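{- Let $\mathtt{P}$ and $\mathtt{Q}$ be finite $\pi$-calculus processes, let $D$ be a distinction, and let $\mathcal{Q}\bar x$ be a quantifier prefix where $\bar x$ contains the free names of $\mathtt{P}$, $\mathtt{Q}$ and $D$. If the formula $\mathcal{Q}\bar x.([\![D]\!]\supset\mathrm{lbisim}\,[\![\mathtt{P}]\!]\,[\![\mathtt{Q}]\!])$ is provable in $FO\lambda^{\Delta\nabla}$ (with definition $\mathbf{D}_\pi$ plus the $\mathrm{lbisim}$ clause) then $\mathtt{P}\sim_o^{D'}\mathtt{Q}$, where $D'$ is the union of $D$ and the $\mathcal{Q}\bar x$-distinction.
   Context: Finite $\pi$-calculus processes, actions and the late transition relation $\xrightarrow{\alpha}$ are as in Milner–Parrow–Walker (prefixes $\bar xy$, $x(y)$, $\tau$, restriction $(x)$, match $[x=y]$, $|$, $+$, $0$; actions $\tau$, $\bar xy$, $xy$ free; $x(y)$, $\bar x(y)$ bound). A distinction is a finite symmetric irreflexive relation on names; a name substitution $\theta$ respects $D$ if $(x,y)\in D$ implies $x\theta\neq y\theta$; $D\theta$ is the image distinction; $\mathrm{fn}(D)$ the names in $D$. An indexed family $\{\mathcal{S}_D\}_D$ of symmetric process relations is an indexed open bisimulation if for every $D$, every $\theta$ respecting $D$, and every $\mathtt{P}\mathcal{S}_D\mathtt{Q}$: (1) if $\mathtt{P}\theta\xrightarrow{\alpha}\mathtt{P}'$, $\alpha$ free, then $\mathtt{Q}\theta\xrightarrow{\alpha}\mathtt{Q}'$ with $\mathtt{P}'\mathcal{S}_{D\theta}\mathtt{Q}'$;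 (2) if $\mathtt{P}\theta\xrightarrow{x(z)}\mathtt{P}'$, $z\notin\mathrm{n}(\mathtt{P}\theta,\mathtt{Q}\theta)$, then $\mathtt{Q}\theta\xrightarrow{x(z)}\mathtt{Q}'$ with $\mathtt{P}'\mathcal{S}_{D\theta}\mathtt{Q}'$; (3) if $\mathtt{P}\theta\xrightarrow{\bar x(z)}\mathtt{P}'$, $z\notin\mathrm{n}(\mathtt{P}\theta,\mathtt{Q}\theta)$, then $\mathtt{Q}\theta\xrightarrow{\bar x(z)}\mathtt{Q}'$ with $\mathtt{P}'\mathcal{S}_{D''}\mathtt{Q}'$ where $D''=D\theta\cup(\{z\}\times\mathrm{fn}(\mathtt{P}\theta,\mathtt{Q}\theta,D\theta))$ (symmetrized). $\mathtt{P}\sim_o^D\mathtt{Q}$ iff $\mathtt{P}\mathcal{S}_D\mathtt{Q}$ for some indexed open bisimulation. A quantifier prefix is $\mathcal{Q}_1x_1\cdots\mathcal{Q}_nx_n$ with each $\mathcal{Q}_i\in\{\forall,\nabla\}$; its $\mathcal{Q}\bar x$-distinction is $\{(x_i,x_j),(x_j,x_i)\mid i\neq j,\ \mathcal{Q}_i=\mathcal{Q}_j=\nabla,\text{ or } i<j,\ \mathcal{Q}_i=\forall,\ \mathcal{Q}_j=\nabla\}$. For $D=\{(x_1,y_1),\dots,(x_n,y_n)\}$, $[\![D]\!]=x_1\neq y_1\land\dots\land x_n\neq y_n$ ($\top$ if $n=0$). $FO\lambda^{\Delta\nabla}$ (Miller–Tiu): intuitionistic sequent calculus over simply typed $\lambda$-terms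 with $\top,\bot,\land,\lor,\supset$, $\forall,\exists$ and the $\nabla$ quantifier (introduced on both sides by adding a fresh locally scoped variable to the judgment's local signature), raising of eigenvariables in $\forall$R/$\exists$L, and stratified definitions $\forall\bar x[p\bar t\triangleq B]$ with defR (unfolding) and defL (case analysis over complete sets of unifiers with the clause heads). Equality by $\forall x[x=x\triangleq\top]$, $s\neq t:=(s=t)\supset\bot$. Encoding (type $n$ of names with no constants, types $p,a$): $[\![\cdot]\!]$ sends $0,+,|,\tau.$ to constants of the same name, $[x=y]\mathtt{P}\mapsto\mathrm{match}\,x\,y[\![\mathtt{P}]\!]$, $\bar xy.\mathtt{P}\mapsto\mathrm{out}\,x\,y[\![\mathtt{P}]\!]$, $x(y).\mathtt{P}\mapsto\mathrm{in}\,x(\lambda y.[\![\mathtt{P}]\!])$, $(x)\mathtt{P}\mapsto\nu(\lambda x.[\![\mathtt{P}]\!])$; actions $\tau:a$, $\downarrow,\uparrow:n\to n\to a$. $\mathbf{D}_\pi$ defines $\mathrm{one}:p\to a\to p\to o$, $\mathrm{onep}:p\to(n\to a)\to(n\to p)\to o$ by: $\mathrm{one}(\tau P)\tau P\triangleq\top$; $\mathrm{onep}(\mathrm{in}XM)(\downarrow X)M\triangleq\top$; $\mathrm{one}(\mathrm{out}\,x\,y\,P)(\uparrow xy)P\triangleq\top$; $\mathrm{one}(\mathrm{match}\,x\,x\,P)AQ\triangleq\mathrm{one}PAQ$ and same for onep; $\mathrm{one}(P+Q)AR\triangleq\mathrm{one}PAR$ / $\mathrm{one}QAR$ and same for onep;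 $\mathrm{one}(P|Q)A(P'|Q)\triangleq\mathrm{one}PAP'$; $\mathrm{one}(P|Q)A(P|Q')\triangleq\mathrm{one}QAQ'$; $\mathrm{onep}(P|Q)A(\lambda n.(Mn|Q))\triangleq\mathrm{onep}PAM$; $\mathrm{onep}(P|Q)A(\lambda n.(P|Nn))\triangleq\mathrm{onep}QAN$; $\mathrm{one}(\nu\lambda n.Pn)A(\nu\lambda n.Qn)\triangleq\nabla n.\mathrm{one}(Pn)A(Qn)$; $\mathrm{onep}(\nu\lambda n.Pn)A(\lambda m.\nu\lambda n.P'nm)\triangleq\nabla n.\mathrm{onep}(Pn)A(P'n)$; $\mathrm{onep}(\nu\lambda n.Mn)(\uparrow X)M'\triangleq\nabla n.\mathrm{one}(Mn)(\uparrow Xn)(M'n)$; $\mathrm{one}(P|Q)\tau(\nu\lambda n.(Mn|Nn))\triangleq\exists X.\mathrm{onep}P(\downarrow X)M\land\mathrm{onep}Q(\uparrow X)N$ and with $\uparrow,\downarrow$ swapped; $\mathrm{one}(P|Q)\tau(MY|Q')\triangleq\exists X.\mathrm{onep}P(\downarrow X)M\land\mathrm{one}Q(\uparrow XY)Q'$; $\mathrm{one}(P|Q)\tau(P'|NY)\triangleq\exists X.\mathrm{one}P(\uparrow XY)P'\land\mathrm{onep}Q(\downarrow X)N$. The $\mathrm{lbisim}$ clause: $\mathrm{lbisim}PQ\triangleq$ conjunction of $\forall A\forall P'[\mathrm{one}PAP'\supset\exists Q'.\mathrm{one}QAQ'\land\mathrm{lbisim}P'Q']$, $\forall A\forall Q'[\mathrm{one}QAQ'\supset\exists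 P'.\mathrm{one}PAP'\land\mathrm{lbisim}Q'P']$, $\forall X\forall P'[\mathrm{onep}P(\downarrow X)P'\supset\exists Q'.\mathrm{onep}Q(\downarrow X)Q'\land\forall w.\mathrm{lbisim}(P'w)(Q'w)]$, its symmetric version (roles of $P,Q$ swapped, recursive call $\mathrm{lbisim}(Q'w)(P'w)$), $\forall X\forall P'[\mathrm{onep}P(\uparrow X)P'\supset\exists Q'.\mathrm{onep}Q(\uparrow X)Q'\land\nabla w.\mathrm{lbisim}(P'w)(Q'w)]$ and its symmetric version. -}

module Defs where

open import Data.Nat using (ℕ; zero; suc; _≡ᵇ_)
open import Data.Fin using (Fin; zero; suc)
open import Data.Bool using (Bool; true; false; if_then_else_)
open import Data.List using (List; []; _∷_; _++_; map; concatMap)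
open import Data.List.Membership.Propositional using (_∈_; _∉_)
open import Data.List.Relation.Unary.All using (All; []; _∷_)
open import Data.Maybe using (Maybe; just; nothing; _>>=_)
import Data.Maybe as Maybe
open import Data.Product using (Σ; Σ-syntax; ∃-syntax; _×_; _,_; proj₁; proj₂)
open import Relation.Binary.PropositionalEquality using (_≡_; _≢_)

-- Part I.  Finite π-calculus (locally nameless: free names are ℕ,
-- bound names are de Bruijn indices, so α-equivalent processes are
-- syntactically equal), late transitions (Milner–Parrow–Walker),
-- distinctions and indexed open bisimulation.

data Nm (k : ℕ) : Set where
  fr : ℕ → Nm k
  bv : Fin k → Nm k

data Proc (k : ℕ) : Set where
  nil    : Proc k
  tauP   : Proc k → Proc k
  outP   : Nm k → Nm k → Proc k → Proc k
  inP    : Nm k → Proc (suc k) → Proc k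
  resP   : Proc (suc k) → Proc k
  matchP : Nm k → Nm k → Proc k → Proc k
  _∣_    : Proc k → Proc k → Proc k
  _⊕_    : Proc k → Proc k → Proc k

shiftNm : ∀ {k} → Nm k → Nm (suc k)
shiftNm (fr x) = fr x
shiftNm (bv i) = bv (suc i)

liftNm : ∀ {k l} → (Nm k → Nm l) → Nm (suc k) → Nm (suc l)
liftNm f (fr x)       = shiftNm (f (fr x))
liftNm f (bv zero)    = bv zero
liftNm f (bv (suc i)) = shiftNm (f (bv i))

mapP : ∀ {k l} → (Nm k → Nm l) → Proc k → Proc l
mapP f nil            = nil
mapP f (tauP P)       = tauP (mapP f P)
mapP f (outP x y P)   = outP (f x) (f y) (mapP f P)
mapP f (inP x P)      = inP (f x) (mapP (liftNm f) P)
mapP f (resP P)       = resP (mapP (liftNm f) P)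
mapP f (matchP x y P) = matchP (f x) (f y) (mapP f P)
mapP f (P ∣ Q)        = mapP f P ∣ mapP f Q
mapP f (P ⊕ Q)        = mapP f P ⊕ mapP f Q

fnNm : ∀ {k} → Nm k → List ℕ
fnNm (fr x) = x ∷ []
fnNm (bv i) = []

fnP : ∀ {k} → Proc k → List ℕ
fnP nil            = []
fnP (tauP P)       = fnP P
fnP (outP x y P)   = fnNm x ++ fnNm y ++ fnP P
fnP (inP x P)      = fnNm x ++ fnP P
fnP (resP P)       = fnP P
fnP (matchP x y P) = fnNm x ++ fnNm y ++ fnP P
fnP (P ∣ Q)        = fnP P ++ fnP Q
fnP (P ⊕ Q)        = fnP P ++ fnP Q

openNm : ∀ {k} → ℕ → Nm (suc k) → Nm k
openNm z (fr x)       = fr x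
openNm z (bv zero)    = fr z
openNm z (bv (suc i)) = bv i

openP : ∀ {k} → Proc (suc k) → ℕ → Proc k
openP P z = mapP (openNm z) P

-- abstracting the free name z (so that resP (closeP z P) is (z)P)
closeNm : ∀ {k} → ℕ → Nm k → Nm (suc k)
closeNm z (fr x) = if x ≡ᵇ z then bv zero else fr x
closeNm z (bv i) = bv (suc i)

closeP : ∀ {k} → ℕ → Proc k → Proc (suc k)
closeP z P = mapP (closeNm z) P

substNm : ∀ {k} → (ℕ → ℕ) → Nm k → Nm k
substNm θ (fr x) = fr (θ x)
substNm θ (bv i) = bv i

substP : ∀ {k} → (ℕ → ℕ) → Proc k → Proc k
substP θ P = mapP (substNm θ) P

[_/_] : ℕ → ℕ → ℕ → ℕ
[ y / z ] w = if w ≡ᵇ z then y else w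

data Act : Set where
  τA    : Act
  outA  : ℕ → ℕ → Act
  inA   : ℕ → ℕ → Act
  binA  : ℕ → ℕ → Act
  boutA : ℕ → ℕ → Act

data IsFree : Act → Set where
  τ-free   : IsFree τA
  out-free : ∀ {x y} → IsFree (outA x y)
  in-free  : ∀ {x y} → IsFree (inA x y)

bnA : Act → List ℕ
bnA (binA x z)  = z ∷ []
bnA (boutA x z) = z ∷ []
bnA _           = []

namesA : Act → List ℕ
namesA τA          = []
namesA (outA x y)  = x ∷ y ∷ []
namesA (inA x y)   = x ∷ y ∷ []
namesA (binA x z)  = x ∷ z ∷ []
namesA (boutA x z) = x ∷ z ∷ []

infix 4 _—[_]→_

-- late transition relation (MPW), on processes without dangling indices
data _—[_]→_ : Proc 0 → Act → Proc 0 → Set where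
  tauT   : ∀ {P} → tauP P —[ τA ]→ P
  outT   : ∀ {x y P} → outP (fr x) (fr y) P —[ outA x y ]→ P
  inT    : ∀ {x z B} → z ∉ fnP B →
           inP (fr x) B —[ binA x z ]→ openP B z
  sumL   : ∀ {P Q α P'} → P —[ α ]→ P' → (P ⊕ Q) —[ α ]→ P'
  sumR   : ∀ {P Q α Q'} → Q —[ α ]→ Q' → (P ⊕ Q) —[ α ]→ Q'
  matchT : ∀ {x P α P'} → P —[ α ]→ P' → matchP (fr x) (fr x) P —[ α ]→ P'
  parL   : ∀ {P Q α P'} → P —[ α ]→ P' → (∀ {z} → z ∈ bnA α → z ∉ fnP Q) →
           (P ∣ Q) —[ α ]→ (P' ∣ Q)
  parR   : ∀ {P Q α Q'} → Q —[ α ]→ Q' → (∀ {z} → z ∈ bnA α → z ∉ fnP P) →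
           (P ∣ Q) —[ α ]→ (P ∣ Q')
  comL   : ∀ {P Q P' Q' x y z} → P —[ outA x y ]→ P' → Q —[ binA x z ]→ Q' →
           (P ∣ Q) —[ τA ]→ (P' ∣ substP [ y / z ] Q')
  comR   : ∀ {P Q P' Q' x y z} → P —[ binA x z ]→ P' → Q —[ outA x y ]→ Q' →
           (P ∣ Q) —[ τA ]→ (substP [ y / z ] P' ∣ Q')
  closeL : ∀ {P Q P' Q' x w} → P —[ boutA x w ]→ P' → Q —[ binA x w ]→ Q' →
           (P ∣ Q) —[ τA ]→ resP (closeP w (P' ∣ Q'))
  closeR : ∀ {P Q P' Q' x w} → P —[ binA x w ]→ P' → Q —[ boutA x w ]→ Q' →
           (P ∣ Q) —[ τA ]→ resP (closeP w (P' ∣ Q'))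
  -- (y)P with y chosen fresh (α-conversion), y ∉ n(α)
  resT   : ∀ {B y α P'} → y ∉ fnP (resP B) → y ∉ namesA α →
           openP B y —[ α ]→ P' → resP B —[ α ]→ resP (closeP y P')
  openT  : ∀ {B y x w P'} → y ∉ fnP (resP B) → y ≢ x →
           openP B y —[ outA x y ]→ P' → w ∉ fnP (resP (closeP y P')) →
           resP B —[ boutA x w ]→ substP [ w / y ] P'

Dist : Set
Dist = List (ℕ × ℕ)

IsDistinction : Dist → Set
IsDistinction D = (∀ {x y} → (x , y) ∈ D → (y , x) ∈ D) × (∀ {x} → (x , x) ∉ D)

Respects : (ℕ → ℕ) → Dist → Set
Respects θ D = ∀ {x y} → (x , y) ∈ D → θ x ≢ θ y

substD : (ℕ → ℕ) → Dist → Dist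
substD θ D = map (λ p → θ (proj₁ p) , θ (proj₂ p)) D

fnD : Dist → List ℕ
fnD D = concatMap (λ p → proj₁ p ∷ proj₂ p ∷ []) D

extD : Dist → ℕ → List ℕ → Dist
extD D z ns = D ++ concatMap (λ y → (z , y) ∷ (y , z) ∷ []) ns

record IsOpenBisim (S : Dist → Proc 0 → Proc 0 → Set) : Set where
  field
    symm : ∀ {D P Q} → S D P Q → S D Q P
    free : ∀ {D P Q} (θ : ℕ → ℕ) → Respects θ D → S D P Q →
           ∀ {α P'} → IsFree α → substP θ P —[ α ]→ P' →
           ∃[ Q' ] (substP θ Q —[ α ]→ Q' × S (substD θ D) P' Q')
    bin  : ∀ {D P Q} (θ : ℕ → ℕ) → Respects θ D → S D P Q →
           ∀ {x z P'} → z ∉ fnP (substP θ P) ++ fnP (substP θ Q) →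
           substP θ P —[ binA x z ]→ P' →
           ∃[ Q' ] (substP θ Q —[ binA x z ]→ Q' × S (substD θ D) P' Q')
    bout : ∀ {D P Q} (θ : ℕ → ℕ) → Respects θ D → S D P Q →
           ∀ {x z P'} → z ∉ fnP (substP θ P) ++ fnP (substP θ Q) →
           substP θ P —[ boutA x z ]→ P' →
           ∃[ Q' ] (substP θ Q —[ boutA x z ]→ Q' ×
                    S (extD (substD θ D) z
                            (fnP (substP θ P) ++ fnP (substP θ Q) ++ fnD (substD θ D)))
                      P' Q')

_∼o[_]_ : Proc 0 → Dist → Proc 0 → Set₁
P ∼o[ D ] Q = Σ[ S ∈ (Dist → Proc 0 → Proc 0 → Set) ] (IsOpenBisim S × S D P Q)

data Quant : Set where
  allQ nabQ : Quant

Prefix : Set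
Prefix = List (Quant × ℕ)

qcond : Quant → Quant → Bool
qcond nabQ nabQ = true
qcond allQ nabQ = true
qcond _    allQ = false

qdist : Prefix → Dist
qdist [] = []
qdist ((q , x) ∷ rest) =
  concatMap (λ qy → if qcond q (proj₁ qy) then (x , proj₂ qy) ∷ (proj₂ qy , x) ∷ [] else []) rest
  ++ qdist rest

infixr 7 _⇒_
data Ty : Set where
  nT pT aT : Ty
  _⇒_ : Ty → Ty → Ty

Ctx : Set
Ctx = List Ty

infix 4 _∋_
data _∋_ : Ctx → Ty → Set where
  here  : ∀ {Γ τ} → (τ ∷ Γ) ∋ τ
  there : ∀ {Γ τ σ} → Γ ∋ τ → (σ ∷ Γ) ∋ τ

data Const : Ty → Set where
  c0          : Const pT
  cPlus cPar  : Const (pT ⇒ pT ⇒ pT)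
  cTau        : Const (pT ⇒ pT)
  cMatch cOut : Const (nT ⇒ nT ⇒ pT ⇒ pT)
  cIn         : Const (nT ⇒ (nT ⇒ pT) ⇒ pT)
  cNu         : Const ((nT ⇒ pT) ⇒ pT)
  aTau        : Const aT
  aDn aUp     : Const (nT ⇒ nT ⇒ aT)

data Tm (Γ : Ctx) : Ty → Set where
  var : ∀ {τ} → Γ ∋ τ → Tm Γ τ
  con : ∀ {τ} → Const τ → Tm Γ τ
  lam : ∀ {σ τ} → Tm (σ ∷ Γ) τ → Tm Γ (σ ⇒ τ)
  app : ∀ {σ τ} → Tm Γ (σ ⇒ τ) → Tm Γ σ → Tm Γ τ

Ren : Ctx → Ctx → Set
Ren Γ Δ = ∀ {τ} → Γ ∋ τ → Δ ∋ τ

Sub : Ctx → Ctx → Set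
Sub Γ Δ = ∀ {τ} → Γ ∋ τ → Tm Δ τ

liftR : ∀ {Γ Δ σ} → Ren Γ Δ → Ren (σ ∷ Γ) (σ ∷ Δ)
liftR r here      = here
liftR r (there x) = there (r x)

ren : ∀ {Γ Δ τ} → Ren Γ Δ → Tm Γ τ → Tm Δ τ
ren r (var x)   = var (r x)
ren r (con c)   = con c
ren r (lam t)   = lam (ren (liftR r) t)
ren r (app t u) = app (ren r t) (ren r u)

liftS : ∀ {Γ Δ σ} → Sub Γ Δ → Sub (σ ∷ Γ) (σ ∷ Δ)
liftS s here      = var here
liftS s (there x) = ren there (s x)

sub : ∀ {Γ Δ τ} → Sub Γ Δ → Tm Γ τ → Tm Δ τ
sub s (var x)   = s x
sub s (con c)   = con c
sub s (lam t)   = lam (sub (liftS s) t)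
sub s (app t u) = app (sub s t) (sub s u)

ext : ∀ {Γ Δ τ} → Sub Γ Δ → Tm Δ τ → Sub (τ ∷ Γ) Δ
ext s u here      = u
ext s u (there x) = s x

_[_]₀ : ∀ {Γ σ τ} → Tm (σ ∷ Γ) τ → Tm Γ σ → Tm Γ τ
t [ u ]₀ = sub (ext var u) t

infix 4 _≈_
data _≈_ {Γ : Ctx} : ∀ {τ} → Tm Γ τ → Tm Γ τ → Set where
  ≈β     : ∀ {σ τ} (t : Tm (σ ∷ Γ) τ) (u : Tm Γ σ) → app (lam t) u ≈ t [ u ]₀
  ≈η     : ∀ {σ τ} (t : Tm Γ (σ ⇒ τ)) → t ≈ lam (app (ren there t) (var here))
  ≈refl  : ∀ {τ} {t : Tm Γ τ} → t ≈ t
  ≈sym   : ∀ {τ} {t u : Tm Γ τ} → t ≈ u → u ≈ t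
  ≈trans : ∀ {τ} {t u v : Tm Γ τ} → t ≈ u → u ≈ v → t ≈ v
  ≈lam   : ∀ {σ τ} {t u : Tm (σ ∷ Γ) τ} → _≈_ {σ ∷ Γ} t u → lam t ≈ lam u
  ≈app   : ∀ {σ τ} {t t' : Tm Γ (σ ⇒ τ)} {u u' : Tm Γ σ} →
           t ≈ t' → u ≈ u' → app t u ≈ app t' u'

data Pred : Set where
  one onep lbisim : Pred
  eqP : Ty → Pred

arity : Pred → List Ty
arity one      = pT ∷ aT ∷ pT ∷ []
arity onep     = pT ∷ (nT ⇒ aT) ∷ (nT ⇒ pT) ∷ []
arity lbisim   = pT ∷ pT ∷ []
arity (eqP τ)  = τ ∷ τ ∷ []

Args : Ctx → List Ty → Set
Args Γ ts = All (Tm Γ) ts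

renA : ∀ {Γ Δ ts} → Ren Γ Δ → Args Γ ts → Args Δ ts
renA r []       = []
renA r (t ∷ ts) = ren r t ∷ renA r ts

subA : ∀ {Γ Δ ts} → Sub Γ Δ → Args Γ ts → Args Δ ts
subA s []       = []
subA s (t ∷ ts) = sub s t ∷ subA s ts

data ArgsEq {Γ : Ctx} : ∀ {ts} → Args Γ ts → Args Γ ts → Set where
  []  : ArgsEq [] []
  _∷_ : ∀ {τ ts} {t u : Tm Γ τ} {as bs : Args Γ ts} →
        t ≈ u → ArgsEq as bs → ArgsEq (t ∷ as) (u ∷ bs)

infixr 6 _∧F_
infixr 5 _∨F_
infixr 4 _⊃F_
data Fm (Γ : Ctx) : Set where
  ⊤F ⊥F : Fm Γ
  _∧F_ _∨F_ _⊃F_ : Fm Γ → Fm Γ → Fm Γ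
  allF exF nabF : (τ : Ty) → Fm (τ ∷ Γ) → Fm Γ
  atom : (p : Pred) → Args Γ (arity p) → Fm Γ

renF : ∀ {Γ Δ} → Ren Γ Δ → Fm Γ → Fm Δ
renF r ⊤F          = ⊤F
renF r ⊥F          = ⊥F
renF r (B ∧F C)    = renF r B ∧F renF r C
renF r (B ∨F C)    = renF r B ∨F renF r C
renF r (B ⊃F C)    = renF r B ⊃F renF r C
renF r (allF τ B)  = allF τ (renF (liftR r) B)
renF r (exF τ B)   = exF τ (renF (liftR r) B)
renF r (nabF τ B)  = nabF τ (renF (liftR r) B)
renF r (atom p as) = atom p (renA r as)

subF : ∀ {Γ Δ} → Sub Γ Δ → Fm Γ → Fm Δ
subF s ⊤F          = ⊤F
subF s ⊥F          = ⊥F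
subF s (B ∧F C)    = subF s B ∧F subF s C
subF s (B ∨F C)    = subF s B ∨F subF s C
subF s (B ⊃F C)    = subF s B ⊃F subF s C
subF s (allF τ B)  = allF τ (subF (liftS s) B)
subF s (exF τ B)   = exF τ (subF (liftS s) B)
subF s (nabF τ B)  = nabF τ (subF (liftS s) B)
subF s (atom p as) = atom p (subA s as)

_[_]F : ∀ {Γ τ} → Fm (τ ∷ Γ) → Tm Γ τ → Fm Γ
B [ t ]F = subF (ext var t) B

infix 4 _≈F_
data _≈F_ {Γ : Ctx} : Fm Γ → Fm Γ → Set where
  ⊤≈ : ⊤F ≈F ⊤F
  ⊥≈ : ⊥F ≈F ⊥F
  ∧≈ : ∀ {B B' C C'} → B ≈F B' → C ≈F C' → (B ∧F C) ≈F (B' ∧F C')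
  ∨≈ : ∀ {B B' C C'} → B ≈F B' → C ≈F C' → (B ∨F C) ≈F (B' ∨F C')
  ⊃≈ : ∀ {B B' C C'} → B ≈F B' → C ≈F C' → (B ⊃F C) ≈F (B' ⊃F C')
  all≈ : ∀ {τ B B'} → _≈F_ {τ ∷ Γ} B B' → allF τ B ≈F allF τ B'
  ex≈  : ∀ {τ B B'} → _≈F_ {τ ∷ Γ} B B' → exF τ B ≈F exF τ B'
  nab≈ : ∀ {τ B B'} → _≈F_ {τ ∷ Γ} B B' → nabF τ B ≈F nabF τ B'
  atom≈ : ∀ {p as bs} → ArgsEq as bs → atom p as ≈F atom p bs

-- context manipulation for local signatures σ (σ is innermost)
liftRN : ∀ σ {Γ Δ} → Ren Γ Δ → Ren (σ ++ Γ) (σ ++ Δ)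
liftRN [] r x = r x
liftRN (s ∷ σ) r here = here
liftRN (s ∷ σ) r (there x) = there (liftRN σ r x)

liftSN : ∀ σ {Γ Δ} → Sub Γ Δ → Sub (σ ++ Γ) (σ ++ Δ)
liftSN [] s x = s x
liftSN (t ∷ σ) s here = var here
liftSN (t ∷ σ) s (there x) = ren there (liftSN σ s x)

injL : ∀ σ {Δ} → Ren σ (σ ++ Δ)
injL (s ∷ σ) here = here
injL (s ∷ σ) (there x) = there (injL σ x)

injR : ∀ σ {Δ} → Ren Δ (σ ++ Δ)
injR [] x = x
injR (s ∷ σ) x = there (injR σ x)

raiseTy : Ctx → Ty → Ty
raiseTy [] τ = τ
raiseTy (s ∷ σ) τ = s ⇒ raiseTy σ τ

spine : ∀ σ {Γ τ} → (∀ {s} → σ ∋ s → Γ ∋ s) → Tm Γ (raiseTy σ τ) → Tm Γ τ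
spine [] r t = t
spine (s ∷ σ) r t = spine σ (λ x → r (there x)) (app t (var (r here)))

-- B[(h σ)/x] for the new eigenvariable h placed at the front of the global signature
raiseSub : ∀ σ τ {G} → Sub (τ ∷ (σ ++ G)) (σ ++ (raiseTy σ τ ∷ G))
raiseSub σ τ = ext (λ x → var (liftRN σ there x))
                   (spine σ (injL σ) (var (injR σ here)))

GJ : Ctx → Set
GJ G = Σ[ σ ∈ Ctx ] Fm (σ ++ G)

renGJ : ∀ {G G'} → Ren G G' → GJ G → GJ G'
renGJ r (σ , B) = σ , renF (liftRN σ r) B

subGJ : ∀ {G G'} → Sub G G' → GJ G → GJ G'
subGJ s (σ , B) = σ , subF (liftSN σ s) B

record Clause (p : Pred) : Set where
  constructor clause
  field
    cv   : Ctx
    head : Args cv (arity p)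
    body : Fm cv

private
  _·_ : ∀ {Γ σ τ} → Tm Γ (σ ⇒ τ) → Tm Γ σ → Tm Γ τ
  _·_ = app
  infixl 9 _·_

  v0 : ∀ {Γ a} → Tm (a ∷ Γ) a
  v0 = var here
  v1 : ∀ {Γ a b} → Tm (b ∷ a ∷ Γ) a
  v1 = var (there here)
  v2 : ∀ {Γ a b c} → Tm (c ∷ b ∷ a ∷ Γ) a
  v2 = var (there (there here))
  v3 : ∀ {Γ a b c d} → Tm (d ∷ c ∷ b ∷ a ∷ Γ) a
  v3 = var (there (there (there here)))
  v4 : ∀ {Γ a b c d e} → Tm (e ∷ d ∷ c ∷ b ∷ a ∷ Γ) a
  v4 = var (there (there (there (there here))))

  wk : ∀ {Γ σ τ} → Tm Γ τ → Tm (σ ∷ Γ) τ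
  wk = ren there

  τ! : ∀ {Γ} → Tm Γ pT → Tm Γ pT
  τ! P = con cTau · P
  out! : ∀ {Γ} → Tm Γ nT → Tm Γ nT → Tm Γ pT → Tm Γ pT
  out! x y P = con cOut · x · y · P
  in! : ∀ {Γ} → Tm Γ nT → Tm Γ (nT ⇒ pT) → Tm Γ pT
  in! x M = con cIn · x · M
  match! : ∀ {Γ} → Tm Γ nT → Tm Γ nT → Tm Γ pT → Tm Γ pT
  match! x y P = con cMatch · x · y · P
  nu! : ∀ {Γ} → Tm Γ (nT ⇒ pT) → Tm Γ pT
  nu! M = con cNu · M
  _+!_ _|!_ : ∀ {Γ} → Tm Γ pT → Tm Γ pT → Tm Γ pT
  P +! Q = con cPlus · P · Q
  P |! Q = con cPar · P · Q
  τa : ∀ {Γ} → Tm Γ aT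
  τa = con aTau
  dn up : ∀ {Γ} → Tm Γ nT → Tm Γ (nT ⇒ aT)
  dn x = con aDn · x
  up x = con aUp · x

  oneA : ∀ {Γ} → Tm Γ pT → Tm Γ aT → Tm Γ pT → Fm Γ
  oneA P A Q = atom one (P ∷ A ∷ Q ∷ [])
  onepA : ∀ {Γ} → Tm Γ pT → Tm Γ (nT ⇒ aT) → Tm Γ (nT ⇒ pT) → Fm Γ
  onepA P A M = atom onep (P ∷ A ∷ M ∷ [])
  lbA : ∀ {Γ} → Tm Γ pT → Tm Γ pT → Fm Γ
  lbA P Q = atom lbisim (P ∷ Q ∷ [])

data Cl : Pred → Set where
  c-tau c-out c-match c-sumL c-sumR c-parL c-parR c-nu
    c-close₁ c-close₂ c-com₁ c-com₂ : Cl one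
  c-in c-matchp c-sumLp c-sumRp c-parLp c-parRp c-nup c-open : Cl onep
  c-lbisim : Cl lbisim
  c-eq : ∀ {τ} → Cl (eqP τ)

-- The clauses.  Clause variables are listed with v0 first.
clauseOf : ∀ {p} → Cl p → Clause p
clauseOf c-tau = clause (pT ∷ []) (τ! v0 ∷ τa ∷ v0 ∷ []) ⊤F
clauseOf c-out = clause (nT ∷ nT ∷ pT ∷ [])
  (out! v0 v1 v2 ∷ up v0 · v1 ∷ v2 ∷ []) ⊤F
clauseOf c-match = clause (nT ∷ pT ∷ aT ∷ pT ∷ [])
  (match! v0 v0 v1 ∷ v2 ∷ v3 ∷ []) (oneA v1 v2 v3)
clauseOf c-sumL = clause (pT ∷ pT ∷ aT ∷ pT ∷ [])
  ((v0 +! v1) ∷ v2 ∷ v3 ∷ []) (oneA v0 v2 v3)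
clauseOf c-sumR = clause (pT ∷ pT ∷ aT ∷ pT ∷ [])
  ((v0 +! v1) ∷ v2 ∷ v3 ∷ []) (oneA v1 v2 v3)
clauseOf c-parL = clause (pT ∷ pT ∷ aT ∷ pT ∷ [])
  ((v0 |! v1) ∷ v2 ∷ (v3 |! v1) ∷ []) (oneA v0 v2 v3)
clauseOf c-parR = clause (pT ∷ pT ∷ aT ∷ pT ∷ [])
  ((v0 |! v1) ∷ v2 ∷ (v0 |! v3) ∷ []) (oneA v1 v2 v3)
clauseOf c-nu = clause ((nT ⇒ pT) ∷ aT ∷ (nT ⇒ pT) ∷ [])
  (nu! (lam (wk v0 · v0)) ∷ v1 ∷ nu! (lam (wk v2 · v0)) ∷ [])
  (nabF nT (oneA (v1 · v0) v2 (v3 · v0)))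
clauseOf c-close₁ = clause (pT ∷ pT ∷ (nT ⇒ pT) ∷ (nT ⇒ pT) ∷ [])
  ((v0 |! v1) ∷ τa ∷ nu! (lam ((wk v2 · v0) |! (wk v3 · v0))) ∷ [])
  (exF nT (onepA v1 (dn v0) v3 ∧F onepA v2 (up v0) v4))
clauseOf c-close₂ = clause (pT ∷ pT ∷ (nT ⇒ pT) ∷ (nT ⇒ pT) ∷ [])
  ((v0 |! v1) ∷ τa ∷ nu! (lam ((wk v2 · v0) |! (wk v3 · v0))) ∷ [])
  (exF nT (onepA v1 (up v0) v3 ∧F onepA v2 (dn v0) v4))
clauseOf c-com₁ = clause (pT ∷ pT ∷ (nT ⇒ pT) ∷ nT ∷ pT ∷ [])
  ((v0 |! v1) ∷ τa ∷ ((v2 · v3) |! v4) ∷ [])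
  (exF nT (onepA v1 (dn v0) v3 ∧F oneA v2 (up v0 · v4) (wk v4)))
clauseOf c-com₂ = clause (pT ∷ pT ∷ pT ∷ (nT ⇒ pT) ∷ nT ∷ [])
  ((v0 |! v1) ∷ τa ∷ (v2 |! (v3 · v4)) ∷ [])
  (exF nT (oneA v1 (up v0 · wk v4) v3 ∧F onepA v2 (dn v0) v4))
clauseOf c-in = clause (nT ∷ (nT ⇒ pT) ∷ [])
  (in! v0 v1 ∷ dn v0 ∷ v1 ∷ []) ⊤F
clauseOf c-matchp = clause (nT ∷ pT ∷ (nT ⇒ aT) ∷ (nT ⇒ pT) ∷ [])
  (match! v0 v0 v1 ∷ v2 ∷ v3 ∷ []) (onepA v1 v2 v3)
clauseOf c-sumLp = clause (pT ∷ pT ∷ (nT ⇒ aT) ∷ (nT ⇒ pT) ∷ [])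
  ((v0 +! v1) ∷ v2 ∷ v3 ∷ []) (onepA v0 v2 v3)
clauseOf c-sumRp = clause (pT ∷ pT ∷ (nT ⇒ aT) ∷ (nT ⇒ pT) ∷ [])
  ((v0 +! v1) ∷ v2 ∷ v3 ∷ []) (onepA v1 v2 v3)
clauseOf c-parLp = clause (pT ∷ pT ∷ (nT ⇒ aT) ∷ (nT ⇒ pT) ∷ [])
  ((v0 |! v1) ∷ v2 ∷ lam ((wk v3 · v0) |! wk v1) ∷ []) (onepA v0 v2 v3)
clauseOf c-parRp = clause (pT ∷ pT ∷ (nT ⇒ aT) ∷ (nT ⇒ pT) ∷ [])
  ((v0 |! v1) ∷ v2 ∷ lam (wk v0 |! (wk v3 · v0)) ∷ []) (onepA v1 v2 v3)
clauseOf c-nup = clause ((nT ⇒ pT) ∷ (nT ⇒ aT) ∷ (nT ⇒ nT ⇒ pT) ∷ [])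
  (nu! (lam (wk v0 · v0)) ∷ v1 ∷ lam (nu! (lam (wk (wk v2) · v0 · v1))) ∷ [])
  (nabF nT (onepA (v1 · v0) v2 (v3 · v0)))
clauseOf c-open = clause ((nT ⇒ pT) ∷ nT ∷ (nT ⇒ pT) ∷ [])
  (nu! (lam (wk v0 · v0)) ∷ up v1 ∷ v2 ∷ [])
  (nabF nT (oneA (v1 · v0) (up v2 · v0) (v3 · v0)))
clauseOf (c-eq {τ}) = clause (τ ∷ []) (v0 ∷ v0 ∷ []) ⊤F
clauseOf c-lbisim = clause (pT ∷ pT ∷ []) (v0 ∷ v1 ∷ [])
  (
     allF aT (allF pT (oneA v2 v1 v0 ⊃F exF pT (oneA v4 v2 v0 ∧F lbA v1 v0)))
  ∧F allF aT (allF pT (oneA v3 v1 v0 ⊃F exF pT (oneA v3 v2 v0 ∧F lbA v1 v0)))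
  ∧F allF nT (allF (nT ⇒ pT) (onepA v2 (dn v1) v0 ⊃F
        exF (nT ⇒ pT) (onepA v4 (dn v2) v0 ∧F allF nT (lbA (v2 · v0) (v1 · v0)))))
  ∧F allF nT (allF (nT ⇒ pT) (onepA v3 (dn v1) v0 ⊃F
        exF (nT ⇒ pT) (onepA v3 (dn v2) v0 ∧F allF nT (lbA (v2 · v0) (v1 · v0)))))
  ∧F allF nT (allF (nT ⇒ pT) (onepA v2 (up v1) v0 ⊃F
        exF (nT ⇒ pT) (onepA v4 (up v2) v0 ∧F nabF nT (lbA (v2 · v0) (v1 · v0)))))
  ∧F allF nT (allF (nT ⇒ pT) (onepA v3 (up v1) v0 ⊃F
        exF (nT ⇒ pT) (onepA v3 (up v2) v0 ∧F nabF nT (lbA (v2 · v0) (v1 · v0))))))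

raiseCtx : Ctx → Ctx → Ctx
raiseCtx σ cv = map (raiseTy σ) cv

raiseVar : ∀ σ {cv τ} → cv ∋ τ → raiseCtx σ cv ∋ raiseTy σ τ
raiseVar σ here = here
raiseVar σ (there x) = there (raiseVar σ x)

-- x̄ ↦ (h̄ σ), with the new variables h̄ in front of the global signature G
raisedInst : ∀ σ cv {G} → Sub cv (σ ++ (raiseCtx σ cv ++ G))
raisedInst σ cv x = spine σ (injL σ) (var (injR σ (injL (raiseCtx σ cv) (raiseVar σ x))))

-- a unifier of (λσ.t̄) with (λσ. s̄[h̄σ/x̄]) for the clause c; the
-- unification variables are the eigenvariables G and the new h̄
record Unifier (G σ : Ctx) {p : Pred} (args : Args (σ ++ G) (arity p)) (c : Cl p) : Set where
  field
    G' : Ctx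
    θ  : Sub (raiseCtx σ (Clause.cv (clauseOf c)) ++ G) G'
    unifies : ArgsEq
      (subA (liftSN σ θ) (renA (liftRN σ (injR (raiseCtx σ (Clause.cv (clauseOf c))))) args))
      (subA (liftSN σ θ) (subA (raisedInst σ (Clause.cv (clauseOf c))) (Clause.head (clauseOf c))))

_≼_ : ∀ {G σ p} {args : Args (σ ++ G) (arity p)} {c : Cl p} →
      Unifier G σ args c → Unifier G σ args c → Set
v ≼ u = Σ[ η ∈ Sub (Unifier.G' u) (Unifier.G' v) ]
          (∀ {τ} x → Unifier.θ v {τ} x ≈ sub η (Unifier.θ u x))

-- the sequent calculus  G ; Γ ⟶ C  (contexts as lists; left rules keep
-- the principal formula, which builds in contraction/weakening/exchange)
data Seq : (G : Ctx) → List (GJ G) → GJ G → Set₁ where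
  init : ∀ {G Γ σ B B'} → (σ , B) ∈ Γ → B ≈F B' → Seq G Γ (σ , B')
  cut  : ∀ {G Γ A C} → Seq G Γ A → Seq G (A ∷ Γ) C → Seq G Γ C
  ⊥L   : ∀ {G Γ σ C} → (σ , ⊥F) ∈ Γ → Seq G Γ C
  ⊤R   : ∀ {G Γ σ} → Seq G Γ (σ , ⊤F)
  ∧L₁  : ∀ {G Γ σ B C D} → (σ , B ∧F C) ∈ Γ → Seq G ((σ , B) ∷ Γ) D → Seq G Γ D
  ∧L₂  : ∀ {G Γ σ B C D} → (σ , B ∧F C) ∈ Γ → Seq G ((σ , C) ∷ Γ) D → Seq G Γ D
  ∧R   : ∀ {G Γ σ B C} → Seq G Γ (σ , B) → Seq G Γ (σ , C) → Seq G Γ (σ , B ∧F C)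
  ∨L   : ∀ {G Γ σ B C D} → (σ , B ∨F C) ∈ Γ →
         Seq G ((σ , B) ∷ Γ) D → Seq G ((σ , C) ∷ Γ) D → Seq G Γ D
  ∨R₁  : ∀ {G Γ σ B C} → Seq G Γ (σ , B) → Seq G Γ (σ , B ∨F C)
  ∨R₂  : ∀ {G Γ σ B C} → Seq G Γ (σ , C) → Seq G Γ (σ , B ∨F C)
  ⊃L   : ∀ {G Γ σ B C D} → (σ , B ⊃F C) ∈ Γ →
         Seq G Γ (σ , B) → Seq G ((σ , C) ∷ Γ) D → Seq G Γ D
  ⊃R   : ∀ {G Γ σ B C} → Seq G ((σ , B) ∷ Γ) (σ , C) → Seq G Γ (σ , B ⊃F C)
  ∀L   : ∀ {G Γ σ τ B D} → (σ , allF τ B) ∈ Γ → (t : Tm (σ ++ G) τ) →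
         Seq G ((σ , B [ t ]F) ∷ Γ) D → Seq G Γ D
  ∀R   : ∀ {G Γ σ τ B} →
         Seq (raiseTy σ τ ∷ G) (map (renGJ there) Γ) (σ , subF (raiseSub σ τ) B) →
         Seq G Γ (σ , allF τ B)
  ∃L   : ∀ {G Γ σ τ B D} → (σ , exF τ B) ∈ Γ →
         Seq (raiseTy σ τ ∷ G) ((σ , subF (raiseSub σ τ) B) ∷ map (renGJ there) Γ)
             (renGJ there D) →
         Seq G Γ D
  ∃R   : ∀ {G Γ σ τ B} → (t : Tm (σ ++ G) τ) →
         Seq G Γ (σ , B [ t ]F) → Seq G Γ (σ , exF τ B)
  ∇L   : ∀ {G Γ σ τ B D} → (σ , nabF τ B) ∈ Γ →
         Seq G ((τ ∷ σ , B) ∷ Γ) D → Seq G Γ D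
  ∇R   : ∀ {G Γ σ τ B} → Seq G Γ (τ ∷ σ , B) → Seq G Γ (σ , nabF τ B)
  defR : ∀ {G Γ σ p} {args : Args (σ ++ G) (arity p)} (c : Cl p) →
         (u : Sub (Clause.cv (clauseOf c)) (σ ++ G)) →
         ArgsEq args (subA u (Clause.head (clauseOf c))) →
         Seq G Γ (σ , subF u (Clause.body (clauseOf c))) →
         Seq G Γ (σ , atom p args)
  -- for every clause, a complete set of unifiers (indexed by I c), and a
  -- premise for each of its members
  defL : ∀ {G Γ σ p D} {args : Args (σ ++ G) (arity p)} →
         (σ , atom p args) ∈ Γ →
         (I : Cl p → Set) →
         (us : ∀ c → I c → Unifier G σ args c) →
         (∀ c (v : Unifier G σ args c) → Σ[ i ∈ I c ] (v ≼ us c i)) →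
         (∀ c (i : I c) →
            let hs = raiseCtx σ (Clause.cv (clauseOf c))
                u  = us c i
                θ  = Unifier.θ u
            in Seq (Unifier.G' u)
                   ((σ , subF (liftSN σ θ)
                             (subF (raisedInst σ (Clause.cv (clauseOf c)))
                                   (Clause.body (clauseOf c))))
                    ∷ map (λ A → subGJ θ (renGJ (injR hs) A)) Γ)
                   (subGJ θ (renGJ (injR hs) D))) →
         Seq G Γ D

⊢_ : Fm [] → Set₁
⊢ F = Seq [] [] ([] , F)

Env : Ctx → Set
Env Γ = ℕ → Maybe (Tm Γ nT)

wkEnv : ∀ {Γ σ} → Env Γ → Env (σ ∷ Γ)
wkEnv ρ x = Maybe.map (ren there) (ρ x)

extBv : ∀ {Γ k} → (Fin k → Tm Γ nT) → Fin (suc k) → Tm (nT ∷ Γ) nT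
extBv β zero    = var here
extBv β (suc i) = ren there (β i)

encNm : ∀ {Γ k} → Env Γ → (Fin k → Tm Γ nT) → Nm k → Maybe (Tm Γ nT)
encNm ρ β (fr x) = ρ x
encNm ρ β (bv i) = just (β i)

encP : ∀ {Γ k} → Env Γ → (Fin k → Tm Γ nT) → Proc k → Maybe (Tm Γ pT)
encP ρ β nil = just (con c0)
encP ρ β (tauP P) = encP ρ β P >>= λ p → just (app (con cTau) p)
encP ρ β (outP x y P) =
  encNm ρ β x >>= λ x' → encNm ρ β y >>= λ y' → encP ρ β P >>= λ p →
  just (app (app (app (con cOut) x') y') p)
encP ρ β (inP x P) =
  encNm ρ β x >>= λ x' → encP (wkEnv ρ) (extBv β) P >>= λ p →
  just (app (app (con cIn) x') (lam p))
encP ρ β (resP P) = encP (wkEnv ρ) (extBv β) P >>= λ p → just (app (con cNu) (lam p))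
encP ρ β (matchP x y P) =
  encNm ρ β x >>= λ x' → encNm ρ β y >>= λ y' → encP ρ β P >>= λ p →
  just (app (app (app (con cMatch) x') y') p)
encP ρ β (P ∣ Q) = encP ρ β P >>= λ p → encP ρ β Q >>= λ q →
  just (app (app (con cPar) p) q)
encP ρ β (P ⊕ Q) = encP ρ β P >>= λ p → encP ρ β Q >>= λ q →
  just (app (app (con cPlus) p) q)

noBv : ∀ {Γ} → Fin 0 → Tm Γ nT
noBv ()

neqF : ∀ {Γ} → Tm Γ nT → Tm Γ nT → Fm Γ
neqF s t = atom (eqP nT) (s ∷ t ∷ []) ⊃F ⊥F

encD : ∀ {Γ} → Env Γ → Dist → Maybe (Fm Γ)
encD ρ [] = just ⊤F
encD ρ ((x , y) ∷ []) = ρ x >>= λ x' → ρ y >>= λ y' → just (neqF x' y')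
encD ρ ((x , y) ∷ d ∷ D) =
  ρ x >>= λ x' → ρ y >>= λ y' → encD ρ (d ∷ D) >>= λ r → just (neqF x' y' ∧F r)

bindName : ∀ {Γ} → ℕ → Env Γ → Env (nT ∷ Γ)
bindName x ρ y = if y ≡ᵇ x then just (var here) else wkEnv ρ y

quantF : ∀ {Γ} → Quant → Fm (nT ∷ Γ) → Fm Γ
quantF allQ B = allF nT B
quantF nabQ B = nabF nT B

-- 𝒬x̄.([[D]] ⊃ lbisim [[P]] [[Q]])  (nothing if some free name is not in x̄)
encGoal : ∀ {Γ} → Env Γ → Prefix → Dist → Proc 0 → Proc 0 → Maybe (Fm Γ)
encGoal ρ [] D P Q =
  encD ρ D >>= λ d → encP ρ noBv P >>= λ p → encP ρ noBv Q >>= λ q →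
  just (d ⊃F atom lbisim (p ∷ q ∷ []))
encGoal ρ ((q , x) ∷ pre) D P Q = Maybe.map (quantF q) (encGoal (bindName x ρ) pre D P Q)

emptyEnv : Env []
emptyEnv _ = nothing

module Submission where

{-
Terms modulo βη give a Kripke model: a world is a context of eigenvariables with a finite set of
inequations between names, its futures are the substitutions that keep the inequations true, and a
judgment σ ▷ B is evaluated with σ held fixed.  Implication and ∀ quantify over futures, ∇ extends
σ, and atoms are interpreted inductively by their clauses.  Since a forced atom yields a unifier with
the head of a clause, every complete set of unifiers covers it, which makes defL sound; the
inequations let worlds satisfy [[D]], so that a witness found there serves every later instance.

A prefix is read off at its generic world: a ∇-name is a local variable, and a ∀-name is an
eigenvariable raised over the ∇-names to its left, so it may still become one of them but no later
one.  A substitution θ of names that respects the distinction is then realised by a substitution of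
eigenvariables, with the images arranged in a new prefix.  At such a world distinct names denote
distinct terms, so provable one and onep atoms are exactly the late transitions, and the processes
related by lbisim at such worlds form an open bisimulation.
-}

-- The calculus has `cut`, and `defL` ranges over arbitrary complete sets of unifiers; soundness in
-- a model needs neither cut elimination nor a unification algorithm. Three obstacles shape the
-- rest. Conversion is an inductive relation, so that two terms differ is invisible until
-- normalisation by evaluation supplies canonical forms. Next, `lbisim` occurs in its own clause
-- below implications; the model exists because the antecedents there speak of `one` and `onep`
-- only, whose interpretation is complete before that of `lbisim` begins. Last, a prefix keeps every
-- name ever read, whereas a bound output separates the new z only from names that still occur in
-- the processes or the distinction. A respectful θ may thus identify z with a forgotten name, which
-- no substitution of eigenvariables can realise; prefixes are therefore controlled only on names
-- that still matter. Moreover z, though fresh for the processes, may occur in the distinction; the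
-- extended distinction then contains (z , z) and no substitution respects it, so the bisimulation
-- is stated for irreflexive distinctions.

open import Defs
open import Data.Bool using (true; false; T; if_then_else_)
open import Data.Empty using (⊥; ⊥-elim)
open import Data.Fin using (Fin; zero; suc)
open import Data.List using (List; []; _∷_; map; _++_; concatMap)
open import Data.List.Membership.Propositional using (_∈_; _∉_)
open import Data.List.Membership.Propositional.Properties
  using (∈-++⁻; ∈-++⁺ˡ; ∈-++⁺ʳ; ∈-map⁺; ∈-map⁻)
open import Data.List.Relation.Unary.All using (All; []; _∷_)
open import Data.List.Relation.Unary.Any using (here; there)
open import Data.List.Relation.Unary.Unique.Propositional using (Unique)
open import Data.Maybe using (Maybe; just; _>>=_)
import Data.Maybe as Maybe
open import Data.Nat using (ℕ; zero; suc; _≡ᵇ_; _≤_; _≟_)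
open import Data.Nat.ListAction using (sum)
open import Data.Nat.Properties using (≡ᵇ⇒≡; m≤m+n; m≤n+m; ≤-trans; <-irrefl)
open import Data.List.Membership.DecPropositional _≟_ using (_∈?_)
open import Data.Product using (Σ; Σ-syntax; ∃-syntax; _×_; _,_; proj₁; proj₂)
import Data.Product as Prod
open import Data.Sum using (_⊎_; inj₁; inj₂)
import Data.Sum as Sum
open import Data.Unit using (⊤; tt)
open import Function using (_∘_)
open import Relation.Nullary using (¬_; yes; no)
open import Relation.Binary.PropositionalEquality
  using (_≡_; _≢_; refl; sym; trans; cong; cong₂; subst)

-- Substitution and βη-equality

ren-cong : ∀ {Γ Δ} {r r' : Ren Γ Δ} → (∀ {τ} (x : Γ ∋ τ) → r x ≡ r' x) →
           ∀ {τ} (t : Tm Γ τ) → ren r t ≡ ren r' t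
ren-cong e (var x)   = cong var (e x)
ren-cong e (con c)   = refl
ren-cong e (lam t)   = cong lam (ren-cong (λ { here → refl ; (there x) → cong there (e x) }) t)
ren-cong e (app t u) = cong₂ app (ren-cong e t) (ren-cong e u)

ren-ren : ∀ {Γ Δ Θ} {r' : Ren Δ Θ} {r : Ren Γ Δ} {τ} (t : Tm Γ τ) →
          ren r' (ren r t) ≡ ren (λ x → r' (r x)) t
ren-ren (var x)   = refl
ren-ren (con c)   = refl
ren-ren (lam t)   =
  cong lam (trans (ren-ren t) (ren-cong (λ { here → refl ; (there x) → refl }) t))
ren-ren (app t u) = cong₂ app (ren-ren t) (ren-ren u)

sub-cong : ∀ {Γ Δ} {s s' : Sub Γ Δ} → (∀ {τ} (x : Γ ∋ τ) → s x ≡ s' x) →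
           ∀ {τ} (t : Tm Γ τ) → sub s t ≡ sub s' t
sub-cong e (var x)   = e x
sub-cong e (con c)   = refl
sub-cong e (lam t)   =
  cong lam (sub-cong (λ { here → refl ; (there x) → cong (ren there) (e x) }) t)
sub-cong e (app t u) = cong₂ app (sub-cong e t) (sub-cong e u)

sub-ren : ∀ {Γ Δ Θ} {s : Sub Δ Θ} {r : Ren Γ Δ} {τ} (t : Tm Γ τ) →
          sub s (ren r t) ≡ sub (λ x → s (r x)) t
sub-ren (var x)   = refl
sub-ren (con c)   = refl
sub-ren (lam t)   =
  cong lam (trans (sub-ren t) (sub-cong (λ { here → refl ; (there x) → refl }) t))
sub-ren (app t u) = cong₂ app (sub-ren t) (sub-ren u)

ren-wk : ∀ {Γ Δ} {r : Ren Γ Δ} {σ τ} (t : Tm Γ τ) →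
         ren (liftR {σ = σ} r) (ren there t) ≡ ren there (ren r t)
ren-wk t = trans (ren-ren t) (sym (ren-ren t))

ren-sub : ∀ {Γ Δ Θ} {r : Ren Δ Θ} {s : Sub Γ Δ} {τ} (t : Tm Γ τ) →
          ren r (sub s t) ≡ sub (λ x → ren r (s x)) t
ren-sub (var x)   = refl
ren-sub (con c)   = refl
ren-sub {s = s} (lam t)   =
  cong lam (trans (ren-sub t) (sub-cong (λ { here → refl ; (there x) → ren-wk (s x) }) t))
ren-sub (app t u) = cong₂ app (ren-sub t) (ren-sub u)

sub-wk : ∀ {Γ Δ} {s : Sub Γ Δ} {σ τ} (t : Tm Γ τ) →
         sub (liftS {σ = σ} s) (ren there t) ≡ ren there (sub s t)
sub-wk t = trans (sub-ren t) (sym (ren-sub t))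

sub-sub : ∀ {Γ Δ Θ} {s' : Sub Δ Θ} {s : Sub Γ Δ} {τ} (t : Tm Γ τ) →
          sub s' (sub s t) ≡ sub (λ x → sub s' (s x)) t
sub-sub (var x)   = refl
sub-sub (con c)   = refl
sub-sub {s = s} (lam t)   =
  cong lam (trans (sub-sub t) (sub-cong (λ { here → refl ; (there x) → sub-wk (s x) }) t))
sub-sub (app t u) = cong₂ app (sub-sub t) (sub-sub u)

sub-ren-var : ∀ {Γ Δ} {r : Ren Γ Δ} {τ} (t : Tm Γ τ) → sub (λ x → var (r x)) t ≡ ren r t
sub-ren-var (var x)   = refl
sub-ren-var (con c)   = refl
sub-ren-var (lam t)   =
  cong lam (trans (sub-cong (λ { here → refl ; (there x) → refl }) t) (sub-ren-var t))
sub-ren-var (app t u) = cong₂ app (sub-ren-var t) (sub-ren-var u)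

ren-id : ∀ {Γ τ} (t : Tm Γ τ) → ren (λ x → x) t ≡ t
ren-id (var x)   = refl
ren-id (con c)   = refl
ren-id (lam t)   =
  cong lam (trans (ren-cong (λ { here → refl ; (there x) → refl }) t) (ren-id t))
ren-id (app t u) = cong₂ app (ren-id t) (ren-id u)

sub-id : ∀ {Γ} {s : Sub Γ Γ} → (∀ {τ} (x : Γ ∋ τ) → s x ≡ var x) →
         ∀ {τ} (t : Tm Γ τ) → sub s t ≡ t
sub-id e t = trans (sub-cong e t) (trans (sub-ren-var t) (ren-id t))

wk-[]₀ : ∀ {Γ σ τ} (t : Tm Γ τ) {u : Tm Γ σ} → ren there t [ u ]₀ ≡ t
wk-[]₀ t = trans (sub-ren t) (sub-id (λ _ → refl) t)

≡⇒≈ : ∀ {Γ τ} {t u : Tm Γ τ} → t ≡ u → t ≈ u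
≡⇒≈ refl = ≈refl

infix 4 _≈S_
_≈S_ : ∀ {Γ Δ} → Sub Γ Δ → Sub Γ Δ → Set
_≈S_ {Γ} s s' = ∀ {τ} (x : Γ ∋ τ) → s x ≈ s' x

sub-≈ : ∀ {Γ Δ} {s : Sub Γ Δ} {τ} {t u : Tm Γ τ} → t ≈ u → sub s t ≈ sub s u
sub-≈ {s = s} (≈β t u) = ≈trans (≈β _ _) (≡⇒≈ (trans (sub-sub t) (trans
  (sub-cong (λ { here → refl ; (there x) → wk-[]₀ (s x) }) t)
  (sym (sub-sub t)))))
sub-≈ (≈η t) = ≈trans (≈η _) (≈lam (≈app (≡⇒≈ (sym (sub-wk t))) ≈refl))
sub-≈ ≈refl = ≈refl
sub-≈ (≈sym e) = ≈sym (sub-≈ e)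
sub-≈ (≈trans e f) = ≈trans (sub-≈ e) (sub-≈ f)
sub-≈ (≈lam e) = ≈lam (sub-≈ e)
sub-≈ (≈app e f) = ≈app (sub-≈ e) (sub-≈ f)

ren-≈ : ∀ {Γ Δ} {r : Ren Γ Δ} {τ} {t u : Tm Γ τ} → t ≈ u → ren r t ≈ ren r u
ren-≈ {t = t} {u} e =
  ≈trans (≡⇒≈ (sym (sub-ren-var t))) (≈trans (sub-≈ e) (≡⇒≈ (sub-ren-var u)))

liftS-≈S : ∀ {Γ Δ} {s s' : Sub Γ Δ} {σ} → s ≈S s' → liftS {σ = σ} s ≈S liftS s'
liftS-≈S e here      = ≈refl
liftS-≈S e (there x) = ren-≈ (e x)

sub-≈S : ∀ {Γ Δ} {s s' : Sub Γ Δ} → s ≈S s' → ∀ {τ} (t : Tm Γ τ) → sub s t ≈ sub s' t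
sub-≈S e (var x)   = e x
sub-≈S e (con c)   = ≈refl
sub-≈S e (lam t)   = ≈lam (sub-≈S (liftS-≈S e) t)
sub-≈S e (app t u) = ≈app (sub-≈S e t) (sub-≈S e u)

≈β-≡ : ∀ {Γ σ τ} {t : Tm (σ ∷ Γ) τ} {u : Tm Γ σ} {v} → t [ u ]₀ ≡ v → app (lam t) u ≈ v
≈β-≡ e = ≈trans (≈β _ _) (≡⇒≈ e)

η-lam : ∀ {Γ σ τ} {t : Tm Γ (σ ⇒ τ)} {u : Tm (σ ∷ Γ) τ} →
        app (ren there t) (var here) ≈ u → t ≈ lam u
η-lam e = ≈trans (≈η _) (≈lam e)

lam-wk-β : ∀ {Γ σ τ} (t : Tm (σ ∷ Γ) τ) → app (ren there (lam t)) (var here) ≈ t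
lam-wk-β t = ≈β-≡ (trans (sub-ren t) (sub-id (λ { here → refl ; (there x) → refl }) t))

lam-inj : ∀ {Γ σ τ} {t u : Tm (σ ∷ Γ) τ} → lam t ≈ lam u → t ≈ u
lam-inj {t = t} {u} e =
  ≈trans (≈sym (lam-wk-β t)) (≈trans (≈app (ren-≈ e) ≈refl) (lam-wk-β u))

-- Normalisation by evaluation

data Base : Ty → Set where
  nB : Base nT
  pB : Base pT
  aB : Base aT

-- η-long β-normal forms: `emb` admits a neutral term only at a base type, so a normal form of arrow
-- type is always an abstraction.
mutual
  data Ne (Γ : Ctx) : Ty → Set where
    nvar : ∀ {τ} → Γ ∋ τ → Ne Γ τ
    ncon : ∀ {τ} → Const τ → Ne Γ τ
    napp : ∀ {σ τ} → Ne Γ (σ ⇒ τ) → Nf Γ σ → Ne Γ τ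

  data Nf (Γ : Ctx) : Ty → Set where
    emb  : ∀ {τ} → Base τ → Ne Γ τ → Nf Γ τ
    nlam : ∀ {σ τ} → Nf (σ ∷ Γ) τ → Nf Γ (σ ⇒ τ)

mutual
  ⌜_⌝ne : ∀ {Γ τ} → Ne Γ τ → Tm Γ τ
  ⌜ nvar x ⌝ne   = var x
  ⌜ ncon c ⌝ne   = con c
  ⌜ napp n m ⌝ne = app ⌜ n ⌝ne ⌜ m ⌝

  ⌜_⌝ : ∀ {Γ τ} → Nf Γ τ → Tm Γ τ
  ⌜ emb _ n ⌝ = ⌜ n ⌝ne
  ⌜ nlam m ⌝ = lam ⌜ m ⌝

mutual
  renNe : ∀ {Γ Δ τ} → Ren Γ Δ → Ne Γ τ → Ne Δ τ
  renNe r (nvar x)   = nvar (r x)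
  renNe r (ncon c)   = ncon c
  renNe r (napp n m) = napp (renNe r n) (renNf r m)

  renNf : ∀ {Γ Δ τ} → Ren Γ Δ → Nf Γ τ → Nf Δ τ
  renNf r (emb b n) = emb b (renNe r n)
  renNf r (nlam m) = nlam (renNf (liftR r) m)

liftR-cong : ∀ {Γ Δ σ} {r r' : Ren Γ Δ} → (∀ {τ} (x : Γ ∋ τ) → r x ≡ r' x) →
             ∀ {τ} (x : (σ ∷ Γ) ∋ τ) → liftR r x ≡ liftR r' x
liftR-cong e here      = refl
liftR-cong e (there x) = cong there (e x)

mutual
  renNe-cong : ∀ {Γ Δ} {r r' : Ren Γ Δ} → (∀ {τ} (x : Γ ∋ τ) → r x ≡ r' x) →
               ∀ {τ} (n : Ne Γ τ) → renNe r n ≡ renNe r' n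
  renNe-cong e (nvar x)   = cong nvar (e x)
  renNe-cong e (ncon c)   = refl
  renNe-cong e (napp n m) = cong₂ napp (renNe-cong e n) (renNf-cong e m)

  renNf-cong : ∀ {Γ Δ} {r r' : Ren Γ Δ} → (∀ {τ} (x : Γ ∋ τ) → r x ≡ r' x) →
               ∀ {τ} (n : Nf Γ τ) → renNf r n ≡ renNf r' n
  renNf-cong e (emb b n) = cong (emb b) (renNe-cong e n)
  renNf-cong e (nlam m) = cong nlam (renNf-cong (liftR-cong e) m)

mutual
  renNe-ren : ∀ {Γ Δ Θ} {r' : Ren Δ Θ} {r : Ren Γ Δ} {τ} (n : Ne Γ τ) →
              renNe r' (renNe r n) ≡ renNe (λ x → r' (r x)) n
  renNe-ren (nvar x)   = refl
  renNe-ren (ncon c)   = refl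
  renNe-ren (napp n m) = cong₂ napp (renNe-ren n) (renNf-ren m)

  renNf-ren : ∀ {Γ Δ Θ} {r' : Ren Δ Θ} {r : Ren Γ Δ} {τ} (n : Nf Γ τ) →
              renNf r' (renNf r n) ≡ renNf (λ x → r' (r x)) n
  renNf-ren (emb b n) = cong (emb b) (renNe-ren n)
  renNf-ren (nlam m) =
    cong nlam (trans (renNf-ren m) (renNf-cong (λ { here → refl ; (there x) → refl }) m))

mutual
  renNe-id : ∀ {Γ} {r : Ren Γ Γ} → (∀ {τ} (x : Γ ∋ τ) → r x ≡ x) →
             ∀ {τ} (n : Ne Γ τ) → renNe r n ≡ n
  renNe-id e (nvar x)   = cong nvar (e x)
  renNe-id e (ncon c)   = refl
  renNe-id e (napp n m) = cong₂ napp (renNe-id e n) (renNf-id e m)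

  renNf-id : ∀ {Γ} {r : Ren Γ Γ} → (∀ {τ} (x : Γ ∋ τ) → r x ≡ x) →
             ∀ {τ} (n : Nf Γ τ) → renNf r n ≡ n
  renNf-id e (emb b n) = cong (emb b) (renNe-id e n)
  renNf-id e (nlam m) =
    cong nlam (renNf-id (λ { here → refl ; (there x) → cong there (e x) }) m)

mutual
  ⌜ren⌝ne : ∀ {Γ Δ} {r : Ren Γ Δ} {τ} (n : Ne Γ τ) → ⌜ renNe r n ⌝ne ≡ ren r ⌜ n ⌝ne
  ⌜ren⌝ne (nvar x)   = refl
  ⌜ren⌝ne (ncon c)   = refl
  ⌜ren⌝ne (napp n m) = cong₂ app (⌜ren⌝ne n) (⌜ren⌝ m)

  ⌜ren⌝ : ∀ {Γ Δ} {r : Ren Γ Δ} {τ} (n : Nf Γ τ) → ⌜ renNf r n ⌝ ≡ ren r ⌜ n ⌝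
  ⌜ren⌝ (emb b n) = ⌜ren⌝ne n
  ⌜ren⌝ (nlam m) = cong lam (⌜ren⌝ m)

-- At a base type a value is a neutral term, so related values there are syntactically equal.
-- Injectivity and clashes of constants will be read off from this.
Val : Ctx → Ty → Set
Val Γ nT      = Ne Γ nT
Val Γ pT      = Ne Γ pT
Val Γ aT      = Ne Γ aT
Val Γ (σ ⇒ τ) = ∀ Δ → Ren Γ Δ → Val Δ σ → Val Δ τ

renV : ∀ τ {Γ Δ} → Ren Γ Δ → Val Γ τ → Val Δ τ
renV nT r n      = renNe r n
renV pT r n      = renNe r n
renV aT r n      = renNe r n
renV (σ ⇒ τ) r f = λ Θ r' v → f Θ (λ x → r' (r x)) v

infix 4 _≗R_
_≗R_ : ∀ {Γ Δ} → Ren Γ Δ → Ren Γ Δ → Set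
_≗R_ {Γ} r r' = ∀ {τ} (x : Γ ∋ τ) → r x ≡ r' x

-- The naturality component makes up for the function space of Val, which has no naturality of its own.
EQ : ∀ τ {Γ} → Val Γ τ → Val Γ τ → Set
EQ nT n m = n ≡ m
EQ pT n m = n ≡ m
EQ aT n m = n ≡ m
EQ (σ ⇒ τ) {Γ} f g =
  (∀ {Δ} (r r' : Ren Γ Δ) → r ≗R r' → ∀ {a b} → EQ σ a b → EQ τ (f Δ r a) (g Δ r' b))
  × (∀ {Δ Θ} (r : Ren Γ Δ) (r' : Ren Δ Θ) (r'' : Ren Γ Θ) → (λ x → r' (r x)) ≗R r'' →
     ∀ {a b} → EQ σ a b → EQ τ (renV τ r' (f Δ r a)) (g Θ r'' (renV σ r' b)))

EQ-ren : ∀ τ {Γ Δ} (r r' : Ren Γ Δ) → r ≗R r' →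
         ∀ {v w} → EQ τ v w → EQ τ (renV τ r v) (renV τ r' w)
EQ-ren nT r r' e {v} refl = renNe-cong e v
EQ-ren pT r r' e {v} refl = renNe-cong e v
EQ-ren aT r r' e {v} refl = renNe-cong e v
EQ-ren (σ ⇒ τ) r r' e (p , q) =
  (λ s s' e' ab → p _ _ (λ x → trans (e' (r x)) (cong s' (e x))) ab) ,
  (λ s s' s'' e' ab →
     q _ s' _ (λ x → trans (e' (r x)) (cong s'' (e x))) ab)

mutual
  EQ-sym : ∀ τ {Γ} {v w : Val Γ τ} → EQ τ v w → EQ τ w v
  EQ-sym nT e = sym e
  EQ-sym pT e = sym e
  EQ-sym aT e = sym e
  EQ-sym (σ ⇒ τ) (p , q) =
    (λ r r' e ab → EQ-sym τ (p r' r (λ x → sym (e x)) (EQ-sym σ ab))) ,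
    (λ r r' r'' e ab →
       EQ-trans τ (EQ-ren τ r' r' (λ _ → refl) (EQ-sym τ (p r r (λ _ → refl) (EQ-reflˡ σ ab))))
      (EQ-trans τ (q r r' r'' e (EQ-reflˡ σ ab))
         (EQ-sym τ (p r'' r'' (λ _ → refl)
           (EQ-ren σ r' r' (λ _ → refl) (EQ-sym σ ab))))))

  EQ-trans : ∀ τ {Γ} {u v w : Val Γ τ} → EQ τ u v → EQ τ v w → EQ τ u w
  EQ-trans nT e f = trans e f
  EQ-trans pT e f = trans e f
  EQ-trans aT e f = trans e f
  EQ-trans (σ ⇒ τ) (p , q) (p' , q') =
    (λ r r' e ab →
       EQ-trans τ (p r r (λ _ → refl) (EQ-reflˡ σ ab)) (p' r r' e ab)) ,
    (λ r r' r'' e ab →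
       EQ-trans τ (EQ-ren τ r' r' (λ _ → refl) (p r r (λ _ → refl) (EQ-reflˡ σ ab)))
                  (q' r r' r'' e ab))

  EQ-reflˡ : ∀ τ {Γ} {v w : Val Γ τ} → EQ τ v w → EQ τ v v
  EQ-reflˡ τ e = EQ-trans τ e (EQ-sym τ e)

EQ-reflʳ : ∀ τ {Γ} {v w : Val Γ τ} → EQ τ v w → EQ τ w w
EQ-reflʳ τ e = EQ-reflˡ τ (EQ-sym τ e)

EQ-ren-ren : ∀ τ {Γ Δ Θ} (r : Ren Γ Δ) (r' : Ren Δ Θ) (r'' : Ren Γ Θ) →
             (λ x → r' (r x)) ≗R r'' → ∀ {v w} → EQ τ v w →
             EQ τ (renV τ r' (renV τ r v)) (renV τ r'' w)
EQ-ren-ren nT r r' r'' e {v} refl = trans (renNe-ren v) (renNe-cong e v)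
EQ-ren-ren pT r r' r'' e {v} refl = trans (renNe-ren v) (renNe-cong e v)
EQ-ren-ren aT r r' r'' e {v} refl = trans (renNe-ren v) (renNe-cong e v)
EQ-ren-ren (σ ⇒ τ) r r' r'' e vw = EQ-ren (σ ⇒ τ) (λ x → r' (r x)) r'' e vw

EQ-ren-id : ∀ τ {Γ} {v w : Val Γ τ} → EQ τ v w → EQ τ (renV τ (λ x → x) v) w
EQ-ren-id nT {v = v} refl = renNe-id (λ _ → refl) v
EQ-ren-id pT {v = v} refl = renNe-id (λ _ → refl) v
EQ-ren-id aT {v = v} refl = renNe-id (λ _ → refl) v
EQ-ren-id (σ ⇒ τ) vw = vw

mutual
  reflect : ∀ τ {Γ} → Ne Γ τ → Val Γ τ
  reflect nT n = n
  reflect pT n = n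
  reflect aT n = n
  reflect (σ ⇒ τ) n = λ Δ r v → reflect τ (napp (renNe r n) (reify σ v))

  reify : ∀ τ {Γ} → Val Γ τ → Nf Γ τ
  reify nT n = emb nB n
  reify pT n = emb pB n
  reify aT n = emb aB n
  reify (σ ⇒ τ) f = nlam (reify τ (f _ there (reflect σ (nvar here))))

mutual
  reflect-EQ : ∀ τ {Γ} {n m : Ne Γ τ} → n ≡ m → EQ τ (reflect τ n) (reflect τ m)
  reflect-EQ nT e = e
  reflect-EQ pT e = e
  reflect-EQ aT e = e
  reflect-EQ (σ ⇒ τ) {n = n} refl =
    (λ r r' e ab → reflect-EQ τ (cong₂ napp (renNe-cong e n) (reify-EQ σ ab))) ,
    (λ r r' r'' e ab → EQ-trans τ (reflect-ren τ r' _)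
      (reflect-EQ τ (cong₂ napp (trans (renNe-ren n) (renNe-cong e n)) (reify-ren σ r' ab))))

  reflect-ren : ∀ τ {Γ Δ} (r : Ren Γ Δ) (n : Ne Γ τ) →
                EQ τ (renV τ r (reflect τ n)) (reflect τ (renNe r n))
  reflect-ren nT r n = refl
  reflect-ren pT r n = refl
  reflect-ren aT r n = refl
  reflect-ren (σ ⇒ τ) r n =
    (λ s s' e ab → reflect-EQ τ (cong₂ napp
       (trans (sym (renNe-ren n)) (renNe-cong e (renNe r n))) (reify-EQ σ ab))) ,
    (λ s s' s'' e ab → EQ-trans τ (reflect-ren τ s' _) (reflect-EQ τ (cong₂ napp
       (trans (renNe-ren n) (trans (renNe-cong (λ x → e (r x)) n) (sym (renNe-ren n))))
       (reify-ren σ s' ab))))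

  reify-EQ : ∀ τ {Γ} {v w : Val Γ τ} → EQ τ v w → reify τ v ≡ reify τ w
  reify-EQ nT e = cong (emb nB) e
  reify-EQ pT e = cong (emb pB) e
  reify-EQ aT e = cong (emb aB) e
  reify-EQ (σ ⇒ τ) (p , q) =
    cong nlam (reify-EQ τ (p there there (λ _ → refl) (reflect-EQ σ refl)))

  reify-ren : ∀ τ {Γ Δ} (r : Ren Γ Δ) {v w : Val Γ τ} → EQ τ v w →
              renNf r (reify τ v) ≡ reify τ (renV τ r w)
  reify-ren nT r refl = refl
  reify-ren pT r refl = refl
  reify-ren aT r refl = refl
  reify-ren (σ ⇒ τ) r (p , q) = cong nlam (trans
    (reify-ren τ (liftR r) (p there there (λ _ → refl) (reflect-EQ σ refl)))
    (reify-EQ τ (EQ-trans τ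
      (EQ-sym τ (EQ-ren τ (liftR r) (liftR r) (λ _ → refl)
        (p there there (λ _ → refl) (reflect-EQ σ refl))))
      (EQ-trans τ (q there (liftR r) (λ x → there (r x)) (λ _ → refl) (reflect-EQ σ refl))
        (EQ-trans τ (EQ-sym τ (p _ _ (λ _ → refl) (EQ-reflˡ σ (EQ-ren σ (liftR r) (liftR r) (λ _ → refl) (reflect-EQ σ refl)))))
         (p _ _ (λ _ → refl) (reflect-ren σ (liftR r) (nvar here))))))))

VEnv : Ctx → Ctx → Set
VEnv Γ Δ = ∀ {τ} → Γ ∋ τ → Val Δ τ

EQE : ∀ {Γ Δ} → VEnv Γ Δ → VEnv Γ Δ → Set
EQE {Γ} ρ ρ' = ∀ {τ} (x : Γ ∋ τ) → EQ τ (ρ x) (ρ' x)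

EQE-sym : ∀ {Γ Δ} {ρ ρ' : VEnv Γ Δ} → EQE ρ ρ' → EQE ρ' ρ
EQE-sym e {τ} x = EQ-sym τ (e x)

EQE-reflˡ : ∀ {Γ Δ} {ρ ρ' : VEnv Γ Δ} → EQE ρ ρ' → EQE ρ ρ
EQE-reflˡ e {τ} x = EQ-reflˡ τ (e x)

EQE-reflʳ : ∀ {Γ Δ} {ρ ρ' : VEnv Γ Δ} → EQE ρ ρ' → EQE ρ' ρ'
EQE-reflʳ e {τ} x = EQ-reflʳ τ (e x)

renE : ∀ {Γ Δ Θ} → Ren Δ Θ → VEnv Γ Δ → VEnv Γ Θ
renE r ρ {τ} x = renV τ r (ρ x)

extE : ∀ {Γ Δ τ} → VEnv Γ Δ → Val Δ τ → VEnv (τ ∷ Γ) Δ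
extE ρ v here      = v
extE ρ v (there x) = ρ x

eval : ∀ {Γ Δ τ} → Tm Γ τ → VEnv Γ Δ → Val Δ τ
eval (var x)   ρ = ρ x
eval (con c)   ρ = reflect _ (ncon c)
eval (lam t)   ρ = λ Θ r v → eval t (extE (renE r ρ) v)
eval (app t u) ρ = eval t ρ _ (λ x → x) (eval u ρ)

extE-EQ : ∀ {Γ Δ τ} {ρ ρ' : VEnv Γ Δ} → EQE ρ ρ' → ∀ {v w} → EQ τ v w →
          EQE (extE {τ = τ} ρ v) (extE ρ' w)
extE-EQ e vw here      = vw
extE-EQ e vw (there x) = e x

renE-EQ : ∀ {Γ Δ Θ} {ρ ρ' : VEnv Γ Δ} (r r' : Ren Δ Θ) → r ≗R r' → EQE ρ ρ' →
          EQE (renE r ρ) (renE r' ρ')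
renE-EQ r r' e ρρ' {τ} x = EQ-ren τ r r' e (ρρ' x)

mutual
  eval-EQ : ∀ {Γ Δ τ} (t : Tm Γ τ) {ρ ρ' : VEnv Γ Δ} → EQE ρ ρ' →
            EQ τ (eval t ρ) (eval t ρ')
  eval-EQ (var x)   e = e x
  eval-EQ (con c)   e = reflect-EQ _ refl
  eval-EQ {τ = σ ⇒ τ} (lam t) {ρ} {ρ'} e =
    (λ r r' f ab → eval-EQ t (extE-EQ (renE-EQ r r' f e) ab)) ,
    (λ r r' r'' f ab → EQ-trans τ
      (eval-ren t r' (extE-EQ (renE-EQ r r (λ _ → refl) e) ab))
      (eval-EQ t λ
        { here → EQ-reflʳ σ (EQ-ren σ r' r' (λ _ → refl) ab)
        ; (there {τ = τ'} x) → EQ-ren-ren τ' r r' r'' f (EQ-reflʳ τ' (e x)) }))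
  eval-EQ (app t u) e = proj₁ (eval-EQ t e) _ _ (λ _ → refl) (eval-EQ u e)

  eval-ren : ∀ {Γ Δ Θ τ} (t : Tm Γ τ) (r : Ren Δ Θ) {ρ ρ' : VEnv Γ Δ} → EQE ρ ρ' →
             EQ τ (renV τ r (eval t ρ)) (eval t (renE r ρ'))
  eval-ren {τ = τ} (var x) r e = EQ-ren τ r r (λ _ → refl) (e x)
  eval-ren {τ = τ} (con c) r e = reflect-ren τ r (ncon c)
  eval-ren {τ = σ ⇒ τ} (lam t) r {ρ} {ρ'} e =
    (λ s s' f ab → eval-EQ t (extE-EQ
       (λ {τ'} x → EQ-sym τ' (EQ-ren-ren τ' r s' _ (λ y → sym (f (r y))) (EQ-sym τ' (e x)))) ab)) ,
    (λ s s' s'' f ab → EQ-trans τ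
      (eval-ren t s' (extE-EQ (λ {τ'} x → EQ-ren τ' _ _ (λ _ → refl) (e x)) ab))
      (eval-EQ t λ
        { here → EQ-reflʳ σ (EQ-ren σ s' s' (λ _ → refl) ab)
        ; (there {τ = τ'} x) → EQ-trans τ'
            (EQ-ren-ren τ' _ s' _ (λ y → f (r y)) (EQ-reflʳ τ' (e x)))
            (EQ-sym τ' (EQ-ren-ren τ' r s'' _ (λ _ → refl) (EQ-reflʳ τ' (e x)))) }))
  eval-ren {τ = τ} (app {σ = σ} t u) r e = EQ-trans τ
    (proj₂ (eval-EQ t (EQE-reflˡ e)) (λ x → x) r r (λ _ → refl)
      (eval-EQ u e))
    (EQ-trans τ
      (proj₁ (eval-EQ t e) r r (λ _ → refl) (eval-ren u r (EQE-reflʳ e)))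
      (proj₁ (eval-ren t r (EQE-reflʳ e)) (λ x → x) (λ x → x) (λ _ → refl)
        (eval-EQ u (renE-EQ r r (λ _ → refl) (EQE-reflʳ e)))))

eval-of-ren : ∀ {Γ Γ' Δ τ} (t : Tm Γ τ) (r : Ren Γ Γ') {ρ : VEnv Γ' Δ} {ρ' : VEnv Γ Δ} →
              EQE (λ x → ρ (r x)) ρ' → EQ τ (eval (ren r t) ρ) (eval t ρ')
eval-of-ren (var x) r e = e x
eval-of-ren (con c) r e = reflect-EQ _ refl
eval-of-ren {τ = σ ⇒ τ} (lam t) r {ρ} {ρ'} e =
  (λ s s' f ab → eval-of-ren t (liftR r) λ
     { here → ab ; (there {τ = τ'} x) → EQ-ren τ' s s' f (e x) }) ,
  (λ s s' s'' f ab → EQ-trans τ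
     (EQ-ren τ s' s' (λ _ → refl) (eval-of-ren t (liftR r) λ
       { here → ab ; (there {τ = τ'} x) → EQ-ren τ' s s (λ _ → refl) (e x) }))
     (EQ-trans τ (eval-ren t s' (extE-EQ (λ {τ'} x → EQ-ren τ' s s (λ _ → refl) (EQ-reflʳ τ' (e x))) (EQ-reflʳ σ ab)))
     (eval-EQ t λ
        { here → EQ-reflʳ σ (EQ-ren σ s' s' (λ _ → refl) ab)
        ; (there {τ = τ'} x) → EQ-ren-ren τ' s s' s'' f (EQ-reflʳ τ' (e x)) })))
eval-of-ren (app t u) r e =
  proj₁ (eval-of-ren t r e) (λ x → x) (λ x → x) (λ _ → refl) (eval-of-ren u r e)

-- `EQ` is only a partial equivalence, so an environment need not be related to itself; `EQE ρ ρ₁`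
-- certifies that `ρ` is.
eval-of-sub : ∀ {Γ Γ' Δ τ} (t : Tm Γ τ) (s : Sub Γ Γ') {ρ ρ₁ : VEnv Γ' Δ} {ρ' : VEnv Γ Δ} →
              EQE ρ ρ₁ → EQE (λ x → eval (s x) ρ) ρ' → EQ τ (eval (sub s t) ρ) (eval t ρ')
eval-of-sub (var x) s d e = e x
eval-of-sub (con c) s d e = reflect-EQ _ refl
eval-of-sub {τ = σ ⇒ τ} (lam t) s {ρ} {ρ₁} {ρ'} d e =
  (λ r r' f ab → body r r' f ab) ,
  (λ r r' r'' f ab → EQ-trans τ
     (EQ-ren τ r' r' (λ _ → refl) (body r r (λ _ → refl) ab))
     (EQ-trans τ (eval-ren t r' (extE-EQ (λ {τ'} x → EQ-ren τ' r r (λ _ → refl) (EQ-reflʳ τ' (e x))) (EQ-reflʳ σ ab)))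
     (eval-EQ t λ
        { here → EQ-reflʳ σ (EQ-ren σ r' r' (λ _ → refl) ab)
        ; (there {τ = τ'} x) → EQ-ren-ren τ' r r' r'' f (EQ-reflʳ τ' (e x)) })))
  where
  body : ∀ {Θ} (r r' : Ren _ Θ) → r ≗R r' → ∀ {a b} → EQ σ a b →
         EQ τ (eval (sub (liftS s) t) (extE (renE r ρ) a)) (eval t (extE (renE r' ρ') b))
  body r r' f ab = eval-of-sub t (liftS s) (extE-EQ (renE-EQ r r (λ _ → refl) d) ab) λ
     { here → ab
     ; (there {τ = τ'} x) → EQ-trans τ'
         (eval-of-ren (s x) there (renE-EQ r r (λ _ → refl) (EQE-reflˡ d)))
         (EQ-trans τ' (EQ-sym τ' (eval-ren (s x) r (EQE-reflˡ d)))
           (EQ-ren τ' r r' f (e x))) }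
eval-of-sub (app t u) s d e =
  proj₁ (eval-of-sub t s d e) (λ x → x) (λ x → x) (λ _ → refl) (eval-of-sub u s d e)

-- Convertible terms evaluate to related values, and `reify` sends related values to equal normal
-- forms: this is how inequality of normal forms refutes conversion.
eval-≈ : ∀ {Γ Δ τ} {t u : Tm Γ τ} → t ≈ u → {ρ ρ' : VEnv Γ Δ} → EQE ρ ρ' →
         EQ τ (eval t ρ) (eval u ρ')
eval-≈ {τ = τ} (≈β t u) {ρ} {ρ'} e = EQ-trans τ
  (eval-EQ t {ρ' = extE ρ' (eval u ρ')} λ
     { here → eval-EQ u e ; (there {τ = τ'} x) → EQ-ren-id τ' (e x) })
  (EQ-sym τ (eval-of-sub t (ext var u) (EQE-reflʳ e) λ
     { here → eval-EQ u (EQE-reflʳ e) ; (there {τ = τ'} x) → EQ-reflʳ τ' (e x) }))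
eval-≈ {τ = σ ⇒ τ} (≈η t) {ρ} {ρ'} e =
  (λ r r' f ab → core r r' f ab) ,
  (λ r r' r'' f ab → EQ-trans τ
     (proj₂ (eval-EQ t (EQE-reflˡ e)) r r' r'' f ab)
     (core r'' r'' (λ _ → refl) (EQ-reflʳ σ (EQ-ren σ r' r' (λ _ → refl) ab))))
  where
  core : ∀ {Θ} (r r' : Ren _ Θ) → r ≗R r' → ∀ {a b} → EQ σ a b →
         EQ τ (eval t ρ Θ r a) (eval (ren there t) (extE (renE r' ρ') b) Θ (λ x → x) b)
  core r r' f ab = EQ-trans τ
    (proj₁ (EQ-ren (σ ⇒ τ) r r' f (eval-EQ t e)) (λ x → x) (λ x → x) (λ _ → refl) ab)
    (EQ-trans τ
    (proj₁ (eval-ren t r' (EQE-reflʳ e)) (λ x → x) (λ x → x) (λ _ → refl) (EQ-reflʳ σ ab))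
    (EQ-sym τ (proj₁ (eval-of-ren t there (renE-EQ r' r' (λ _ → refl) (EQE-reflʳ e)))
       (λ x → x) (λ x → x) (λ _ → refl) (EQ-reflʳ σ ab))))
eval-≈ (≈refl {t = t}) e = eval-EQ t e
eval-≈ {τ = τ} (≈sym p) e = EQ-sym τ (eval-≈ p (EQE-sym e))
eval-≈ {τ = τ} (≈trans p q) e =
  EQ-trans τ (eval-≈ p (EQE-reflˡ e)) (eval-≈ q e)
eval-≈ {τ = σ ⇒ τ} (≈lam {u = u} p) e =
  (λ r r' f ab → eval-≈ p (extE-EQ (renE-EQ r r' f e) ab)) ,
  (λ r r' r'' f ab → EQ-trans τ
     (EQ-ren τ r' r' (λ _ → refl) (eval-≈ p (extE-EQ (renE-EQ r r (λ _ → refl) e) ab)))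
     (EQ-trans τ (eval-ren u r' (extE-EQ (λ {τ'} x → EQ-ren τ' r r (λ _ → refl) (EQ-reflʳ τ' (e x))) (EQ-reflʳ σ ab)))
     (eval-EQ u λ
        { here → EQ-reflʳ σ (EQ-ren σ r' r' (λ _ → refl) ab)
        ; (there {τ = τ'} x) → EQ-ren-ren τ' r r' r'' f (EQ-reflʳ τ' (e x)) })))
eval-≈ (≈app p q) e = proj₁ (eval-≈ p e) (λ x → x) (λ x → x) (λ _ → refl) (eval-≈ q e)

idE : ∀ {Γ} → VEnv Γ Γ
idE x = reflect _ (nvar x)

idE-EQ : ∀ {Γ} → EQE (idE {Γ}) idE
idE-EQ {τ = τ} x = reflect-EQ τ refl

nf : ∀ {Γ τ} → Tm Γ τ → Nf Γ τ
nf {τ = τ} t = reify τ (eval t idE)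

-- Logical relation between terms and values. At the identity environment it yields `≈nf`, and with
-- it the converse direction: equal normal forms imply convertibility.
R : ∀ τ {Γ} → Tm Γ τ → Val Γ τ → Set
R nT t n = t ≈ ⌜ n ⌝ne
R pT t n = t ≈ ⌜ n ⌝ne
R aT t n = t ≈ ⌜ n ⌝ne
R (σ ⇒ τ) {Γ} t f =
  ∀ {Δ} (r : Ren Γ Δ) {u v} → R σ u v → R τ (app (ren r t) u) (f Δ r v)

R-≈ : ∀ τ {Γ} {t t' : Tm Γ τ} {v} → t ≈ t' → R τ t v → R τ t' v
R-≈ nT e p = ≈trans (≈sym e) p
R-≈ pT e p = ≈trans (≈sym e) p
R-≈ aT e p = ≈trans (≈sym e) p
R-≈ (σ ⇒ τ) e p r q = R-≈ τ (≈app (ren-≈ e) ≈refl) (p r q)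

R-ren : ∀ τ {Γ Δ} (r : Ren Γ Δ) {t : Tm Γ τ} {v} → R τ t v → R τ (ren r t) (renV τ r v)
R-ren nT r {v = v} p = ≈trans (ren-≈ p) (≡⇒≈ (sym (⌜ren⌝ne v)))
R-ren pT r {v = v} p = ≈trans (ren-≈ p) (≡⇒≈ (sym (⌜ren⌝ne v)))
R-ren aT r {v = v} p = ≈trans (ren-≈ p) (≡⇒≈ (sym (⌜ren⌝ne v)))
R-ren (σ ⇒ τ) r {t} p s q = R-≈ τ (≈app (≡⇒≈ (sym (ren-ren t))) ≈refl) (p _ q)

mutual
  R-reflect : ∀ τ {Γ} {t : Tm Γ τ} {n} → t ≈ ⌜ n ⌝ne → R τ t (reflect τ n)
  R-reflect nT e = e
  R-reflect pT e = e
  R-reflect aT e = e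
  R-reflect (σ ⇒ τ) {n = n} e r q =
    R-reflect τ (≈app (≈trans (ren-≈ e) (≡⇒≈ (sym (⌜ren⌝ne n)))) (R-reify σ q))

  R-reify : ∀ τ {Γ} {t : Tm Γ τ} {v} → R τ t v → t ≈ ⌜ reify τ v ⌝
  R-reify nT p = p
  R-reify pT p = p
  R-reify aT p = p
  R-reify (σ ⇒ τ) p = η-lam (R-reify τ (p there (R-reflect σ ≈refl)))

eval-R : ∀ {Γ Δ τ} (t : Tm Γ τ) {s : Sub Γ Δ} {ρ : VEnv Γ Δ} →
         (∀ {σ} (x : Γ ∋ σ) → R σ (s x) (ρ x)) → R τ (sub s t) (eval t ρ)
eval-R (var x) h = h x
eval-R (con c) h = R-reflect _ ≈refl
eval-R {τ = σ ⇒ τ} (lam t) {s} h r {u} q = R-≈ τ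
  (≈sym (≈β-≡ (trans (sub-ren (sub (liftS s) t)) (sub-sub t))))
  (eval-R t λ { here → q
              ; (there {τ = τ'} x) → R-≈ τ' (≡⇒≈ (sym
                  (trans (sub-ren (s x)) (sub-ren-var (s x))))) (R-ren τ' r (h x)) })
eval-R {τ = τ} (app t u) {s} h =
  R-≈ τ (≈app (≡⇒≈ (ren-id (sub s t))) ≈refl) (eval-R t h (λ x → x) (eval-R u h))

≈nf : ∀ {Γ τ} (t : Tm Γ τ) → t ≈ ⌜ nf t ⌝
≈nf {τ = τ} t = ≈trans (≡⇒≈ (sym (sub-id (λ _ → refl) t)))
  (R-reify τ (eval-R t (λ {σ} x → R-reflect σ ≈refl)))

nf-≡⇒≈ : ∀ {Γ τ} {t u : Tm Γ τ} → nf t ≡ nf u → t ≈ u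
nf-≡⇒≈ {t = t} {u} e = ≈trans (≈nf t) (≈trans (≡⇒≈ (cong ⌜_⌝ e)) (≈sym (≈nf u)))

Neutral : ∀ {Γ τ} → Tm Γ τ → Set
Neutral (var x)   = ⊤
Neutral (con c)   = ⊤
Neutral (lam t)   = ⊥
Neutral (app t u) = Neutral t

toNe : ∀ {Γ τ} (t : Tm Γ τ) → Neutral t → Ne Γ τ
toNe (var x)   p = nvar x
toNe (con c)   p = ncon c
toNe (app t u) p = napp (toNe t p) (nf u)

eval-toNe : ∀ {Γ τ} (t : Tm Γ τ) (p : Neutral t) → EQ τ (eval t idE) (reflect τ (toNe t p))
eval-toNe {τ = τ} (var x) p = reflect-EQ τ refl
eval-toNe {τ = τ} (con c) p = reflect-EQ τ refl
eval-toNe {τ = τ} (app t u) p = EQ-trans τ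
  (proj₁ (eval-toNe t p) (λ x → x) (λ x → x) (λ _ → refl) (eval-EQ u idE-EQ))
  (reflect-EQ τ (cong₂ napp (renNe-id (λ _ → refl) (toNe t p)) refl))

-- At a base type `reflect` is the identity, so the value of a neutral term is its `toNe`.
-- Convertible neutral terms hence share their head and have equal normal arguments.
toNe-≈ : ∀ {Γ τ} → Base τ → {t u : Tm Γ τ} (p : Neutral t) (q : Neutral u) → t ≈ u →
         toNe t p ≡ toNe u q
toNe-≈ nB {t} {u} p q e = trans (sym (eval-toNe t p)) (trans (eval-≈ e idE-EQ) (eval-toNe u q))
toNe-≈ pB {t} {u} p q e = trans (sym (eval-toNe t p)) (trans (eval-≈ e idE-EQ) (eval-toNe u q))
toNe-≈ aB {t} {u} p q e = trans (sym (eval-toNe t p)) (trans (eval-≈ e idE-EQ) (eval-toNe u q))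

data Head (Γ : Ctx) : Set where
  hvar : ∀ {τ} → Γ ∋ τ → Head Γ
  hcon : ∀ {τ} → Const τ → Head Γ

headNe : ∀ {Γ τ} → Ne Γ τ → Head Γ
headNe (nvar x)   = hvar x
headNe (ncon c)   = hcon c
headNe (napp n _) = headNe n

head : ∀ {Γ τ} (t : Tm Γ τ) → Neutral t → Head Γ
head (var x)   _ = hvar x
head (con c)   _ = hcon c
head (app t _) p = head t p

head-toNe : ∀ {Γ τ} (t : Tm Γ τ) (p : Neutral t) → headNe (toNe t p) ≡ head t p
head-toNe (var x)   p = refl
head-toNe (con c)   p = refl
head-toNe (app t _) p = head-toNe t p

head-≈ : ∀ {Γ τ} → Base τ → {t u : Tm Γ τ} (p : Neutral t) (q : Neutral u) → t ≈ u →
         head t p ≡ head u q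
head-≈ b {t} {u} p q e =
  trans (sym (head-toNe t p)) (trans (cong headNe (toNe-≈ b p q e)) (head-toNe u q))

napp-inj : ∀ {Γ σ τ} {n n' : Ne Γ (σ ⇒ τ)} {m m' : Nf Γ σ} →
           napp n m ≡ napp n' m' → n ≡ n' × m ≡ m'
napp-inj refl = refl , refl

con-inj₁ : ∀ {Γ σ τ} → Base τ → {c : Const (σ ⇒ τ)} {a a' : Tm Γ σ} →
           app (con c) a ≈ app (con c) a' → a ≈ a'
con-inj₁ b e = nf-≡⇒≈ (proj₂ (napp-inj (toNe-≈ b tt tt e)))

con-inj₂ : ∀ {Γ σ₁ σ₂ τ} → Base τ → {c : Const (σ₁ ⇒ σ₂ ⇒ τ)}
           {a a' : Tm Γ σ₁} {b b' : Tm Γ σ₂} →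
           app (app (con c) a) b ≈ app (app (con c) a') b' → a ≈ a' × b ≈ b'
con-inj₂ B e with napp-inj (toNe-≈ B tt tt e)
... | e₁ , e₂ = nf-≡⇒≈ (proj₂ (napp-inj e₁)) , nf-≡⇒≈ e₂

con-inj₃ : ∀ {Γ σ₁ σ₂ σ₃ τ} → Base τ → {c : Const (σ₁ ⇒ σ₂ ⇒ σ₃ ⇒ τ)}
           {a a' : Tm Γ σ₁} {b b' : Tm Γ σ₂} {d d' : Tm Γ σ₃} →
           app (app (app (con c) a) b) d ≈ app (app (app (con c) a') b') d' →
           a ≈ a' × b ≈ b' × d ≈ d'
con-inj₃ B e with napp-inj (toNe-≈ B tt tt e)
... | e₁ , e₂ with napp-inj e₁
... | e₃ , e₄ = nf-≡⇒≈ (proj₂ (napp-inj e₃)) , nf-≡⇒≈ e₄ , nf-≡⇒≈ e₂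

-- A Kripke model of the logic

infixr 9 _⊙_
_⊙_ : ∀ {Γ Δ Θ} → Sub Δ Θ → Sub Γ Δ → Sub Γ Θ
(s' ⊙ s) x = sub s' (s x)

ext-≈S : ∀ {Γ Δ τ} {s s' : Sub Γ Δ} {t t' : Tm Δ τ} → s ≈S s' → t ≈ t' → ext s t ≈S ext s' t'
ext-≈S e f here      = f
ext-≈S e f (there x) = e x

liftSN-≈S : ∀ σ {Γ Δ} {s s' : Sub Γ Δ} → s ≈S s' → liftSN σ s ≈S liftSN σ s'
liftSN-≈S [] e x              = e x
liftSN-≈S (_ ∷ σ) e here      = ≈refl
liftSN-≈S (_ ∷ σ) e (there x) = ren-≈ (liftSN-≈S σ e x)

liftSN-cong : ∀ σ {Γ Δ} {s s' : Sub Γ Δ} → (∀ {τ} (x : Γ ∋ τ) → s x ≡ s' x) →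
              ∀ {τ} (x : (σ ++ Γ) ∋ τ) → liftSN σ s x ≡ liftSN σ s' x
liftSN-cong [] e x              = e x
liftSN-cong (_ ∷ σ) e here      = refl
liftSN-cong (_ ∷ σ) e (there x) = cong (ren there) (liftSN-cong σ e x)

ren-liftSN : ∀ σ {Γ Δ Θ} (r : Ren Δ Θ) (s : Sub Γ Δ) {τ} (x : (σ ++ Γ) ∋ τ) →
             ren (liftRN σ r) (liftSN σ s x) ≡ liftSN σ (λ y → ren r (s y)) x
ren-liftSN [] r s x              = refl
ren-liftSN (_ ∷ σ) r s here      = refl
ren-liftSN (_ ∷ σ) r s (there x) = trans (ren-ren (liftSN σ s x))
  (trans (sym (ren-ren (liftSN σ s x))) (cong (ren there) (ren-liftSN σ r s x)))

liftSN-⊙ : ∀ σ {Γ Δ Θ} (s' : Sub Δ Θ) (s : Sub Γ Δ) {τ} (x : (σ ++ Γ) ∋ τ) →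
           sub (liftSN σ s') (liftSN σ s x) ≡ liftSN σ (s' ⊙ s) x
liftSN-⊙ [] s' s x              = refl
liftSN-⊙ (_ ∷ σ) s' s here      = refl
liftSN-⊙ (_ ∷ σ) s' s (there x) =
  trans (sub-ren (liftSN σ s x)) (trans (sym (ren-sub (liftSN σ s x)))
    (cong (ren there) (liftSN-⊙ σ s' s x)))

liftSN-var : ∀ σ {Γ τ} (x : (σ ++ Γ) ∋ τ) → liftSN σ {Γ} var x ≡ var x
liftSN-var [] x              = refl
liftSN-var (_ ∷ σ) here      = refl
liftSN-var (_ ∷ σ) (there x) = cong (ren there) (liftSN-var σ x)

liftSN-ren : ∀ σ {Γ Δ Θ} (s : Sub Δ Θ) (r : Ren Γ Δ) {τ} (x : (σ ++ Γ) ∋ τ) →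
             liftSN σ s (liftRN σ r x) ≡ liftSN σ (λ y → s (r y)) x
liftSN-ren [] s r x              = refl
liftSN-ren (_ ∷ σ) s r here      = refl
liftSN-ren (_ ∷ σ) s r (there x) = cong (ren there) (liftSN-ren σ s r x)

ArgsEq-sym : ∀ {Γ ts} {as bs : Args Γ ts} → ArgsEq as bs → ArgsEq bs as
ArgsEq-sym []      = []
ArgsEq-sym (e ∷ p) = ≈sym e ∷ ArgsEq-sym p

ArgsEq-trans : ∀ {Γ ts} {as bs cs : Args Γ ts} → ArgsEq as bs → ArgsEq bs cs → ArgsEq as cs
ArgsEq-trans [] []            = []
ArgsEq-trans (e ∷ p) (f ∷ q)  = ≈trans e f ∷ ArgsEq-trans p q

subA-≈ : ∀ {Γ Δ ts} {s : Sub Γ Δ} {as bs : Args Γ ts} → ArgsEq as bs → ArgsEq (subA s as) (subA s bs)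
subA-≈ []      = []
subA-≈ (e ∷ p) = sub-≈ e ∷ subA-≈ p

subA-≈S : ∀ {Γ Δ ts} {s s' : Sub Γ Δ} → s ≈S s' → (as : Args Γ ts) → ArgsEq (subA s as) (subA s' as)
subA-≈S e []       = []
subA-≈S e (t ∷ as) = sub-≈S e t ∷ subA-≈S e as

subA-⊙ : ∀ {Γ Δ Θ ts} {s' : Sub Δ Θ} {s : Sub Γ Δ} (as : Args Γ ts) →
         ArgsEq (subA s' (subA s as)) (subA (s' ⊙ s) as)
subA-⊙ []       = []
subA-⊙ (t ∷ as) = ≡⇒≈ (sub-sub t) ∷ subA-⊙ as

subA-fuse : ∀ {Γ Δ Θ ts} {s : Sub Δ Θ} {r : Sub Γ Δ} {s' : Sub Γ Θ} → s' ≈S s ⊙ r →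
            (as : Args Γ ts) → ArgsEq (subA s (subA r as)) (subA s' as)
subA-fuse e as = ArgsEq-trans (subA-⊙ as) (ArgsEq-sym (subA-≈S e as))

renA-subA : ∀ {Γ Δ ts} {r : Ren Γ Δ} (as : Args Γ ts) → renA r as ≡ subA (λ x → var (r x)) as
renA-subA []       = refl
renA-subA (t ∷ as) = cong₂ _∷_ (sym (sub-ren-var t)) (renA-subA as)

renF-subF : ∀ {Γ Δ} {r : Ren Γ Δ} {s : Sub Γ Δ} → (∀ {τ} (x : Γ ∋ τ) → s x ≡ var (r x)) →
            (B : Fm Γ) → renF r B ≡ subF s B
renF-subF-lift : ∀ {Γ Δ σ} {r : Ren Γ Δ} {s : Sub Γ Δ} → (∀ {τ} (x : Γ ∋ τ) → s x ≡ var (r x)) →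
                 (B : Fm (σ ∷ Γ)) → renF (liftR r) B ≡ subF (liftS s) B
renF-subF-lift e = renF-subF λ { here → refl ; (there x) → cong (ren there) (e x) }
renF-subF e ⊤F          = refl
renF-subF e ⊥F          = refl
renF-subF e (B ∧F C)    = cong₂ _∧F_ (renF-subF e B) (renF-subF e C)
renF-subF e (B ∨F C)    = cong₂ _∨F_ (renF-subF e B) (renF-subF e C)
renF-subF e (B ⊃F C)    = cong₂ _⊃F_ (renF-subF e B) (renF-subF e C)
renF-subF e (allF τ B)  = cong (allF τ) (renF-subF-lift e B)
renF-subF e (exF τ B)   = cong (exF τ) (renF-subF-lift e B)
renF-subF e (nabF τ B)  = cong (nabF τ) (renF-subF-lift e B)
renF-subF {r = r} {s} e (atom p as) = cong (atom p) (trans (renA-subA as) (go as))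
  where
  go : ∀ {ts} (as : Args _ ts) → subA (λ x → var (r x)) as ≡ subA s as
  go []       = refl
  go (t ∷ as) = cong₂ _∷_ (sub-cong (λ x → sym (e x)) t) (go as)

-- Derivability of `one`, `onep` and equality. Their clause bodies contain neither ∀ nor
-- implication, so no futures are consulted and the relation is closed under every substitution of
-- eigenvariables (`Der-sub`). `Pos₀` is ⊥ on the connectives that do not occur there.
mutual
  data Der : ∀ p G σ → Args (σ ++ G) (arity p) → Set where
    der : ∀ {p G σ args} (c : Cl p) (u : Sub (Clause.cv (clauseOf c)) (σ ++ G)) →
          ArgsEq args (subA u (Clause.head (clauseOf c))) →
          Pos₀ (Clause.body (clauseOf c)) G σ u → Der p G σ args

  Pos₀ : ∀ {Γ} → Fm Γ → ∀ G σ → Sub Γ (σ ++ G) → Set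
  Pos₀ ⊤F          G σ s = ⊤
  Pos₀ (B ∧F C)    G σ s = Pos₀ B G σ s × Pos₀ C G σ s
  Pos₀ (exF τ B)   G σ s = Σ[ t ∈ Tm (σ ++ G) τ ] Pos₀ B G σ (ext s t)
  Pos₀ (nabF τ B)  G σ s = Pos₀ B G (τ ∷ σ) (liftS s)
  Pos₀ (atom p as) G σ s = Der p G σ (subA s as)
  Pos₀ _           G σ s = ⊥

-- An inequation may mention local variables, so each world carries the signature `loc` of its own
-- inequations, which substitutions leave untouched. It is independent of the σ of the judgment
-- being evaluated.
record World : Set where
  field
    G   : Ctx
    loc : Ctx
    nm  : ℕ → Tm (loc ++ G) nT
    D   : Dist

  Sat : ∀ {Θ} → Sub G Θ → Set
  Sat η = ∀ {x y} → (x , y) ∈ D → ¬ (sub (liftSN loc η) (nm x) ≈ sub (liftSN loc η) (nm y))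

  field
    consistent : Sat var

open World using (G; Sat)

-- To ask only that `η` itself satisfy the inequations of `W` would not be stable: a later instance
-- could break them. The condition covers all further instances allowed by `W'`, which makes
-- morphisms compose.
record Mor (W W' : World) : Set where
  field
    η    : Sub (G W) (G W')
    pres : ∀ {Θ} (κ : Sub (G W') Θ) → Sat W' κ → Sat W (κ ⊙ η)

open Mor

Sat-≈S : ∀ W {Θ} {κ κ' : Sub (G W) Θ} → κ ≈S κ' → Sat W κ → Sat W κ'
Sat-≈S W e h {x} {y} d q = h d (≈trans (sub-≈S (liftSN-≈S (World.loc W) e) (World.nm W x))
  (≈trans q (≈sym (sub-≈S (liftSN-≈S (World.loc W) e) (World.nm W y)))))

idM : ∀ {W} → Mor W W
idM .η = var
idM .pres κ h = h

_∘M_ : ∀ {W W' W''} → Mor W' W'' → Mor W W' → Mor W W''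
(m' ∘M m) .η = η m' ⊙ η m
_∘M_ {W} m' m .pres κ h =
  Sat-≈S W (λ x → ≡⇒≈ (sym (sub-sub (η m x)))) (pres m (κ ⊙ η m') (pres m' κ h))

act : ∀ {W W'} (m : Mor W W') σ {Γ} → Sub Γ (σ ++ G W) → Sub Γ (σ ++ G W')
act m σ s = liftSN σ (η m) ⊙ s

mutual
  data LB : ∀ W σ → Args (σ ++ G W) (arity lbisim) → Set where
    lb : ∀ {W σ args} (u : Sub (Clause.cv (clauseOf c-lbisim)) (σ ++ G W)) →
         ArgsEq args (subA u (Clause.head (clauseOf c-lbisim))) →
         Pos₁ (Clause.body (clauseOf c-lbisim)) W σ u → LB W σ args

  -- Force restricted to the implications that occur in the lbisim clause, whose antecedents do
  -- not mention lbisim, so that LB occurs positively.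
  Pos₁ : ∀ {Γ} → Fm Γ → ∀ W σ → Sub Γ (σ ++ G W) → Set
  Pos₁ ⊤F                W σ s = ⊤
  Pos₁ (B ∧F C)          W σ s = Pos₁ B W σ s × Pos₁ C W σ s
  Pos₁ (exF τ B)         W σ s = Σ[ t ∈ Tm (σ ++ G W) τ ] Pos₁ B W σ (ext s t)
  Pos₁ (nabF τ B)        W σ s = Pos₁ B W (τ ∷ σ) (liftS s)
  Pos₁ (allF τ B)        W σ s =
    ∀ W' (m : Mor W W') (t : Tm (σ ++ G W') τ) → Pos₁ B W' σ (ext (act m σ s) t)
  Pos₁ (atom p as ⊃F C)  W σ s =
    ∀ W' (m : Mor W W') → Der p (G W') σ (subA (act m σ s) as) → Pos₁ C W' σ (act m σ s)
  Pos₁ (atom lbisim as)  W σ s = LB W σ (subA s as)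
  Pos₁ (atom one as)     W σ s = Der one (G W) σ (subA s as)
  Pos₁ (atom onep as)    W σ s = Der onep (G W) σ (subA s as)
  Pos₁ (atom (eqP τ) as) W σ s = Der (eqP τ) (G W) σ (subA s as)
  Pos₁ _                 W σ s = ⊥

At : ∀ p W σ → Args (σ ++ G W) (arity p) → Set
At lbisim  W σ as = LB W σ as
At one     W σ as = Der one (G W) σ as
At onep    W σ as = Der onep (G W) σ as
At (eqP τ) W σ as = Der (eqP τ) (G W) σ as

Force : ∀ {Γ} → Fm Γ → ∀ W σ → Sub Γ (σ ++ G W) → Set
Force ⊤F          W σ s = ⊤
Force ⊥F          W σ s = ⊥
Force (B ∧F C)    W σ s = Force B W σ s × Force C W σ s
Force (B ∨F C)    W σ s = Force B W σ s ⊎ Force C W σ s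
Force (B ⊃F C)    W σ s =
  ∀ W' (m : Mor W W') → Force B W' σ (act m σ s) → Force C W' σ (act m σ s)
Force (exF τ B)   W σ s = Σ[ t ∈ Tm (σ ++ G W) τ ] Force B W σ (ext s t)
Force (nabF τ B)  W σ s = Force B W (τ ∷ σ) (liftS s)
Force (allF τ B)  W σ s =
  ∀ W' (m : Mor W W') (t : Tm (σ ++ G W') τ) → Force B W' σ (ext (act m σ s) t)
Force (atom p as) W σ s = At p W σ (subA s as)


act-≈S : ∀ {W W'} (m : Mor W W') σ {Γ} {s s' : Sub Γ (σ ++ G W)} → s ≈S s' → act m σ s ≈S act m σ s'
act-≈S m σ e x = sub-≈ (e x)

act-liftS : ∀ {W W'} (m : Mor W W') σ {Γ τ} (s : Sub Γ (σ ++ G W)) →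
            act m (τ ∷ σ) (liftS {σ = τ} s) ≈S liftS (act m σ s)
act-liftS m σ s here      = ≈refl
act-liftS m σ s (there x) = ≡⇒≈ (trans (sub-ren (s x)) (sym (ren-sub (s x))))

act-∘M : ∀ {W W' W''} (m' : Mor W' W'') (m : Mor W W') σ {Γ} (s : Sub Γ (σ ++ G W)) →
         act (m' ∘M m) σ s ≈S act m' σ (act m σ s)
act-∘M m' m σ s x = ≡⇒≈ (sym (trans (sub-sub (s x)) (sub-cong (liftSN-⊙ σ (η m') (η m)) (s x))))

act-id : ∀ {W} σ {Γ} (s : Sub Γ (σ ++ G W)) → act (idM {W}) σ s ≈S s
act-id σ s x = ≡⇒≈ (sub-id (liftSN-var σ) (s x))

Der-≈ : ∀ {p G σ as bs} → ArgsEq bs as → Der p G σ as → Der p G σ bs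
Der-≈ e (der c u f b) = der c u (ArgsEq-trans e f) b

Pos₀-≈S : ∀ {Γ} (B : Fm Γ) {G σ} {s s' : Sub Γ (σ ++ G)} → s' ≈S s → Pos₀ B G σ s → Pos₀ B G σ s'
Pos₀-≈S ⊤F e p               = tt
Pos₀-≈S (B ∧F C) e (p , q)   = Pos₀-≈S B e p , Pos₀-≈S C e q
Pos₀-≈S (exF τ B) e (t , p)  = t , Pos₀-≈S B (ext-≈S e ≈refl) p
Pos₀-≈S (nabF τ B) e p       = Pos₀-≈S B (liftS-≈S e) p
Pos₀-≈S (atom p as) e d      = Der-≈ (subA-≈S e as) d

mutual
  Der-sub : ∀ {p G G' σ as} (κ : Sub G G') → Der p G σ as → Der p G' σ (subA (liftSN σ κ) as)
  Der-sub {σ = σ} κ (der c u e b) =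
    der c (liftSN σ κ ⊙ u) (ArgsEq-trans (subA-≈ e) (subA-⊙ (Clause.head (clauseOf c))))
      (Pos₀-sub (Clause.body (clauseOf c)) κ b)

  Pos₀-sub : ∀ {Γ} (B : Fm Γ) {G G' σ} {s : Sub Γ (σ ++ G)} (κ : Sub G G') →
             Pos₀ B G σ s → Pos₀ B G' σ (liftSN σ κ ⊙ s)
  Pos₀-sub ⊤F κ p = tt
  Pos₀-sub (B ∧F C) κ (p , q) = Pos₀-sub B κ p , Pos₀-sub C κ q
  Pos₀-sub (exF τ B) {σ = σ} κ (t , p) = sub (liftSN σ κ) t ,
    Pos₀-≈S B (λ { here → ≈refl ; (there x) → ≈refl }) (Pos₀-sub B κ p)
  Pos₀-sub (nabF τ B) {σ = σ} {s} κ p = Pos₀-≈S B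
    (λ { here → ≈refl ; (there x) → ≡⇒≈ (trans (ren-sub (s x)) (sym (sub-ren (s x)))) })
    (Pos₀-sub B {σ = τ ∷ σ} κ p)
  Pos₀-sub (atom p as) κ d = Der-≈ (ArgsEq-sym (subA-⊙ as)) (Der-sub κ d)

LB-≈ : ∀ {W σ as bs} → ArgsEq bs as → LB W σ as → LB W σ bs
LB-≈ e (lb u f b) = lb u (ArgsEq-trans e f) b

Pos₁-≈S : ∀ {Γ} (B : Fm Γ) {W σ} {s s' : Sub Γ (σ ++ G W)} → s' ≈S s → Pos₁ B W σ s → Pos₁ B W σ s'
Pos₁-≈S ⊤F e p                  = tt
Pos₁-≈S (B ∧F C) e (p , q)      = Pos₁-≈S B e p , Pos₁-≈S C e q
Pos₁-≈S (exF τ B) e (t , p)     = t , Pos₁-≈S B (ext-≈S e ≈refl) p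
Pos₁-≈S (nabF τ B) e p          = Pos₁-≈S B (liftS-≈S e) p
Pos₁-≈S (allF τ B) {σ = σ} e p  = λ W' m t → Pos₁-≈S B (ext-≈S (act-≈S m σ e) ≈refl) (p W' m t)
Pos₁-≈S (atom p as ⊃F C) {σ = σ} e f = λ W' m d → Pos₁-≈S C (act-≈S m σ e)
  (f W' m (Der-≈ (ArgsEq-sym (subA-≈S (act-≈S m σ e) as)) d))
Pos₁-≈S (atom lbisim as) e d    = LB-≈ (subA-≈S e as) d
Pos₁-≈S (atom one as) e d       = Der-≈ (subA-≈S e as) d
Pos₁-≈S (atom onep as) e d      = Der-≈ (subA-≈S e as) d
Pos₁-≈S (atom (eqP τ) as) e d   = Der-≈ (subA-≈S e as) d

mutual
  LB-mono : ∀ {W W' σ as} (m : Mor W W') → LB W σ as → LB W' σ (subA (liftSN σ (η m)) as)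
  LB-mono {σ = σ} m (lb u e b) =
    lb (act m σ u) (ArgsEq-trans (subA-≈ e)
      (subA-⊙ {s' = liftSN σ (η m)} {s = u} (Clause.head (clauseOf c-lbisim))))
      (Pos₁-mono (Clause.body (clauseOf c-lbisim)) {s = u} m b)

  Pos₁-mono : ∀ {Γ} (B : Fm Γ) {W W' σ} {s : Sub Γ (σ ++ G W)} (m : Mor W W') →
              Pos₁ B W σ s → Pos₁ B W' σ (act m σ s)
  Pos₁-mono ⊤F m p = tt
  Pos₁-mono (B ∧F C) m (p , q) = Pos₁-mono B m p , Pos₁-mono C m q
  Pos₁-mono (exF τ B) {σ = σ} m (t , p) = sub (liftSN σ (η m)) t ,
    Pos₁-≈S B (λ { here → ≈refl ; (there x) → ≈refl }) (Pos₁-mono B m p)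
  Pos₁-mono (nabF τ B) {σ = σ} {s} m p = Pos₁-≈S B (λ x → ≈sym (act-liftS m σ s x))
    (Pos₁-mono B {σ = τ ∷ σ} m p)
  Pos₁-mono (allF τ B) {σ = σ} {s} m p = λ W'' m' t →
    Pos₁-≈S B (ext-≈S (λ x → ≈sym (act-∘M m' m σ s x)) ≈refl) (p W'' (m' ∘M m) t)
  Pos₁-mono (atom p as ⊃F C) {σ = σ} {s} m f = λ W'' m' d →
    Pos₁-≈S C (λ x → ≈sym (act-∘M m' m σ s x))
      (f W'' (m' ∘M m) (Der-≈ (subA-≈S (act-∘M m' m σ s) as) d))
  Pos₁-mono (atom lbisim as) m d  = LB-≈ (ArgsEq-sym (subA-⊙ as)) (LB-mono m d)
  Pos₁-mono (atom one as) m d     = Der-≈ (ArgsEq-sym (subA-⊙ as)) (Der-sub (η m) d)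
  Pos₁-mono (atom onep as) m d    = Der-≈ (ArgsEq-sym (subA-⊙ as)) (Der-sub (η m) d)
  Pos₁-mono (atom (eqP τ) as) m d = Der-≈ (ArgsEq-sym (subA-⊙ as)) (Der-sub (η m) d)

At-≈ : ∀ p {W σ as bs} → ArgsEq bs as → At p W σ as → At p W σ bs
At-≈ lbisim  e d = LB-≈ e d
At-≈ one     e d = Der-≈ e d
At-≈ onep    e d = Der-≈ e d
At-≈ (eqP τ) e d = Der-≈ e d

At-mono : ∀ p {W W' σ as} (m : Mor W W') → At p W σ as → At p W' σ (subA (liftSN σ (η m)) as)
At-mono lbisim  m d = LB-mono m d
At-mono one     m d = Der-sub (η m) d
At-mono onep    m d = Der-sub (η m) d
At-mono (eqP τ) m d = Der-sub (η m) d

-- Both directions are proved at once because an implication uses the opposite direction on its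
-- antecedent.
Force-subF : ∀ {Γ Δ} (B : Fm Γ) {r : Sub Γ Δ} {W σ} {s : Sub Δ (σ ++ G W)} {s' : Sub Γ (σ ++ G W)} →
             s' ≈S s ⊙ r →
             (Force (subF r B) W σ s → Force B W σ s') × (Force B W σ s' → Force (subF r B) W σ s)
Force-subF ⊤F e = (λ p → p) , (λ p → p)
Force-subF ⊥F e = (λ p → p) , (λ p → p)
Force-subF (B ∧F C) e =
  Prod.map (proj₁ (Force-subF B e)) (proj₁ (Force-subF C e)) ,
  Prod.map (proj₂ (Force-subF B e)) (proj₂ (Force-subF C e))
Force-subF (B ∨F C) e =
  Sum.map (proj₁ (Force-subF B e)) (proj₁ (Force-subF C e)) ,
  Sum.map (proj₂ (Force-subF B e)) (proj₂ (Force-subF C e))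
Force-subF (B ⊃F C) {r} {σ = σ} {s} {s'} e =
  (λ f W' m p → proj₁ (Force-subF C (e' m)) (f W' m (proj₂ (Force-subF B (e' m)) p))) ,
  (λ f W' m p → proj₂ (Force-subF C (e' m)) (f W' m (proj₁ (Force-subF B (e' m)) p)))
  where
  e' : ∀ {W'} (m : Mor _ W') → act m σ s' ≈S act m σ s ⊙ r
  e' m x = ≈trans (sub-≈ (e x)) (≡⇒≈ (sub-sub (r x)))
Force-subF (exF τ B) {r} {s = s} {s'} e =
  (λ (t , p) → t , proj₁ (Force-subF B e') p) , (λ (t , p) → t , proj₂ (Force-subF B e') p)
  where
  e' : ∀ {t} → ext s' t ≈S ext s t ⊙ liftS r
  e' here      = ≈refl
  e' (there x) = ≈trans (e x) (≡⇒≈ (sym (sub-ren (r x))))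
Force-subF (allF τ B) {r} {σ = σ} {s} {s'} e =
  (λ f W' m t → proj₁ (Force-subF B (e' m)) (f W' m t)) ,
  (λ f W' m t → proj₂ (Force-subF B (e' m)) (f W' m t))
  where
  e' : ∀ {W' t} (m : Mor _ W') → ext (act m σ s') t ≈S ext (act m σ s) t ⊙ liftS r
  e' m here      = ≈refl
  e' m (there x) = ≈trans (sub-≈ (e x)) (≡⇒≈ (trans (sub-sub (r x)) (sym (sub-ren (r x)))))
Force-subF (nabF τ B) {r} {σ = σ} {s} {s'} e = Force-subF B {σ = τ ∷ σ} λ
  { here → ≈refl ; (there x) → ≈trans (ren-≈ (e x)) (≡⇒≈ (trans (ren-sub (r x)) (sym (sub-ren (r x))))) }
Force-subF (atom p as) e =
  At-≈ p (ArgsEq-sym (subA-fuse e as)) , At-≈ p (subA-fuse e as)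

subF-var : ∀ {Γ} {s : Sub Γ Γ} → (∀ {τ} (x : Γ ∋ τ) → s x ≡ var x) → (B : Fm Γ) → subF s B ≡ B
subF-var-lift : ∀ {Γ σ} {s : Sub Γ Γ} → (∀ {τ} (x : Γ ∋ τ) → s x ≡ var x) →
                (B : Fm (σ ∷ Γ)) → subF (liftS s) B ≡ B
subF-var-lift e = subF-var λ { here → refl ; (there x) → cong (ren there) (e x) }
subF-var e ⊤F          = refl
subF-var e ⊥F          = refl
subF-var e (B ∧F C)    = cong₂ _∧F_ (subF-var e B) (subF-var e C)
subF-var e (B ∨F C)    = cong₂ _∨F_ (subF-var e B) (subF-var e C)
subF-var e (B ⊃F C)    = cong₂ _⊃F_ (subF-var e B) (subF-var e C)
subF-var e (allF τ B)  = cong (allF τ) (subF-var-lift e B)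
subF-var e (exF τ B)   = cong (exF τ) (subF-var-lift e B)
subF-var e (nabF τ B)  = cong (nabF τ) (subF-var-lift e B)
subF-var {s = s} e (atom p as) = cong (atom p) (go as)
  where
  go : ∀ {ts} (as : Args _ ts) → subA s as ≡ as
  go []       = refl
  go (t ∷ as) = cong₂ _∷_ (sub-id e t) (go as)

Force-≈S : ∀ {Γ} (B : Fm Γ) {W σ} {s s' : Sub Γ (σ ++ G W)} → s' ≈S s → Force B W σ s → Force B W σ s'
Force-≈S B {W} {σ} {s} e p = proj₁ (Force-subF B {r = var} e)
  (subst (λ C → Force C W σ s) (sym (subF-var (λ _ → refl) B)) p)

Force-≈F : ∀ {Γ} {B B' : Fm Γ} → B ≈F B' → ∀ {W σ} {s : Sub Γ (σ ++ G W)} →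
           (Force B W σ s → Force B' W σ s) × (Force B' W σ s → Force B W σ s)
Force-≈F ⊤≈ = (λ p → p) , (λ p → p)
Force-≈F ⊥≈ = (λ p → p) , (λ p → p)
Force-≈F (∧≈ d e) = Prod.map (proj₁ (Force-≈F d)) (proj₁ (Force-≈F e)) ,
                    Prod.map (proj₂ (Force-≈F d)) (proj₂ (Force-≈F e))
Force-≈F (∨≈ d e) = Sum.map (proj₁ (Force-≈F d)) (proj₁ (Force-≈F e)) ,
                    Sum.map (proj₂ (Force-≈F d)) (proj₂ (Force-≈F e))
Force-≈F (⊃≈ d e) = (λ f W' m p → proj₁ (Force-≈F e) (f W' m (proj₂ (Force-≈F d) p))) ,
                    (λ f W' m p → proj₂ (Force-≈F e) (f W' m (proj₁ (Force-≈F d) p)))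
Force-≈F (all≈ d) = (λ f W' m t → proj₁ (Force-≈F d) (f W' m t)) ,
                    (λ f W' m t → proj₂ (Force-≈F d) (f W' m t))
Force-≈F (ex≈ d)  = (λ (t , p) → t , proj₁ (Force-≈F d) p) , (λ (t , p) → t , proj₂ (Force-≈F d) p)
Force-≈F (nab≈ {τ = τ} d) {σ = σ} = Force-≈F d {σ = τ ∷ σ}
Force-≈F (atom≈ {p = p} e) = At-≈ p (subA-≈ (ArgsEq-sym e)) , At-≈ p (subA-≈ e)

Force-mono : ∀ {Γ} (B : Fm Γ) {W W' σ} {s : Sub Γ (σ ++ G W)} (m : Mor W W') →
             Force B W σ s → Force B W' σ (act m σ s)
Force-mono ⊤F m p = tt
Force-mono (B ∧F C) m (p , q) = Force-mono B m p , Force-mono C m q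
Force-mono (B ∨F C) m (inj₁ p) = inj₁ (Force-mono B m p)
Force-mono (B ∨F C) m (inj₂ q) = inj₂ (Force-mono C m q)
Force-mono (B ⊃F C) {σ = σ} {s} m f = λ W'' m' p →
  Force-≈S C (λ x → ≈sym (act-∘M m' m σ s x))
    (f W'' (m' ∘M m) (Force-≈S B (act-∘M m' m σ s) p))
Force-mono (exF τ B) {σ = σ} m (t , p) = sub (liftSN σ (η m)) t ,
  Force-≈S B (λ { here → ≈refl ; (there x) → ≈refl }) (Force-mono B m p)
Force-mono (nabF τ B) {σ = σ} {s} m p = Force-≈S B (λ x → ≈sym (act-liftS m σ s x))
  (Force-mono B {σ = τ ∷ σ} m p)
Force-mono (allF τ B) {σ = σ} {s} m p = λ W'' m' t →
  Force-≈S B (ext-≈S (λ x → ≈sym (act-∘M m' m σ s x)) ≈refl) (p W'' (m' ∘M m) t)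
Force-mono (atom p as) m d = At-≈ p (ArgsEq-sym (subA-⊙ as)) (At-mono p m d)

-- Soundness

LowPred : Pred → Set
LowPred lbisim = ⊥
LowPred _      = ⊤

-- `Pos₀` and `Pos₁` default to ⊥ outside their fragments. `Strat₀` and `Strat₁` delimit the
-- formulas on which they agree with `Force`; all clause bodies lie within them.
Strat₀ : ∀ {Γ} → Fm Γ → Set
Strat₀ ⊤F          = ⊤
Strat₀ (B ∧F C)    = Strat₀ B × Strat₀ C
Strat₀ (exF τ B)   = Strat₀ B
Strat₀ (nabF τ B)  = Strat₀ B
Strat₀ (atom p as) = LowPred p
Strat₀ _           = ⊥

Strat₁ : ∀ {Γ} → Fm Γ → Set
Strat₁ ⊤F               = ⊤
Strat₁ (B ∧F C)         = Strat₁ B × Strat₁ C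
Strat₁ (exF τ B)        = Strat₁ B
Strat₁ (nabF τ B)       = Strat₁ B
Strat₁ (allF τ B)       = Strat₁ B
Strat₁ (atom p as ⊃F C) = LowPred p × Strat₁ C
Strat₁ (atom p as)      = ⊤
Strat₁ _                = ⊥

At-Der : ∀ p → LowPred p → ∀ {W σ as} → (Der p (G W) σ as → At p W σ as) × (At p W σ as → Der p (G W) σ as)
At-Der one _     = (λ d → d) , (λ d → d)
At-Der onep _    = (λ d → d) , (λ d → d)
At-Der (eqP τ) _ = (λ d → d) , (λ d → d)

Force-Pos₀ : ∀ {Γ} (B : Fm Γ) → Strat₀ B → ∀ {W σ} {s : Sub Γ (σ ++ G W)} →
             (Pos₀ B (G W) σ s → Force B W σ s) × (Force B W σ s → Pos₀ B (G W) σ s)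
Force-Pos₀ ⊤F _ = (λ p → p) , (λ p → p)
Force-Pos₀ (B ∧F C) (b , c) =
  Prod.map (proj₁ (Force-Pos₀ B b)) (proj₁ (Force-Pos₀ C c)) ,
  Prod.map (proj₂ (Force-Pos₀ B b)) (proj₂ (Force-Pos₀ C c))
Force-Pos₀ (exF τ B) b =
  (λ (t , p) → t , proj₁ (Force-Pos₀ B b) p) , (λ (t , p) → t , proj₂ (Force-Pos₀ B b) p)
Force-Pos₀ (nabF τ B) b {σ = σ} = Force-Pos₀ B b {σ = τ ∷ σ}
Force-Pos₀ (atom p as) b = At-Der p b

Force-Pos₁ : ∀ {Γ} (B : Fm Γ) → Strat₁ B → ∀ {W σ} {s : Sub Γ (σ ++ G W)} →
             (Pos₁ B W σ s → Force B W σ s) × (Force B W σ s → Pos₁ B W σ s)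
Force-Pos₁ ⊤F _ = (λ p → p) , (λ p → p)
Force-Pos₁ (B ∧F C) (b , c) =
  Prod.map (proj₁ (Force-Pos₁ B b)) (proj₁ (Force-Pos₁ C c)) ,
  Prod.map (proj₂ (Force-Pos₁ B b)) (proj₂ (Force-Pos₁ C c))
Force-Pos₁ (exF τ B) b =
  (λ (t , p) → t , proj₁ (Force-Pos₁ B b) p) , (λ (t , p) → t , proj₂ (Force-Pos₁ B b) p)
Force-Pos₁ (nabF τ B) b {σ = σ} = Force-Pos₁ B b {σ = τ ∷ σ}
Force-Pos₁ (allF τ B) b =
  (λ f W' m t → proj₁ (Force-Pos₁ B b) (f W' m t)) ,
  (λ f W' m t → proj₂ (Force-Pos₁ B b) (f W' m t))
Force-Pos₁ (atom p as ⊃F C) (a , c) =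
  (λ f W' m d → proj₁ (Force-Pos₁ C c) (f W' m (proj₂ (At-Der p a) d))) ,
  (λ f W' m d → proj₂ (Force-Pos₁ C c) (f W' m (proj₁ (At-Der p a) d)))
Force-Pos₁ (atom lbisim as) _  = (λ p → p) , (λ p → p)
Force-Pos₁ (atom one as) _     = (λ p → p) , (λ p → p)
Force-Pos₁ (atom onep as) _    = (λ p → p) , (λ p → p)
Force-Pos₁ (atom (eqP τ) as) _ = (λ p → p) , (λ p → p)

body : ∀ {p} (c : Cl p) → Fm (Clause.cv (clauseOf c))
body c = Clause.body (clauseOf c)

body-strat₀ : ∀ {p} → LowPred p → (c : Cl p) → Strat₀ (body c)
body-strat₀ _ c-tau    = _
body-strat₀ _ c-out    = _
body-strat₀ _ c-match  = _
body-strat₀ _ c-sumL   = _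
body-strat₀ _ c-sumR   = _
body-strat₀ _ c-parL   = _
body-strat₀ _ c-parR   = _
body-strat₀ _ c-nu     = _
body-strat₀ _ c-close₁ = _
body-strat₀ _ c-close₂ = _
body-strat₀ _ c-com₁   = _
body-strat₀ _ c-com₂   = _
body-strat₀ _ c-in     = _
body-strat₀ _ c-matchp = _
body-strat₀ _ c-sumLp  = _
body-strat₀ _ c-sumRp  = _
body-strat₀ _ c-parLp  = _
body-strat₀ _ c-parRp  = _
body-strat₀ _ c-nup    = _
body-strat₀ _ c-open   = _
body-strat₀ _ c-eq     = _

-- Definitions are interpreted as fixed points: `At-fold` validates `defR` and `At-unfold` validates
-- `defL`. One step is unfolded, with the clause body read by the uniform `Force`.
Unfolded : ∀ p W σ → Args (σ ++ G W) (arity p) → Set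
Unfolded p W σ as = Σ[ c ∈ Cl p ] Σ[ u ∈ Sub (Clause.cv (clauseOf c)) (σ ++ G W) ]
  (ArgsEq as (subA u (Clause.head (clauseOf c))) × Force (body c) W σ u)

Der-unfold : ∀ {p} → LowPred p → ∀ {W σ as} → Der p (G W) σ as → Unfolded p W σ as
Der-unfold l (der c u e b) = c , u , e , proj₁ (Force-Pos₀ (body c) (body-strat₀ l c)) b

Der-fold : ∀ {p} → LowPred p → ∀ {W σ as} → Unfolded p W σ as → Der p (G W) σ as
Der-fold l (c , u , e , b) = der c u e (proj₂ (Force-Pos₀ (body c) (body-strat₀ l c)) b)

At-unfold : ∀ p {W σ as} → At p W σ as → Unfolded p W σ as
At-unfold one d             = Der-unfold tt d
At-unfold onep d            = Der-unfold tt d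
At-unfold (eqP τ) d         = Der-unfold tt d
At-unfold lbisim (lb u e b) = c-lbisim , u , e , proj₁ (Force-Pos₁ (body c-lbisim) _ {s = u}) b

At-fold : ∀ p {W σ as} → Unfolded p W σ as → At p W σ as
At-fold one d                       = Der-fold tt d
At-fold onep d                      = Der-fold tt d
At-fold (eqP τ) d                   = Der-fold tt d
At-fold lbisim (c-lbisim , u , e , b) = lb u e (proj₂ (Force-Pos₁ (body c-lbisim) _ {s = u}) b)

-- Raising over the local signature

lams : ∀ σ {Γ τ} → Tm (σ ++ Γ) τ → Tm Γ (raiseTy σ τ)
lams-mid : ∀ σ {Γ s} → Ren (s ∷ σ ++ Γ) (σ ++ s ∷ Γ)
lams-mid σ here      = injR σ here
lams-mid σ (there x) = liftRN σ there x
lams []      t = t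
-- The head of σ becomes the outermost abstraction, since `spine` supplies its variable first;
-- `lams-mid` moves it behind the rest of σ.
lams (s ∷ σ) t = lam (lams σ (ren (lams-mid σ) t))

copair : ∀ σ {Γ Δ} → (∀ {s} → σ ∋ s → Δ ∋ s) → Ren Γ Δ → Ren (σ ++ Γ) Δ
copair []      r k x         = k x
copair (s ∷ σ) r k here      = r here
copair (s ∷ σ) r k (there x) = copair σ (λ y → r (there y)) k x

copair-injR : ∀ σ {Γ Δ} (r : ∀ {s} → σ ∋ s → Δ ∋ s) (k : Ren Γ Δ) {τ} (x : Γ ∋ τ) →
              copair σ r k (injR σ x) ≡ k x
copair-injR []      r k x = refl
copair-injR (s ∷ σ) r k x = copair-injR σ _ k x

copair-liftRN : ∀ σ {Γ Γ' Δ} (r : ∀ {s} → σ ∋ s → Δ ∋ s) (k : Ren Γ' Δ) (j : Ren Γ Γ') {τ} (x : (σ ++ Γ) ∋ τ) →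
                copair σ r k (liftRN σ j x) ≡ copair σ r (λ y → k (j y)) x
copair-liftRN []      r k j x         = refl
copair-liftRN (s ∷ σ) r k j here      = refl
copair-liftRN (s ∷ σ) r k j (there x) = copair-liftRN σ _ k j x

copair-inj : ∀ σ {Γ Δ} (j : Ren (σ ++ Γ) Δ) {τ} (x : (σ ++ Γ) ∋ τ) →
             copair σ (λ y → j (injL σ y)) (λ y → j (injR σ y)) x ≡ j x
copair-inj []      j x         = refl
copair-inj (s ∷ σ) j here      = refl
copair-inj (s ∷ σ) j (there x) = copair-inj σ (λ y → j (there y)) x

spine-≈ : ∀ σ {Γ τ} {r : ∀ {s} → σ ∋ s → Γ ∋ s} {t u : Tm Γ (raiseTy σ τ)} → t ≈ u →
          spine σ r t ≈ spine σ r u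
spine-≈ []      e = e
spine-≈ (s ∷ σ) e = spine-≈ σ (≈app e ≈refl)

sub-spine : ∀ σ {Γ Δ τ} {s : Sub Γ Δ} {r : ∀ {a} → σ ∋ a → Γ ∋ a} {r' : ∀ {a} → σ ∋ a → Δ ∋ a} →
            (∀ {a} (x : σ ∋ a) → s (r x) ≡ var (r' x)) → (t : Tm Γ (raiseTy σ τ)) →
            sub s (spine σ r t) ≡ spine σ r' (sub s t)
sub-spine []      e t = refl
sub-spine (a ∷ σ) {s = s} {r} {r'} e t = trans (sub-spine σ (λ x → e (there x)) (app t (var (r here))))
  (cong (λ u → spine σ (λ x → r' (there x)) (app (sub s t) u)) (e here))

-- Iterated β. Arbitrary `r` and `k` are needed for the induction: each contraction turns the
-- abstracted local variable into a global one, whose value then belongs to `k`.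
spine-lams : ∀ σ {Γ Δ τ} (r : ∀ {s} → σ ∋ s → Δ ∋ s) (k : Ren Γ Δ) (t : Tm (σ ++ Γ) τ) →
             spine σ r (ren k (lams σ t)) ≈ ren (copair σ r k) t
spine-lams []      r k t = ≈refl
spine-lams (s ∷ σ) {Γ} {Δ} r k t = ≈trans (spine-≈ σ (≈β-≡ contract))
  (≈trans (spine-lams σ r' k' (ren (lams-mid σ) t))
          (≡⇒≈ (trans (ren-ren t) (ren-cong same t))))
  where
  r' : ∀ {a} → σ ∋ a → Δ ∋ a
  r' x = r (there x)
  k' : Ren (s ∷ Γ) Δ
  k' here      = r here
  k' (there x) = k x
  contract : ren (liftR k) (lams σ (ren (lams-mid σ) t)) [ var (r here) ]₀ ≡
             ren k' (lams σ (ren (lams-mid σ) t))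
  contract = trans (sub-ren (lams σ _)) (trans
    (sub-cong (λ { here → refl ; (there x) → refl }) (lams σ _)) (sub-ren-var (lams σ _)))
  same : ∀ {a} (x : (s ∷ σ ++ Γ) ∋ a) → copair σ r' k' (lams-mid σ x) ≡ copair (s ∷ σ) r k x
  same here      = copair-injR σ r' k' here
  same (there x) = copair-liftRN σ r' k' there x

liftSN-injL : ∀ σ {Γ Δ} (s : Sub Γ Δ) {τ} (x : σ ∋ τ) → liftSN σ s (injL σ x) ≡ var (injL σ x)
liftSN-injL (a ∷ σ) s here      = refl
liftSN-injL (a ∷ σ) s (there x) = cong (ren there) (liftSN-injL σ s x)

liftSN-injR : ∀ σ {Γ Δ} (s : Sub Γ Δ) {τ} (x : Γ ∋ τ) → liftSN σ s (injR σ x) ≡ ren (injR σ) (s x)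
liftSN-injR []      s x = sym (ren-id (s x))
liftSN-injR (a ∷ σ) s x = trans (cong (ren there) (liftSN-injR σ s x)) (ren-ren (s x))

-- Raising loses nothing: a term that contains local variables is still an instance of the raised
-- variable. This justifies `∀R`, `∃L` and the raised clauses of `defL`.
sub-raised : ∀ σ {Γ Δ τ} (s : Sub Γ Δ) (h : Γ ∋ raiseTy σ τ) (t : Tm (σ ++ Δ) τ) → s h ≡ lams σ t →
             sub (liftSN σ s) (spine σ (injL σ) (var (injR σ h))) ≈ t
sub-raised σ s h t e = ≈trans
  (≡⇒≈ (trans (sub-spine σ (liftSN-injL σ s) (var (injR σ h)))
    (cong (spine σ (injL σ)) (trans (liftSN-injR σ s h) (cong (ren (injR σ)) e)))))
  (≈trans (spine-lams σ (injL σ) (injR σ) t)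
    (≡⇒≈ (trans (ren-cong (copair-inj σ (λ x → x)) t) (ren-id t))))

sub-raiseSub : ∀ σ {Γ Δ τ} (s : Sub Γ Δ) (t : Tm (σ ++ Δ) τ) →
               ext (liftSN σ s) t ≈S liftSN σ (ext s (lams σ t)) ⊙ raiseSub σ τ
sub-raiseSub σ s t here      = ≈sym (sub-raised σ _ here t refl)
sub-raiseSub σ s t (there x) = ≡⇒≈ (sym (liftSN-ren σ _ there x))

-- Turns a clause instance found in the model into the substitution that a `Unifier` asks for.
inst : ∀ σ cv {Γ Δ} → Sub cv (σ ++ Δ) → Sub Γ Δ → Sub (raiseCtx σ cv ++ Γ) Δ
inst σ []       u s x         = s x
inst σ (t ∷ cv) u s here      = lams σ (u here)
inst σ (t ∷ cv) u s (there x) = inst σ cv (λ y → u (there y)) s x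

inst-injR : ∀ σ cv {Γ Δ} (u : Sub cv (σ ++ Δ)) (s : Sub Γ Δ) {τ} (x : Γ ∋ τ) →
            inst σ cv u s (injR (raiseCtx σ cv) x) ≡ s x
inst-injR σ []       u s x = refl
inst-injR σ (t ∷ cv) u s x = inst-injR σ cv _ s x

inst-injL : ∀ σ cv {Γ Δ} (u : Sub cv (σ ++ Δ)) (s : Sub Γ Δ) {τ} (x : cv ∋ τ) →
            inst σ cv u s (injL (raiseCtx σ cv) (raiseVar σ x)) ≡ lams σ (u x)
inst-injL σ (t ∷ cv) u s here      = refl
inst-injL σ (t ∷ cv) u s (there x) = inst-injL σ cv _ s x

ForceJ : ∀ {Γ} → GJ Γ → ∀ W → Sub Γ (G W) → Set
ForceJ (σ , B) W θ = Force B W σ (liftSN σ θ)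

ForceJ-≈S : ∀ {Γ} (A : GJ Γ) {W} {θ θ' : Sub Γ (G W)} → θ' ≈S θ → ForceJ A W θ → ForceJ A W θ'
ForceJ-≈S (σ , B) e = Force-≈S B (liftSN-≈S σ e)

ForceJ-mono : ∀ {Γ} (A : GJ Γ) {W W'} {θ : Sub Γ (G W)} (m : Mor W W') → ForceJ A W θ → ForceJ A W' (η m ⊙ θ)
ForceJ-mono (σ , B) {θ = θ} m p =
  Force-≈S B (λ x → ≡⇒≈ (sym (liftSN-⊙ σ (η m) θ x))) (Force-mono B m p)

ForceJ-sub : ∀ {Γ Δ} (A : GJ Γ) {W} (κ : Sub Γ Δ) (θ : Sub Δ (G W)) →
             (ForceJ (subGJ κ A) W θ → ForceJ A W (θ ⊙ κ)) × (ForceJ A W (θ ⊙ κ) → ForceJ (subGJ κ A) W θ)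
ForceJ-sub (σ , B) κ θ = Force-subF B (λ x → ≡⇒≈ (sym (liftSN-⊙ σ θ κ x)))

ForceJ-ren : ∀ {Γ Δ} (A : GJ Γ) {W} (r : Ren Γ Δ) (θ : Sub Δ (G W)) →
             (ForceJ (renGJ r A) W θ → ForceJ A W (λ x → θ (r x))) ×
             (ForceJ A W (λ x → θ (r x)) → ForceJ (renGJ r A) W θ)
ForceJ-ren (σ , B) {W} r θ
  rewrite renF-subF {r = liftRN σ r} (λ _ → refl) B =
  Force-subF B (λ x → ≡⇒≈ (sym (liftSN-ren σ θ r x)))

Forced : ∀ {Γ} → List (GJ Γ) → ∀ W → Sub Γ (G W) → Set
Forced Γs W θ = ∀ {A} → A ∈ Γs → ForceJ A W θ

Forced-∷ : ∀ {Γ Γs A W} {θ : Sub Γ (G W)} → ForceJ A W θ → Forced Γs W θ → Forced (A ∷ Γs) W θ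
Forced-∷ p ps (here refl) = p
Forced-∷ p ps (there x)   = ps x

Forced-ren : ∀ {Γ Δ Γs W} (r : Ren Γ Δ) {θ : Sub Δ (G W)} → Forced Γs W (λ x → θ (r x)) →
             Forced (map (renGJ r) Γs) W θ
Forced-ren r ps x with ∈-map⁻ (renGJ r) x
... | A , y , refl = proj₂ (ForceJ-ren A r _) (ps y)

Forced-mono : ∀ {Γ Γs W W'} {θ : Sub Γ (G W)} (m : Mor W W') → Forced Γs W θ → Forced Γs W' (η m ⊙ θ)
Forced-mono m ps {A} x = ForceJ-mono A m (ps x)

-- World and instance of the eigenvariables stay general in the induction, because the right rules
-- for ⊃ and ∀ pass to a future and `defL` replaces the signature. `cut` is mere composition.
sound : ∀ {Γ Γs A} → Seq Γ Γs A → ∀ W (θ : Sub Γ (G W)) → Forced Γs W θ → ForceJ A W θ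
sound (init x e) W θ ps = proj₁ (Force-≈F e) (ps x)
sound (cut d e) W θ ps = sound e W θ (Forced-∷ (sound d W θ ps) ps)
sound (⊥L x) W θ ps = ⊥-elim (ps x)
sound ⊤R W θ ps = tt
sound (∧L₁ x d) W θ ps = sound d W θ (Forced-∷ (proj₁ (ps x)) ps)
sound (∧L₂ x d) W θ ps = sound d W θ (Forced-∷ (proj₂ (ps x)) ps)
sound (∧R d e) W θ ps = sound d W θ ps , sound e W θ ps
sound (∨L x d e) W θ ps with ps x
... | inj₁ p = sound d W θ (Forced-∷ p ps)
... | inj₂ p = sound e W θ (Forced-∷ p ps)
sound (∨R₁ d) W θ ps = inj₁ (sound d W θ ps)
sound (∨R₂ d) W θ ps = inj₂ (sound d W θ ps)
-- The implication is used at the present world, taken as its own future.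
sound (⊃L {σ = σ} {B} {C} x d e) W θ ps = sound e W θ (Forced-∷
  (Force-≈S C (λ y → ≈sym (act-id {W} σ (liftSN σ θ) y))
    (ps x W idM (Force-mono B idM (sound d W θ ps)))) ps)
sound (⊃R {σ = σ} {B = B} {C} d) W θ ps W' m p =
  Force-≈S C (act-lift σ) (sound d W' (η m ⊙ θ)
    (Forced-∷ (Force-≈S B (λ x → ≈sym (act-lift σ x)) p) (λ {A} → Forced-mono m ps {A})))
  where
  act-lift : ∀ σ → act m σ (liftSN σ θ) ≈S liftSN σ (η m ⊙ θ)
  act-lift σ x = ≡⇒≈ (liftSN-⊙ σ (η m) θ x)
sound (∀L {σ = σ} {B = B} x t d) W θ ps = sound d W θ (Forced-∷
  (proj₂ (Force-subF B λ { here → ≈refl ; (there y) → act-id {W} σ (liftSN σ θ) y })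
    (ps x W idM (sub (liftSN σ θ) t))) ps)
-- The instance `t` may contain variables of σ; abstracted over them it becomes the value of the
-- raised eigenvariable.
sound (∀R {σ = σ} {τ} {B} d) W θ ps W' m t =
  Force-≈S B (ext-≈S (λ x → ≡⇒≈ (liftSN-⊙ σ (η m) θ x)) ≈refl)
    (proj₁ (Force-subF B (sub-raiseSub σ (η m ⊙ θ) t))
      (sound d W' (ext (η m ⊙ θ) (lams σ t)) (Forced-ren there (λ {A} → Forced-mono m ps {A}))))
sound (∃L {σ = σ} {B = B} {D} x d) W θ ps with ps x
... | t , p = proj₁ (ForceJ-ren D there (ext θ (lams σ t)))
  (sound d W (ext θ (lams σ t)) (Forced-∷
    (proj₂ (Force-subF B (sub-raiseSub σ θ t)) p) (Forced-ren there ps)))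
sound (∃R {σ = σ} {B = B} t d) W θ ps = sub (liftSN σ θ) t ,
  proj₁ (Force-subF B λ { here → ≈refl ; (there y) → ≈refl }) (sound d W θ ps)
sound (∇L {σ = σ} {τ} {B} x d) W θ ps = sound d W θ (Forced-∷
  (Force-≈S B {σ = τ ∷ σ} (λ { here → ≈refl ; (there y) → ≈refl }) (ps x)) ps)
sound (∇R {σ = σ} {τ} {B} d) W θ ps =
  Force-≈S B {σ = τ ∷ σ} (λ { here → ≈refl ; (there y) → ≈refl }) (sound d W θ ps)
sound (defR {σ = σ} {p} c u e d) W θ ps = At-fold p (c , liftSN σ θ ⊙ u ,
  ArgsEq-trans (subA-≈ e) (subA-⊙ (Clause.head (clauseOf c))) ,
  proj₁ (Force-subF (body c) (λ _ → ≈refl)) (sound d W θ ps))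
sound {Γ} (defL {σ = σ} {p} {D} {args} x I us csu d) W θ ps with At-unfold p (ps x)
-- The clause instance by which the atom is forced is a unifier over the signature of the world. The
-- complete set contains a more general one, and the premise for that one is used.
... | c , u , e , b = goal (csu c v)
  where
  cv : Ctx
  cv = Clause.cv (clauseOf c)
  θv : Sub (raiseCtx σ cv ++ Γ) (G W)
  θv = inst σ cv u θ
  old : ∀ {τ} (y : (σ ++ Γ) ∋ τ) → liftSN σ θ y ≈ liftSN σ θv (liftRN σ (injR (raiseCtx σ cv)) y)
  old y = ≈sym (≈trans (≡⇒≈ (liftSN-ren σ θv (injR (raiseCtx σ cv)) y))
    (liftSN-≈S σ (λ z → ≡⇒≈ (inst-injR σ cv u θ z)) y))
  new : u ≈S liftSN σ θv ⊙ raisedInst σ cv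
  new y = ≈sym (sub-raised σ θv (injL (raiseCtx σ cv) (raiseVar σ y)) (u y) (inst-injL σ cv u θ y))
  v : Unifier Γ σ args c
  v .Unifier.G' = G W
  v .Unifier.θ  = θv
  v .Unifier.unifies = ArgsEq-trans
    (subst (λ as → ArgsEq (subA (liftSN σ θv) as) (subA (liftSN σ θ) args)) (sym (renA-subA args))
      (subA-fuse old args))
    (ArgsEq-trans e (ArgsEq-sym (subA-fuse new (Clause.head (clauseOf c)))))
  goal : (Σ[ i ∈ I c ] (v ≼ us c i)) → ForceJ D W θ
  -- `v` is the instance `κ` of the chosen unifier, so the premise read at `κ` speaks of the
  -- original judgments at `θ`.
  goal (i , κ , h) = undo D (sound (d c i) W κ (Forced-∷ body-forced ctx-forced))
    where
    θi : Sub (raiseCtx σ cv ++ Γ) (Unifier.G' (us c i))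
    θi = Unifier.θ (us c i)
    restrict : θ ≈S (λ y → (κ ⊙ θi) (injR (raiseCtx σ cv) y))
    restrict y = ≈trans (≡⇒≈ (sym (inst-injR σ cv u θ y))) (h (injR (raiseCtx σ cv) y))
    undo : ∀ A → ForceJ (subGJ θi (renGJ (injR (raiseCtx σ cv)) A)) W κ → ForceJ A W θ
    undo A q = ForceJ-≈S A restrict (proj₁ (ForceJ-ren A (injR (raiseCtx σ cv)) (κ ⊙ θi))
      (proj₁ (ForceJ-sub (renGJ (injR (raiseCtx σ cv)) A) θi κ) q))
    ctx-forced : Forced (map (λ A → subGJ θi (renGJ (injR (raiseCtx σ cv)) A)) _) W κ
    ctx-forced y with ∈-map⁻ (λ A → subGJ θi (renGJ (injR (raiseCtx σ cv)) A)) y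
    ... | A , z , refl = proj₂ (ForceJ-sub (renGJ (injR (raiseCtx σ cv)) A) θi κ)
      (proj₂ (ForceJ-ren A (injR (raiseCtx σ cv)) (κ ⊙ θi))
        (ForceJ-≈S A (λ y → ≈sym (restrict y)) (ps z)))
    body-forced : ForceJ (σ , subF (liftSN σ θi) (subF (raisedInst σ cv) (body c))) W κ
    body-forced = proj₂ (Force-subF (subF (raisedInst σ cv) (body c))
        (λ y → ≡⇒≈ (sym (liftSN-⊙ σ κ θi y))))
      (proj₂ (Force-subF (body c) (λ y → ≈trans (new y) (sub-≈S (liftSN-≈S σ h) (raisedInst σ cv y)))) b)

-- Processes, free names and transitions

≡ᵇ-refl : ∀ x → (x ≡ᵇ x) ≡ true
≡ᵇ-refl zero    = refl
≡ᵇ-refl (suc x) = ≡ᵇ-refl x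

≡ᵇ-≢ : ∀ {x y} → x ≢ y → (x ≡ᵇ y) ≡ false
≡ᵇ-≢ {x} {y} ne with x ≡ᵇ y in e
... | true  = ⊥-elim (ne (≡ᵇ⇒≡ x y (subst T (sym e) tt)))
... | false = refl

-- The successor of the sum exceeds every member.
fresh : List ℕ → ℕ
fresh L = suc (sum L)

∈⇒≤sum : ∀ {x L} → x ∈ L → x ≤ sum L
∈⇒≤sum {L = y ∷ L} (here refl) = m≤m+n y (sum L)
∈⇒≤sum {L = y ∷ L} (there p)   = ≤-trans (∈⇒≤sum p) (m≤n+m (sum L) y)

fresh-∉ : ∀ L → fresh L ∉ L
fresh-∉ L p = <-irrefl refl (∈⇒≤sum p)

-- Free names are compared only inside `L`: the maps that close or rename at a fresh name differ
-- from the trivial ones exactly at that name, which does not occur in the process.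
record Agree {k} {A : Set} (f g : Nm k → A) (L : List ℕ) : Set where
  constructor agree
  field
    on-bv : ∀ i → f (bv i) ≡ g (bv i)
    on-fr : ∀ {x} → x ∈ L → f (fr x) ≡ g (fr x)

Agree-⊆ : ∀ {k} {A : Set} {f g : Nm k → A} {L L'} → (∀ {x} → x ∈ L' → x ∈ L) → Agree f g L → Agree f g L'
Agree-⊆ h (agree p q) = agree p λ x → q (h x)

agree-nm : ∀ {k} {A : Set} {f g : Nm k → A} n → Agree f g (fnNm n) → f n ≡ g n
agree-nm (fr x) (agree p q) = q (here refl)
agree-nm (bv i) (agree p q) = p i

agree-lift : ∀ {k l} {f g : Nm k → Nm l} {L} → Agree f g L → Agree (liftNm f) (liftNm g) L
agree-lift (agree p q) = agree (λ { zero → refl ; (suc i) → cong shiftNm (p i) }) λ x → cong shiftNm (q x)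

agreeˡ : ∀ {k} {A : Set} {f g : Nm k → A} L {L'} → Agree f g (L ++ L') → Agree f g L
agreeˡ L = Agree-⊆ ∈-++⁺ˡ

agreeʳ : ∀ {k} {A : Set} {f g : Nm k → A} L {L'} → Agree f g (L ++ L') → Agree f g L'
agreeʳ L = Agree-⊆ (∈-++⁺ʳ L)

cong₃ : ∀ {A B C D : Set} (f : A → B → C → D) {a a' b b' c c'} →
        a ≡ a' → b ≡ b' → c ≡ c' → f a b c ≡ f a' b' c'
cong₃ f refl refl refl = refl

mapP-cong : ∀ {k l} {f g : Nm k → Nm l} (P : Proc k) → Agree f g (fnP P) → mapP f P ≡ mapP g P
mapP-cong nil a = refl
mapP-cong (tauP P) a = cong tauP (mapP-cong P a)
mapP-cong (outP x y P) a = cong₃ outP (agree-nm x (agreeˡ (fnNm x) a))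
  (agree-nm y (agreeˡ (fnNm y) (agreeʳ (fnNm x) a)))
  (mapP-cong P (agreeʳ (fnNm y) (agreeʳ (fnNm x) a)))
mapP-cong (inP x P) a =
  cong₂ inP (agree-nm x (agreeˡ (fnNm x) a)) (mapP-cong P (agree-lift (agreeʳ (fnNm x) a)))
mapP-cong (resP P) a = cong resP (mapP-cong P (agree-lift a))
mapP-cong (matchP x y P) a = cong₃ matchP (agree-nm x (agreeˡ (fnNm x) a))
  (agree-nm y (agreeˡ (fnNm y) (agreeʳ (fnNm x) a)))
  (mapP-cong P (agreeʳ (fnNm y) (agreeʳ (fnNm x) a)))
mapP-cong (P ∣ Q) a = cong₂ _∣_ (mapP-cong P (agreeˡ (fnP P) a)) (mapP-cong Q (agreeʳ (fnP P) a))
mapP-cong (P ⊕ Q) a = cong₂ _⊕_ (mapP-cong P (agreeˡ (fnP P) a)) (mapP-cong Q (agreeʳ (fnP P) a))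

mapP-≗ : ∀ {k l} {f g : Nm k → Nm l} → (∀ n → f n ≡ g n) → (P : Proc k) → mapP f P ≡ mapP g P
mapP-≗ e P = mapP-cong P (agree (λ i → e (bv i)) (λ {x} _ → e (fr x)))

lift-shift : ∀ {k l} (f : Nm k → Nm l) n → liftNm f (shiftNm n) ≡ shiftNm (f n)
lift-shift f (fr x) = refl
lift-shift f (bv i) = refl

lift-lift : ∀ {k l m} (g : Nm l → Nm m) (f : Nm k → Nm l) n → liftNm g (liftNm f n) ≡ liftNm (λ n → g (f n)) n
lift-lift g f (fr x)       = lift-shift g (f (fr x))
lift-lift g f (bv zero)    = refl
lift-lift g f (bv (suc i)) = lift-shift g (f (bv i))

mapP-∘ : ∀ {k l m} {g : Nm l → Nm m} {f : Nm k → Nm l} (P : Proc k) → mapP g (mapP f P) ≡ mapP (λ n → g (f n)) P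
mapP-∘ nil            = refl
mapP-∘ (tauP P)       = cong tauP (mapP-∘ P)
mapP-∘ (outP x y P)   = cong (outP _ _) (mapP-∘ P)
mapP-∘ (inP x P)      = cong (inP _) (trans (mapP-∘ P) (mapP-≗ (lift-lift _ _) P))
mapP-∘ (resP P)       = cong resP (trans (mapP-∘ P) (mapP-≗ (lift-lift _ _) P))
mapP-∘ (matchP x y P) = cong (matchP _ _) (mapP-∘ P)
mapP-∘ (P ∣ Q)        = cong₂ _∣_ (mapP-∘ P) (mapP-∘ Q)
mapP-∘ (P ⊕ Q)        = cong₂ _⊕_ (mapP-∘ P) (mapP-∘ Q)

mapP-id : ∀ {k} {f : Nm k → Nm k} → (∀ n → f n ≡ n) → (P : Proc k) → mapP f P ≡ P
mapP-id-lift : ∀ {k} {f : Nm k → Nm k} → (∀ n → f n ≡ n) → (P : Proc (suc k)) → mapP (liftNm f) P ≡ P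
mapP-id-lift e = mapP-id λ { (fr x) → cong shiftNm (e (fr x)) ; (bv zero) → refl ; (bv (suc i)) → cong shiftNm (e (bv i)) }
mapP-id e nil            = refl
mapP-id e (tauP P)       = cong tauP (mapP-id e P)
mapP-id e (outP x y P)   = cong₃ outP (e x) (e y) (mapP-id e P)
mapP-id e (inP x P)      = cong₂ inP (e x) (mapP-id-lift e P)
mapP-id e (resP P)       = cong resP (mapP-id-lift e P)
mapP-id e (matchP x y P) = cong₃ matchP (e x) (e y) (mapP-id e P)
mapP-id e (P ∣ Q)        = cong₂ _∣_ (mapP-id e P) (mapP-id e Q)
mapP-id e (P ⊕ Q)        = cong₂ _⊕_ (mapP-id e P) (mapP-id e Q)

mapP-fuse : ∀ {k l m} {g : Nm l → Nm m} {f : Nm k → Nm l} {h : Nm k → Nm m} (P : Proc k) →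
            Agree (λ n → g (f n)) h (fnP P) → mapP g (mapP f P) ≡ mapP h P
mapP-fuse P a = trans (mapP-∘ P) (mapP-cong P a)

data ImageName {k l} (f : Nm k → Nm l) (L : List ℕ) (x : ℕ) : Set where
  name  : ∀ y → y ∈ L → x ∈ fnNm (f (fr y)) → ImageName f L x
  bound : ∀ i → x ∈ fnNm (f (bv i)) → ImageName f L x

image-⊆ : ∀ {k l} {f : Nm k → Nm l} {L L' x} → (∀ {y} → y ∈ L → y ∈ L') → ImageName f L x → ImageName f L' x
image-⊆ h (name y p q) = name y (h p) q
image-⊆ h (bound i q)  = bound i q

fnNm-shift : ∀ {k} (n : Nm k) → fnNm (shiftNm n) ≡ fnNm n
fnNm-shift (fr x) = refl
fnNm-shift (bv i) = refl

-- The index added by the lift is sent to itself and yields no free name, so it cannot be the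
-- origin.
image-lift : ∀ {k l} {f : Nm k → Nm l} {L x} → ImageName (liftNm f) L x → ImageName f L x
image-lift {f = f} (name y p q)      = name y p (subst (_ ∈_) (fnNm-shift (f (fr y))) q)
image-lift {f = f} (bound (suc i) q) = bound i (subst (_ ∈_) (fnNm-shift (f (bv i))) q)

fnNm-map : ∀ {k l} (f : Nm k → Nm l) n {x} → x ∈ fnNm (f n) → ImageName f (fnNm n) x
fnNm-map f (fr y) p = name y (here refl) p
fnNm-map f (bv i) p = bound i p

fn-map : ∀ {k l} (f : Nm k → Nm l) (P : Proc k) {x} → x ∈ fnP (mapP f P) → ImageName f (fnP P) x

fn-map₂ : ∀ {k l} (f : Nm k → Nm l) m n (P : Proc k) {x} →
          x ∈ fnNm (f m) ++ fnNm (f n) ++ fnP (mapP f P) → ImageName f (fnNm m ++ fnNm n ++ fnP P) x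
fn-map₂ f m n P p with ∈-++⁻ (fnNm (f m)) p
... | inj₁ q = image-⊆ ∈-++⁺ˡ (fnNm-map f m q)
... | inj₂ q with ∈-++⁻ (fnNm (f n)) q
...   | inj₁ r = image-⊆ (∈-++⁺ʳ (fnNm m) ∘ ∈-++⁺ˡ) (fnNm-map f n r)
...   | inj₂ r = image-⊆ (∈-++⁺ʳ (fnNm m) ∘ ∈-++⁺ʳ (fnNm n)) (fn-map f P r)

fn-map-++ : ∀ {k l} (f : Nm k → Nm l) (P Q : Proc k) {x} →
            x ∈ fnP (mapP f P) ++ fnP (mapP f Q) → ImageName f (fnP P ++ fnP Q) x
fn-map-++ f P Q p with ∈-++⁻ (fnP (mapP f P)) p
... | inj₁ q = image-⊆ ∈-++⁺ˡ (fn-map f P q)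
... | inj₂ q = image-⊆ (∈-++⁺ʳ (fnP P)) (fn-map f Q q)

fn-map f (tauP P) p       = fn-map f P p
fn-map f (outP m n P) p   = fn-map₂ f m n P p
fn-map f (inP m P) p with ∈-++⁻ (fnNm (f m)) p
... | inj₁ q = image-⊆ ∈-++⁺ˡ (fnNm-map f m q)
... | inj₂ q = image-⊆ (∈-++⁺ʳ (fnNm m)) (image-lift (fn-map (liftNm f) P q))
fn-map f (resP P) p       = image-lift (fn-map (liftNm f) P p)
fn-map f (matchP m n P) p = fn-map₂ f m n P p
fn-map f (P ∣ Q) p        = fn-map-++ f P Q p
fn-map f (P ⊕ Q) p        = fn-map-++ f P Q p

fn-open : ∀ (B : Proc 1) {z x} → x ∈ fnP (openP B z) → x ∈ fnP B ⊎ x ≡ z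
fn-open B {z} p with fn-map (openNm z) B p
... | name y q (here refl)   = inj₁ q
... | bound zero (here refl) = inj₂ refl

fn-close : ∀ {k} (P : Proc k) {y x} → x ∈ fnP (closeP y P) → x ∈ fnP P × x ≢ y
fn-close P {y} {x} p with fn-map (closeNm y) P p
... | name z q r with z ≟ y
...   | yes refl rewrite ≡ᵇ-refl z with () ← r
...   | no ne rewrite ≡ᵇ-≢ ne with here refl ← r = q , ne

fn-subst : ∀ {k θ} (P : Proc k) {x} → x ∈ fnP (substP θ P) → Σ[ y ∈ ℕ ] (y ∈ fnP P × x ≡ θ y)
fn-subst {θ = θ} P p with fn-map (substNm θ) P p
... | name y q (here refl) = y , q , refl

fn-shift : ∀ {k} (P : Proc k) {x} → x ∈ fnP (mapP shiftNm P) → x ∈ fnP P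
fn-shift P p with fn-map shiftNm P p
... | name y q (here refl) = q

open-shift : ∀ {z} (P : Proc 0) → openP (mapP shiftNm P) z ≡ P
open-shift {z} P = trans (mapP-∘ P) (mapP-id (λ { (fr x) → refl ; (bv ()) }) P)

close-open : ∀ {y} (B : Proc 1) → y ∉ fnP B → closeP y (openP B y) ≡ B
close-open {y} B y∉ = trans (mapP-fuse {h = λ n → n} B (agree
  (λ { zero → cong (λ b → if b then bv zero else fr y) (≡ᵇ-refl y) })
  (λ {x} x∈ → cong (λ b → if b then bv zero else fr x) (≡ᵇ-≢ {x} {y} λ { refl → y∉ x∈ }))))
  (mapP-id (λ _ → refl) B)

-- A late input names the received value provisionally by a fresh z. Replacing z gives the direct
-- instantiation, which the communication clauses express by applying `M` to `Y`.
subst-open : ∀ {y z} (B : Proc 1) → z ∉ fnP B → substP [ y / z ] (openP B z) ≡ openP B y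
subst-open {y} {z} B z∉ = mapP-fuse B (agree
  (λ { zero → cong (λ b → fr (if b then y else z)) (≡ᵇ-refl z) })
  (λ {x} x∈ → cong (λ b → fr (if b then y else x)) (≡ᵇ-≢ {x} {z} λ { refl → z∉ x∈ })))

subst-close : ∀ {w y} (P : Proc 0) → substP [ w / y ] P ≡ openP (closeP y P) w
subst-close {w} {y} P = sym (trans (mapP-∘ P) (mapP-≗ pt P))
  where
  pt : ∀ n → openNm w (closeNm y n) ≡ substNm [ w / y ] n
  pt (fr x) with x ≡ᵇ y
  ... | true  = refl
  ... | false = refl
  pt (bv ())

-- If z were y, closing after opening would capture the name just put in.
close-open-swap : ∀ {y z} (B : Proc 1) → z ≢ y →
                  openP (resP (closeP y B)) z ≡ resP (closeP y (openP B z))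
close-open-swap {y} {z} B ne = cong resP (trans (mapP-∘ B) (trans (mapP-≗ pt B) (sym (mapP-∘ B))))
  where
  pt : ∀ n → liftNm (openNm z) (closeNm y n) ≡ closeNm y (openNm z n)
  pt (fr x) with x ≡ᵇ y
  ... | true  = refl
  ... | false = refl
  pt (bv zero) rewrite ≡ᵇ-≢ ne = refl
  pt (bv (suc ()))

fnA : Act → List ℕ
fnA (binA x z)  = x ∷ []
fnA (boutA x z) = x ∷ []
fnA α           = namesA α

fnA-⊆ : ∀ α {x} → x ∈ fnA α → x ∈ namesA α
fnA-⊆ (outA x y) p = p
fnA-⊆ (inA x y) p = p
fnA-⊆ (binA x z) (here refl) = here refl
fnA-⊆ (boutA x z) (here refl) = here refl

act-fn : ∀ {P α P'} → P —[ α ]→ P' → ∀ {x} → x ∈ fnA α → x ∈ fnP P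
act-fn outT (here refl) = here refl
act-fn outT (there (here refl)) = there (here refl)
act-fn (inT _) (here refl) = here refl
act-fn (sumL {P = P} t) p = ∈-++⁺ˡ (act-fn t p)
act-fn (sumR {P = P} t) p = ∈-++⁺ʳ (fnP P) (act-fn t p)
act-fn (matchT t) p = there (there (act-fn t p))
act-fn (parL t _) p = ∈-++⁺ˡ (act-fn t p)
act-fn (parR {P = P} t _) p = ∈-++⁺ʳ (fnP P) (act-fn t p)
act-fn (resT {B} {y} {α} _ y∉ t) p with fn-open B (act-fn t p)
... | inj₁ q    = q
... | inj₂ refl = ⊥-elim (y∉ (fnA-⊆ α p))
act-fn (openT {B} _ ne t _) (here refl) with fn-open B (act-fn t (here refl))
... | inj₁ q    = q
... | inj₂ refl = ⊥-elim (ne refl)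

-- Bounds the names that matter after a transition, and supplies the freshness condition of `openT`
-- when a derivation is decoded.
res-fn : ∀ {P α P'} → P —[ α ]→ P' → ∀ {x} → x ∈ fnP P' → x ∈ fnP P ⊎ x ∈ bnA α

res-fn-subst : ∀ {P α P' x y z} → P —[ α ]→ P' → bnA α ≡ z ∷ [] → x ∈ fnP (substP [ y / z ] P') → x ∈ fnP P ⊎ x ≡ y
res-fn-subst {P' = P'} {z = z} t e p with fn-subst P' p
... | w , q , refl with w ≟ z
...   | yes refl rewrite ≡ᵇ-refl w = inj₂ refl
...   | no ne rewrite ≡ᵇ-≢ ne with res-fn t q
...     | inj₁ r = inj₁ r
...     | inj₂ r with here refl ← subst (w ∈_) e r = ⊥-elim (ne refl)

res-fn-close : ∀ {P Q α β P' Q' x w} → P —[ α ]→ P' → Q —[ β ]→ Q' → bnA α ≡ w ∷ [] → bnA β ≡ w ∷ [] →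
               x ∈ fnP (closeP w (P' ∣ Q')) → x ∈ fnP (P ∣ Q)
res-fn-close {P} {P' = P'} {Q'} t u e f p with fn-close (P' ∣ Q') p
... | q , ne with ∈-++⁻ (fnP P') q
...   | inj₁ r with res-fn t r
...     | inj₁ s = ∈-++⁺ˡ s
...     | inj₂ s with here refl ← subst (_ ∈_) e s = ⊥-elim (ne refl)
res-fn-close {P} {P' = P'} {Q'} t u e f p | q , ne | inj₂ r with res-fn u r
...     | inj₁ s = ∈-++⁺ʳ (fnP P) s
...     | inj₂ s with here refl ← subst (_ ∈_) f s = ⊥-elim (ne refl)

res-fn tauT p = inj₁ p
res-fn outT p = inj₁ (there (there p))
res-fn (inT {B = B} _) p with fn-open B p
... | inj₁ q = inj₁ (there q)
... | inj₂ e = inj₂ (here e)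
res-fn (sumL t) p with res-fn t p
... | inj₁ q = inj₁ (∈-++⁺ˡ q)
... | inj₂ q = inj₂ q
res-fn (sumR {P = P} t) p with res-fn t p
... | inj₁ q = inj₁ (∈-++⁺ʳ (fnP P) q)
... | inj₂ q = inj₂ q
res-fn (matchT t) p with res-fn t p
... | inj₁ q = inj₁ (there (there q))
... | inj₂ q = inj₂ q
res-fn (parL {P} {P' = P'} t _) p with ∈-++⁻ (fnP P') p
... | inj₂ q = inj₁ (∈-++⁺ʳ (fnP P) q)
... | inj₁ q with res-fn t q
...   | inj₁ r = inj₁ (∈-++⁺ˡ r)
...   | inj₂ r = inj₂ r
res-fn (parR {P} t _) p with ∈-++⁻ (fnP P) p
... | inj₁ q = inj₁ (∈-++⁺ˡ q)
... | inj₂ q with res-fn t q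
...   | inj₁ r = inj₁ (∈-++⁺ʳ (fnP P) r)
...   | inj₂ r = inj₂ r
res-fn (comL {P} {P' = P'} t u) p with ∈-++⁻ (fnP P') p
... | inj₁ q with inj₁ r ← res-fn t q = inj₁ (∈-++⁺ˡ r)
... | inj₂ q with res-fn-subst u refl q
...   | inj₁ r    = inj₁ (∈-++⁺ʳ (fnP P) r)
...   | inj₂ refl = inj₁ (∈-++⁺ˡ (act-fn t (there (here refl))))
res-fn (comR {P} {P' = P'} {y = y} {z} t u) p with ∈-++⁻ (fnP (substP [ y / z ] P')) p
... | inj₂ q with inj₁ r ← res-fn u q = inj₁ (∈-++⁺ʳ (fnP P) r)
... | inj₁ q with res-fn-subst t refl q
...   | inj₁ r    = inj₁ (∈-++⁺ˡ r)
...   | inj₂ refl = inj₁ (∈-++⁺ʳ (fnP P) (act-fn u (there (here refl))))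
res-fn (closeL t u) p = inj₁ (res-fn-close t u refl refl p)
res-fn (closeR t u) p = inj₁ (res-fn-close t u refl refl p)
res-fn (resT {B} {y} {P' = P'} _ _ t) p with fn-close P' p
... | q , ne with res-fn t q
...   | inj₂ r = inj₂ r
...   | inj₁ r with fn-open B r
...     | inj₁ s = inj₁ s
...     | inj₂ e = ⊥-elim (ne e)
res-fn (openT {B} {y} {w = w} {P'} _ _ t _) p with fn-subst P' p
... | v , q , refl with v ≟ y
...   | yes refl rewrite ≡ᵇ-refl v = inj₂ (here refl)
...   | no ne rewrite ≡ᵇ-≢ ne with res-fn t q
...     | inj₁ r with fn-open B r
...       | inj₁ s = inj₁ s
...       | inj₂ e = ⊥-elim (ne e)

fnNm-map⁺ : ∀ {k l} (f : Nm k → Nm l) n {y x} → y ∈ fnNm n → x ∈ fnNm (f (fr y)) → x ∈ fnNm (f n)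
fnNm-map⁺ f (fr y) (here refl) q = q

fn-map⁺ : ∀ {k l} (f : Nm k → Nm l) (P : Proc k) {y x} → y ∈ fnP P → x ∈ fnNm (f (fr y)) → x ∈ fnP (mapP f P)
fn-map⁺-lift : ∀ {k l} (f : Nm k → Nm l) (P : Proc (suc k)) {y x} → y ∈ fnP P → x ∈ fnNm (f (fr y)) →
               x ∈ fnP (mapP (liftNm f) P)
fn-map⁺-lift f P {y} p q = fn-map⁺ (liftNm f) P p (subst (_ ∈_) (sym (fnNm-shift (f (fr y)))) q)

++-map : ∀ {A : Set} {x y : A} L {L' M M'} → (x ∈ L → y ∈ M) → (x ∈ L' → y ∈ M') → x ∈ L ++ L' → y ∈ M ++ M'
++-map L {M = M} f g p with ∈-++⁻ L p
... | inj₁ q = ∈-++⁺ˡ (f q)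
... | inj₂ q = ∈-++⁺ʳ M (g q)

fn-map⁺ f (tauP P) p q       = fn-map⁺ f P p q
fn-map⁺ f (outP m n P) p q   = ++-map (fnNm m) (λ r → fnNm-map⁺ f m r q)
  (++-map (fnNm n) (λ r → fnNm-map⁺ f n r q) (λ r → fn-map⁺ f P r q)) p
fn-map⁺ f (inP m P) p q      = ++-map (fnNm m) (λ r → fnNm-map⁺ f m r q) (λ r → fn-map⁺-lift f P r q) p
fn-map⁺ f (resP P) p q       = fn-map⁺-lift f P p q
fn-map⁺ f (matchP m n P) p q = ++-map (fnNm m) (λ r → fnNm-map⁺ f m r q)
  (++-map (fnNm n) (λ r → fnNm-map⁺ f n r q) (λ r → fn-map⁺ f P r q)) p
fn-map⁺ f (P ∣ Q) p q        = ++-map (fnP P) (λ r → fn-map⁺ f P r q) (λ r → fn-map⁺ f Q r q) p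
fn-map⁺ f (P ⊕ Q) p q        = ++-map (fnP P) (λ r → fn-map⁺ f P r q) (λ r → fn-map⁺ f Q r q) p

fn-subst⁺ : ∀ {k θ} (P : Proc k) {x} → x ∈ fnP P → θ x ∈ fnP (substP θ P)
fn-subst⁺ {θ = θ} P p = fn-map⁺ (substNm θ) P p (here refl)

fnD-∈ : ∀ {D x y} → (x , y) ∈ D → x ∈ fnD D × y ∈ fnD D
fnD-∈ (here refl) = here refl , there (here refl)
fnD-∈ (there p)   = there (there (proj₁ (fnD-∈ p))) , there (there (proj₂ (fnD-∈ p)))

fnD-⊆ : ∀ D {L : List ℕ} → (∀ {x y} → (x , y) ∈ D → x ∈ L × y ∈ L) → ∀ {x} → x ∈ fnD D → x ∈ L
fnD-⊆ (_ ∷ D) h (here refl)         = proj₁ (h (here refl))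
fnD-⊆ (_ ∷ D) h (there (here refl)) = proj₂ (h (here refl))
fnD-⊆ (_ ∷ D) h (there (there p))   = fnD-⊆ D (λ q → h (there q)) p

substD-⁻ : ∀ θ D {x y} → (x , y) ∈ substD θ D → Σ[ a ∈ ℕ ] Σ[ b ∈ ℕ ] ((a , b) ∈ D × x ≡ θ a × y ≡ θ b)
substD-⁻ θ ((a , b) ∷ D) (here refl) = a , b , here refl , refl , refl
substD-⁻ θ (_ ∷ D) (there p) with substD-⁻ θ D p
... | a , b , q , e , f = a , b , there q , e , f

substD-⁺ : ∀ θ {D x y} → (x , y) ∈ D → (θ x , θ y) ∈ substD θ D
substD-⁺ θ (here refl) = here refl
substD-⁺ θ (there p)   = there (substD-⁺ θ p)

extD-⁺ : ∀ D {z ns x} → x ∈ ns → (z , x) ∈ extD D z ns × (x , z) ∈ extD D z ns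
extD-⁺ D {z} {ns} p = ∈-++⁺ʳ D (proj₁ (go p)) , ∈-++⁺ʳ D (proj₂ (go p))
  where
  go : ∀ {ns x} → x ∈ ns → (z , x) ∈ extD [] z ns × (x , z) ∈ extD [] z ns
  go (here refl) = here refl , there (here refl)
  go (there q)   = there (there (proj₁ (go q))) , there (there (proj₂ (go q)))

extD-⁻ : ∀ D {z ns x y} → (x , y) ∈ extD D z ns → (x , y) ∈ D ⊎ (x ≡ z × y ∈ ns) ⊎ (x ∈ ns × y ≡ z)
extD-⁻ D {z} {ns} p with ∈-++⁻ D p
... | inj₁ q = inj₁ q
... | inj₂ q = inj₂ (go ns q)
  where
  go : ∀ ns {x y} → (x , y) ∈ extD [] z ns → (x ≡ z × y ∈ ns) ⊎ (x ∈ ns × y ≡ z)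
  go (n ∷ ns) (here refl)         = inj₁ (refl , here refl)
  go (n ∷ ns) (there (here refl)) = inj₂ (here refl , refl)
  go (n ∷ ns) (there (there q)) with go ns q
  ... | inj₁ (e , r) = inj₁ (e , there r)
  ... | inj₂ (r , e) = inj₂ (there r , e)

fnD-subst⁺ : ∀ θ D {x} → x ∈ fnD D → θ x ∈ fnD (substD θ D)
fnD-subst⁺ θ (_ ∷ D) (here refl)         = here refl
fnD-subst⁺ θ (_ ∷ D) (there (here refl)) = there (here refl)
fnD-subst⁺ θ (_ ∷ D) (there (there p))   = there (there (fnD-subst⁺ θ D p))

-- From transitions to provable atoms

con₂ : ∀ {Γ σ₁ σ₂ τ} → Const (σ₁ ⇒ σ₂ ⇒ τ) → Tm Γ σ₁ → Tm Γ σ₂ → Tm Γ τ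
con₂ c t u = app (app (con c) t) u

con₃ : ∀ {Γ σ₁ σ₂ σ₃ τ} → Const (σ₁ ⇒ σ₂ ⇒ σ₃ ⇒ τ) → Tm Γ σ₁ → Tm Γ σ₂ → Tm Γ σ₃ → Tm Γ τ
con₃ c t u v = app (app (app (con c) t) u) v

NmEnv : ℕ → Ctx → Set
NmEnv k Γ = Nm k → Tm Γ nT

extN : ∀ {k Γ} → NmEnv k Γ → NmEnv (suc k) (nT ∷ Γ)
extN e (fr x)       = ren there (e (fr x))
extN e (bv zero)    = var here
extN e (bv (suc i)) = ren there (e (bv i))

-- Total counterpart of `encP`: every name has a term in advance, so nothing can fail. `Carries`
-- relates the two.
enc : ∀ {k Γ} → NmEnv k Γ → Proc k → Tm Γ pT
enc e nil            = con c0
enc e (tauP P)       = app (con cTau) (enc e P)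
enc e (outP x y P)   = con₃ cOut (e x) (e y) (enc e P)
enc e (inP x P)      = con₂ cIn (e x) (lam (enc (extN e) P))
enc e (resP P)       = app (con cNu) (lam (enc (extN e) P))
enc e (matchP x y P) = con₃ cMatch (e x) (e y) (enc e P)
enc e (P ∣ Q)        = con₂ cPar (enc e P) (enc e Q)
enc e (P ⊕ Q)        = con₂ cPlus (enc e P) (enc e Q)

record Agree≈ {k Γ} (f g : NmEnv k Γ) (L : List ℕ) : Set where
  constructor agree≈
  field
    on-bv : ∀ i → f (bv i) ≈ g (bv i)
    on-fr : ∀ {x} → x ∈ L → f (fr x) ≈ g (fr x)

Agree≈-⊆ : ∀ {k Γ} {f g : NmEnv k Γ} {L L'} → (∀ {x} → x ∈ L' → x ∈ L) → Agree≈ f g L → Agree≈ f g L'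
Agree≈-⊆ h (agree≈ p q) = agree≈ p λ x → q (h x)

agree≈ˡ : ∀ {k Γ} {f g : NmEnv k Γ} L {L'} → Agree≈ f g (L ++ L') → Agree≈ f g L
agree≈ˡ L = Agree≈-⊆ ∈-++⁺ˡ

agree≈ʳ : ∀ {k Γ} {f g : NmEnv k Γ} L {L'} → Agree≈ f g (L ++ L') → Agree≈ f g L'
agree≈ʳ L = Agree≈-⊆ (∈-++⁺ʳ L)

agree≈-nm : ∀ {k Γ} {f g : NmEnv k Γ} n → Agree≈ f g (fnNm n) → f n ≈ g n
agree≈-nm (fr x) (agree≈ p q) = q (here refl)
agree≈-nm (bv i) (agree≈ p q) = p i

agree≈-ext : ∀ {k Γ} {f g : NmEnv k Γ} {L} → Agree≈ f g L → Agree≈ (extN f) (extN g) L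
agree≈-ext (agree≈ p q) =
  agree≈ (λ { zero → ≈refl ; (suc i) → ren-≈ (p i) }) λ x → ren-≈ (q x)

enc-≈ : ∀ {k Γ} {f g : NmEnv k Γ} (P : Proc k) → Agree≈ f g (fnP P) → enc f P ≈ enc g P
enc-≈ nil a            = ≈refl
enc-≈ (tauP P) a       = ≈app ≈refl (enc-≈ P a)
enc-≈ (outP x y P) a   =
  ≈app (≈app (≈app ≈refl (agree≈-nm x (agree≈ˡ (fnNm x) a)))
             (agree≈-nm y (agree≈ˡ (fnNm y) (agree≈ʳ (fnNm x) a))))
       (enc-≈ P (agree≈ʳ (fnNm y) (agree≈ʳ (fnNm x) a)))
enc-≈ (inP x P) a      =
  ≈app (≈app ≈refl (agree≈-nm x (agree≈ˡ (fnNm x) a)))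
       (≈lam (enc-≈ P (agree≈-ext (agree≈ʳ (fnNm x) a))))
enc-≈ (resP P) a       = ≈app ≈refl (≈lam (enc-≈ P (agree≈-ext a)))
enc-≈ (matchP x y P) a =
  ≈app (≈app (≈app ≈refl (agree≈-nm x (agree≈ˡ (fnNm x) a)))
             (agree≈-nm y (agree≈ˡ (fnNm y) (agree≈ʳ (fnNm x) a))))
       (enc-≈ P (agree≈ʳ (fnNm y) (agree≈ʳ (fnNm x) a)))
enc-≈ (P ∣ Q) a        =
  ≈app (≈app ≈refl (enc-≈ P (agree≈ˡ (fnP P) a))) (enc-≈ Q (agree≈ʳ (fnP P) a))
enc-≈ (P ⊕ Q) a        =
  ≈app (≈app ≈refl (enc-≈ P (agree≈ˡ (fnP P) a))) (enc-≈ Q (agree≈ʳ (fnP P) a))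

enc-≗ : ∀ {k Γ} {f g : NmEnv k Γ} → (∀ n → f n ≡ g n) → (P : Proc k) → enc f P ≈ enc g P
enc-≗ e P = enc-≈ P (agree≈ (λ i → ≡⇒≈ (e (bv i))) λ {x} _ → ≡⇒≈ (e (fr x)))

extN-shift : ∀ {k Γ} (e : NmEnv k Γ) n → extN e (shiftNm n) ≡ ren there (e n)
extN-shift e (fr x) = refl
extN-shift e (bv i) = refl

extN-lift : ∀ {k l Γ} (e : NmEnv l Γ) (f : Nm k → Nm l) n → extN e (liftNm f n) ≡ extN (λ m → e (f m)) n
extN-lift e f (fr x)       = extN-shift e (f (fr x))
extN-lift e f (bv zero)    = refl
extN-lift e f (bv (suc i)) = extN-shift e (f (bv i))

enc-map : ∀ {k l Γ} {e : NmEnv l Γ} {f : Nm k → Nm l} (P : Proc k) → enc e (mapP f P) ≈ enc (λ n → e (f n)) P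
enc-map nil            = ≈refl
enc-map (tauP P)       = ≈app ≈refl (enc-map P)
enc-map (outP x y P)   = ≈app ≈refl (enc-map P)
enc-map {e = e} {f} (inP x P) = ≈app ≈refl (≈lam (≈trans (enc-map P) (enc-≗ (extN-lift e f) P)))
enc-map {e = e} {f} (resP P)  = ≈app ≈refl (≈lam (≈trans (enc-map P) (enc-≗ (extN-lift e f) P)))
enc-map (matchP x y P) = ≈app ≈refl (enc-map P)
enc-map (P ∣ Q)        = ≈app (≈app ≈refl (enc-map P)) (enc-map Q)
enc-map (P ⊕ Q)        = ≈app (≈app ≈refl (enc-map P)) (enc-map Q)

enc-mapP : ∀ {k l Γ} {e : NmEnv l Γ} {f : Nm k → Nm l} {g : NmEnv k Γ} (P : Proc k) →
           Agree≈ (λ n → e (f n)) g (fnP P) → enc e (mapP f P) ≈ enc g P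
enc-mapP P a = ≈trans (enc-map P) (enc-≈ P a)

sub-extN : ∀ {k Γ Δ} (s : Sub Γ Δ) (e : NmEnv k Γ) n → sub (liftS s) (extN e n) ≡ extN (λ m → sub s (e m)) n
sub-extN s e (fr x)       = sub-wk (e (fr x))
sub-extN s e (bv zero)    = refl
sub-extN s e (bv (suc i)) = sub-wk (e (bv i))

sub-enc : ∀ {k Γ Δ} {s : Sub Γ Δ} {e : NmEnv k Γ} (P : Proc k) → sub s (enc e P) ≈ enc (λ n → sub s (e n)) P
sub-enc nil            = ≈refl
sub-enc (tauP P)       = ≈app ≈refl (sub-enc P)
sub-enc (outP x y P)   = ≈app ≈refl (sub-enc P)
sub-enc {s = s} {e} (inP x P) = ≈app ≈refl (≈lam (≈trans (sub-enc P) (enc-≗ (sub-extN s e) P)))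
sub-enc {s = s} {e} (resP P)  = ≈app ≈refl (≈lam (≈trans (sub-enc P) (enc-≗ (sub-extN s e) P)))
sub-enc (matchP x y P) = ≈app ≈refl (sub-enc P)
sub-enc (P ∣ Q)        = ≈app (≈app ≈refl (sub-enc P)) (sub-enc Q)
sub-enc (P ⊕ Q)        = ≈app (≈app ≈refl (sub-enc P)) (sub-enc Q)

ren-enc : ∀ {k Γ Δ} {r : Ren Γ Δ} {e : NmEnv k Γ} (P : Proc k) → ren r (enc e P) ≈ enc (λ n → ren r (e n)) P
ren-enc {e = e} P = ≈trans (≡⇒≈ (sym (sub-ren-var (enc e P))))
  (≈trans (sub-enc P) (enc-≗ (λ n → sub-ren-var (e n)) P))

nmE : ∀ {Γ} → (ℕ → Tm Γ nT) → NmEnv 0 Γ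
nmE e (fr x) = e x
nmE e (bv ())

⟦_⟧ : ∀ {Γ} → Proc 0 → (ℕ → Tm Γ nT) → Tm Γ pT
⟦ P ⟧ e = enc (nmE e) P

abs : ∀ {Γ} → (ℕ → Tm Γ nT) → Proc 1 → Tm (nT ∷ Γ) pT
abs e B = enc (extN (nmE e)) B

-- The environment under a ∇ whose variable is named y.
bind : ∀ {Γ} → ℕ → (ℕ → Tm Γ nT) → ℕ → Tm (nT ∷ Γ) nT
bind y e x = if x ≡ᵇ y then var here else ren there (e x)

bind-≡ : ∀ {Γ} y (e : ℕ → Tm Γ nT) → bind y e y ≡ var here
bind-≡ y e rewrite ≡ᵇ-refl y = refl

bind-≢ : ∀ {Γ y x} (e : ℕ → Tm Γ nT) → x ≢ y → bind y e x ≡ ren there (e x)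
bind-≢ e ne rewrite ≡ᵇ-≢ ne = refl

abs-β : ∀ {Γ} {e : ℕ → Tm Γ nT} (B : Proc 1) z → app (lam (abs e B)) (e z) ≈ ⟦ openP B z ⟧ e
abs-β {e = e} B z = ≈trans (≈β _ _) (≈trans (sub-enc B) (≈sym (enc-mapP B
  (agree≈ (λ { zero → ≈refl }) (λ {x} _ → ≡⇒≈ (sym (wk-[]₀ (e x))))))))

abs-wk-β : ∀ {Γ} {e : ℕ → Tm Γ nT} {m : Tm Γ (nT ⇒ pT)} (B : Proc 1) → m ≈ lam (abs e B) →
           app (ren there m) (var here) ≈ abs e B
abs-wk-β B h = ≈trans (≈app (ren-≈ h) ≈refl) (lam-wk-β _)

abs-shift : ∀ {Γ} {e : ℕ → Tm Γ nT} (P : Proc 0) → abs e (mapP shiftNm P) ≈ ren there (⟦ P ⟧ e)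
abs-shift {e = e} P = ≈trans (enc-mapP P (agree≈ (λ ()) (λ _ → ≈refl))) (≈sym (ren-enc P))

enc-open : ∀ {Γ} {e : ℕ → Tm Γ nT} {y} (B : Proc 1) → y ∉ fnP B → ⟦ openP B y ⟧ (bind y e) ≈ abs e B
enc-open {e = e} {y} B y∉ = enc-mapP B (agree≈
  (λ { zero → ≡⇒≈ (bind-≡ y e) })
  (λ {x} x∈ → ≡⇒≈ (bind-≢ e λ { refl → y∉ x∈ })))

enc-close : ∀ {Γ} {e : ℕ → Tm Γ nT} {y} (P : Proc 0) → abs e (closeP y P) ≈ ⟦ P ⟧ (bind y e)
enc-close {e = e} {y} P = enc-mapP P (agree≈ (λ ()) (λ {x} _ → pt x))
  where
  pt : ∀ x → extN (nmE e) (closeNm y (fr x)) ≈ bind y e x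
  pt x with x ≡ᵇ y
  ... | true  = ≈refl
  ... | false = ≈refl

-- The bound variable of B and the variable named y trade places, as in the clause for onep under ν.
enc-close-swap : ∀ {Γ} {e : ℕ → Tm Γ nT} {y} (B : Proc 1) {m : Tm Γ (nT ⇒ nT ⇒ pT)} →
                 m ≈ lam (lam (abs (bind y e) B)) →
                 lam (app (con cNu) (lam (app (app (ren there (ren there m)) (var here)) (var (there here)))))
                 ≈ lam (abs e (resP (closeP y B)))
enc-close-swap {Γ} {e} {y} B {m} h = ≈lam (≈app ≈refl (≈lam
  (≈trans (≈app (≈app (ren-≈ (ren-≈ h)) ≈refl) ≈refl)
  (≈trans (≈app (≈β _ _) ≈refl) (≈trans (≈β _ _)
  (≈trans (≡⇒≈ collapse) (≈trans (sub-enc B)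
  (≈sym (enc-mapP B (agree≈ (λ { zero → ≈refl }) (λ {x} _ → pt x)))))))))))
  where
  swap : Sub (nT ∷ nT ∷ Γ) (nT ∷ nT ∷ Γ)
  swap here              = var (there here)
  swap (there here)      = var here
  swap (there (there x)) = var (there (there x))
  b : Tm (nT ∷ nT ∷ Γ) pT
  b = abs (bind y e) B
  collapse : _ ≡ sub swap b
  collapse = trans (cong (λ t → sub _ (sub _ t)) (ren-ren b)) (trans (cong (sub _) (sub-ren b))
    (trans (sub-sub b) (sub-cong (λ { here → refl ; (there here) → refl ; (there (there x)) → refl }) b)))
  pt : ∀ x → extN (extN (nmE e)) (closeNm y (fr x)) ≈ sub swap (extN (nmE (bind y e)) (fr x))
  pt x with x ≡ᵇ y
  ... | true  = ≈refl
  ... | false = ≡⇒≈ (sym (trans (sub-ren (ren there (e x))) (trans (sub-ren (e x))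
                  (trans (sub-ren-var (e x)) (sym (ren-ren (e x)))))))

envOf : ∀ {Γ Δ} → All (Tm Δ) Γ → Sub Γ Δ
envOf (t ∷ ts) here      = t
envOf (t ∷ ts) (there x) = envOf ts x

data Pol : Set where
  inn out : Pol

polC : Pol → Const (nT ⇒ nT ⇒ aT)
polC inn = aDn
polC out = aUp

polA : Pol → ℕ → ℕ → Act
polA inn x z = binA x z
polA out x z = boutA x z

Der₁ : ∀ G σ → Tm (σ ++ G) pT → Tm (σ ++ G) aT → Tm (σ ++ G) pT → Set
Der₁ G σ p a q = Der one G σ (p ∷ a ∷ q ∷ [])

Derₚ : ∀ G σ → Tm (σ ++ G) pT → Tm (σ ++ G) (nT ⇒ aT) → Tm (σ ++ G) (nT ⇒ pT) → Set
Derₚ G σ p a m = Der onep G σ (p ∷ a ∷ m ∷ [])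

-- A bound transition shows its residual at the single name z, whereas `onep` speaks of an
-- abstraction. Newness of z makes `B` the abstraction from which the residual arose.
record Abs {G σ} (p : Tm (σ ++ G) pT) (e : ℕ → Tm (σ ++ G) nT) (d : Pol) (x z : ℕ) (P' : Proc 0) : Set where
  constructor absOf
  field
    B    : Proc 1
    new  : z ∉ fnP B
    opn  : P' ≡ openP B z
    step : Derₚ G σ p (app (con (polC d)) (e x)) (lam (abs e B))

Step : ∀ {G σ} → Tm (σ ++ G) pT → (ℕ → Tm (σ ++ G) nT) → Act → Proc 0 → Set
Step {G} {σ} p e τA          P' = Der₁ G σ p (con aTau) (⟦ P' ⟧ e)
Step {G} {σ} p e (outA x y)  P' = Der₁ G σ p (con₂ aUp (e x) (e y)) (⟦ P' ⟧ e)
-- The late rules never produce a free input label.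
Step {G} {σ} p e (inA x y)   P' = ⊥
Step {G} {σ} p e (binA x z)  P' = Abs {G} {σ} p e inn x z P'
Step {G} {σ} p e (boutA x z) P' = Abs {G} {σ} p e out x z P'

-- Serves the clauses that hand on action and residual unchanged: match and sum.
step-map : ∀ {G σ p p' e} → (∀ {a q} → Der₁ G σ p a q → Der₁ G σ p' a q) →
           (∀ {a q} → Derₚ G σ p a q → Derₚ G σ p' a q) →
           ∀ α {P'} → Step {G} {σ} p e α P' → Step {G} {σ} p' e α P'
step-map f g τA d          = f d
step-map f g (outA x y) d  = f d
step-map f g (binA x z) (absOf B z∉ eq d) = absOf B z∉ eq (g d)
step-map f g (boutA x z) (absOf B z∉ eq d) = absOf B z∉ eq (g d)

∉-++ : ∀ {A : Set} {x : A} L {L'} → x ∉ L → x ∉ L' → x ∉ L ++ L'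
∉-++ L p q r with ∈-++⁻ L r
... | inj₁ s = p s
... | inj₂ s = q s

par-absL : ∀ {G σ e d x z P'} (P Q : Proc 0) → z ∉ fnP Q → Abs {G} {σ} (⟦ P ⟧ e) e d x z P' →
           Abs {G} {σ} (⟦ P ∣ Q ⟧ e) e d x z (P' ∣ Q)
par-absL {e = e} {d} {x} P Q z∉ (absOf B z∉B refl s) = absOf (B ∣ mapP shiftNm Q)
  (∉-++ (fnP B) z∉B (z∉ ∘ fn-shift Q)) (cong (_ ∣_) (sym (open-shift Q)))
  (der c-parLp (envOf (⟦ P ⟧ e ∷ ⟦ Q ⟧ e ∷ app (con (polC d)) (e x) ∷ lam (abs e B) ∷ []))
    (≈refl ∷ ≈refl ∷ ≈lam (≈app (≈app ≈refl (≈sym (lam-wk-β _))) (abs-shift Q)) ∷ []) s)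

par-absR : ∀ {G σ e d x z Q'} (P Q : Proc 0) → z ∉ fnP P → Abs {G} {σ} (⟦ Q ⟧ e) e d x z Q' →
           Abs {G} {σ} (⟦ P ∣ Q ⟧ e) e d x z (P ∣ Q')
par-absR {e = e} {d} {x} P Q z∉ (absOf B z∉B refl s) = absOf (mapP shiftNm P ∣ B)
  (∉-++ (fnP (mapP shiftNm P)) (z∉ ∘ fn-shift P) z∉B) (cong (_∣ _) (sym (open-shift P)))
  (der c-parRp (envOf (⟦ P ⟧ e ∷ ⟦ Q ⟧ e ∷ app (con (polC d)) (e x) ∷ lam (abs e B) ∷ []))
    (≈refl ∷ ≈refl ∷ ≈lam (≈app (≈app ≈refl (abs-shift P)) (≈sym (lam-wk-β _))) ∷ []) s)

par-stepL : ∀ {G σ e} (P Q : Proc 0) α {P'} → (∀ {z} → z ∈ bnA α → z ∉ fnP Q) →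
            Step {G} {σ} (⟦ P ⟧ e) e α P' → Step {G} {σ} (⟦ P ∣ Q ⟧ e) e α (P' ∣ Q)
par-stepL {e = e} P Q τA {P'} z∉ d = der c-parL (envOf (⟦ P ⟧ e ∷ ⟦ Q ⟧ e ∷ con aTau ∷ ⟦ P' ⟧ e ∷ []))
  (≈refl ∷ ≈refl ∷ ≈refl ∷ []) d
par-stepL {e = e} P Q (outA x y) {P'} z∉ d = der c-parL (envOf (⟦ P ⟧ e ∷ ⟦ Q ⟧ e ∷ con₂ aUp (e x) (e y) ∷ ⟦ P' ⟧ e ∷ []))
  (≈refl ∷ ≈refl ∷ ≈refl ∷ []) d
par-stepL P Q (binA x z) z∉ d = par-absL P Q (z∉ (here refl)) d
par-stepL P Q (boutA x z) z∉ d = par-absL P Q (z∉ (here refl)) d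

par-stepR : ∀ {G σ e} (P Q : Proc 0) α {Q'} → (∀ {z} → z ∈ bnA α → z ∉ fnP P) →
            Step {G} {σ} (⟦ Q ⟧ e) e α Q' → Step {G} {σ} (⟦ P ∣ Q ⟧ e) e α (P ∣ Q')
par-stepR {e = e} P Q τA {P'} z∉ d = der c-parR (envOf (⟦ P ⟧ e ∷ ⟦ Q ⟧ e ∷ con aTau ∷ ⟦ P' ⟧ e ∷ []))
  (≈refl ∷ ≈refl ∷ ≈refl ∷ []) d
par-stepR {e = e} P Q (outA x y) {P'} z∉ d = der c-parR (envOf (⟦ P ⟧ e ∷ ⟦ Q ⟧ e ∷ con₂ aUp (e x) (e y) ∷ ⟦ P' ⟧ e ∷ []))
  (≈refl ∷ ≈refl ∷ ≈refl ∷ []) d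
par-stepR P Q (binA x z) z∉ d = par-absR P Q (z∉ (here refl)) d
par-stepR P Q (boutA x z) z∉ d = par-absR P Q (z∉ (here refl)) d

Der₁-≈ : ∀ {G σ p p' a a' q q'} → p' ≈ p → a' ≈ a → q' ≈ q → Der₁ G σ p a q → Der₁ G σ p' a' q'
Der₁-≈ e f g = Der-≈ (e ∷ f ∷ g ∷ [])

Derₚ-≈ : ∀ {G σ p p' a a' q q'} → p' ≈ p → a' ≈ a → q' ≈ q → Derₚ G σ p a q → Derₚ G σ p' a' q'
Derₚ-≈ e f g = Der-≈ (e ∷ f ∷ g ∷ [])

res-abs : ∀ {G σ e d x y z P'} (B : Proc 1) → y ∉ fnP B → y ≢ x → y ≢ z →
          Abs {G} {nT ∷ σ} (⟦ openP B y ⟧ (bind y e)) (bind y e) d x z P' →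
          Abs {G} {σ} (⟦ resP B ⟧ e) e d x z (resP (closeP y P'))
res-abs {e = e} {d} {x} {y} {z} B y∉ y≢x y≢z (absOf C z∉ refl s) = absOf (resP (closeP y C))
  (λ p → z∉ (proj₁ (fn-close C p))) (sym (close-open-swap C (λ p → y≢z (sym p))))
  (der c-nup (envOf (lam (abs e B) ∷ app (con (polC d)) (e x) ∷ m ∷ []))
    (≈app ≈refl (≈lam (≈sym (lam-wk-β _))) ∷ ≈refl ∷ ≈sym (enc-close-swap C {m} ≈refl) ∷ [])
    (Derₚ-≈ (≈trans (lam-wk-β _) (≈sym (enc-open B y∉)))
      (≈app ≈refl (≡⇒≈ (sym (bind-≢ e λ p → y≢x (sym p))))) (lam-wk-β _) s))
  where
  m : Tm _ (nT ⇒ nT ⇒ pT)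
  m = lam (lam (abs (bind y e) C))

res-step : ∀ {G σ e y} (B : Proc 1) α {P'} → y ∉ fnP B → y ∉ namesA α →
           Step {G} {nT ∷ σ} (⟦ openP B y ⟧ (bind y e)) (bind y e) α P' →
           Step {G} {σ} (⟦ resP B ⟧ e) e α (resP (closeP y P'))
res-step {e = e} {y} B τA {P'} y∉ y∉α d =
  der c-nu (envOf (lam (abs e B) ∷ con aTau ∷ lam (⟦ P' ⟧ (bind y e)) ∷ []))
    (≈app ≈refl (≈lam (≈sym (lam-wk-β _))) ∷ ≈refl ∷
     ≈app ≈refl (≈lam (≈trans (enc-close P') (≈sym (lam-wk-β _)))) ∷ [])
    (Der₁-≈ (≈trans (lam-wk-β _) (≈sym (enc-open B y∉))) ≈refl (lam-wk-β _) d)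
res-step {e = e} {y} B (outA x w) {P'} y∉ y∉α d =
  der c-nu (envOf (lam (abs e B) ∷ con₂ aUp (e x) (e w) ∷ lam (⟦ P' ⟧ (bind y e)) ∷ []))
    (≈app ≈refl (≈lam (≈sym (lam-wk-β _))) ∷ ≈refl ∷
     ≈app ≈refl (≈lam (≈trans (enc-close P') (≈sym (lam-wk-β _)))) ∷ [])
    (Der₁-≈ (≈trans (lam-wk-β _) (≈sym (enc-open B y∉)))
      (≈app (≈app ≈refl (≡⇒≈ (sym (bind-≢ e λ { refl → y∉α (here refl) }))))
            (≡⇒≈ (sym (bind-≢ e λ { refl → y∉α (there (here refl)) }))))
      (lam-wk-β _) d)
res-step B (binA x z) y∉ y∉α d =
  res-abs B y∉ (λ { refl → y∉α (here refl) }) (λ { refl → y∉α (there (here refl)) }) d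
res-step B (boutA x z) y∉ y∉α d =
  res-abs B y∉ (λ { refl → y∉α (here refl) }) (λ { refl → y∉α (there (here refl)) }) d

-- The environment is arbitrary, because equal names have equal terms under any `e`. It is the
-- converse direction that must exclude accidental equalities.
encode-step : ∀ {P α P'} → P —[ α ]→ P' → ∀ {G σ} (e : ℕ → Tm (σ ++ G) nT) → Step {G} {σ} (⟦ P ⟧ e) e α P'
encode-step (tauT {P}) e = der c-tau (envOf (⟦ P ⟧ e ∷ [])) (≈refl ∷ ≈refl ∷ ≈refl ∷ []) tt
encode-step (outT {x} {y} {P}) e =
  der c-out (envOf (e x ∷ e y ∷ ⟦ P ⟧ e ∷ [])) (≈refl ∷ ≈refl ∷ ≈refl ∷ []) tt
encode-step (inT {x} {B = B} z∉) e = absOf B z∉ refl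
  (der c-in (envOf (e x ∷ lam (abs e B) ∷ [])) (≈refl ∷ ≈refl ∷ ≈refl ∷ []) tt)
encode-step (sumL {P} {Q} {α} t) {G} {σ} e = step-map {p = ⟦ P ⟧ e}
  (λ {a} {q} d → der c-sumL (envOf (⟦ P ⟧ e ∷ ⟦ Q ⟧ e ∷ a ∷ q ∷ [])) (≈refl ∷ ≈refl ∷ ≈refl ∷ []) d)
  (λ {a} {q} d → der c-sumLp (envOf (⟦ P ⟧ e ∷ ⟦ Q ⟧ e ∷ a ∷ q ∷ [])) (≈refl ∷ ≈refl ∷ ≈refl ∷ []) d)
  α (encode-step t e)
encode-step (sumR {P} {Q} {α} t) e = step-map {p = ⟦ Q ⟧ e}
  (λ {a} {q} d → der c-sumR (envOf (⟦ P ⟧ e ∷ ⟦ Q ⟧ e ∷ a ∷ q ∷ [])) (≈refl ∷ ≈refl ∷ ≈refl ∷ []) d)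
  (λ {a} {q} d → der c-sumRp (envOf (⟦ P ⟧ e ∷ ⟦ Q ⟧ e ∷ a ∷ q ∷ [])) (≈refl ∷ ≈refl ∷ ≈refl ∷ []) d)
  α (encode-step t e)
encode-step (matchT {x} {P} {α} t) e = step-map {p = ⟦ P ⟧ e}
  (λ {a} {q} d → der c-match (envOf (e x ∷ ⟦ P ⟧ e ∷ a ∷ q ∷ [])) (≈refl ∷ ≈refl ∷ ≈refl ∷ []) d)
  (λ {a} {q} d → der c-matchp (envOf (e x ∷ ⟦ P ⟧ e ∷ a ∷ q ∷ [])) (≈refl ∷ ≈refl ∷ ≈refl ∷ []) d)
  α (encode-step t e)
encode-step (parL {P} {Q} {α} t z∉) e = par-stepL P Q α z∉ (encode-step t e)
encode-step (parR {P} {Q} {α} t z∉) e = par-stepR P Q α z∉ (encode-step t e)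
encode-step (comL {P} {Q} {P'} {x = x} {y} t u) e with encode-step u e
... | absOf C z∉ refl d =
  der c-com₂ (envOf (⟦ P ⟧ e ∷ ⟦ Q ⟧ e ∷ ⟦ P' ⟧ e ∷ lam (abs e C) ∷ e y ∷ []))
    (≈refl ∷ ≈refl ∷ ≈app ≈refl (≈trans (≡⇒≈ (cong (λ R → ⟦ R ⟧ e) (subst-open C z∉))) (≈sym (abs-β C y))) ∷ [])
    (e x , encode-step t e , d)
encode-step (comR {P} {Q} {Q' = Q'} {x} {y} t u) e with encode-step t e
... | absOf C z∉ refl d =
  der c-com₁ (envOf (⟦ P ⟧ e ∷ ⟦ Q ⟧ e ∷ lam (abs e C) ∷ e y ∷ ⟦ Q' ⟧ e ∷ []))
    (≈refl ∷ ≈refl ∷ ≈app (≈app ≈refl (≈trans (≡⇒≈ (cong (λ R → ⟦ R ⟧ e) (subst-open C z∉))) (≈sym (abs-β C y)))) ≈refl ∷ [])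
    (e x , d , encode-step u e)
encode-step (closeL {P} {Q} {x = x} {w} t u) e with encode-step t e | encode-step u e
... | absOf C w∉C refl d | absOf C' w∉C' refl d' =
  der c-close₂ (envOf (⟦ P ⟧ e ∷ ⟦ Q ⟧ e ∷ lam (abs e C) ∷ lam (abs e C') ∷ []))
    (≈refl ∷ ≈refl ∷ ≈app ≈refl (≈lam (≈app (≈app ≈refl (piece C w∉C)) (piece C' w∉C'))) ∷ [])
    (e x , d , d')
  where
  piece : ∀ C → w ∉ fnP C → abs e (closeP w (openP C w)) ≈ app (ren there (lam (abs e C))) (var here)
  piece C w∉ = ≈trans (≡⇒≈ (cong (abs e) (close-open C w∉))) (≈sym (lam-wk-β _))
encode-step (closeR {P} {Q} {x = x} {w} t u) e with encode-step t e | encode-step u e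
... | absOf C w∉C refl d | absOf C' w∉C' refl d' =
  der c-close₁ (envOf (⟦ P ⟧ e ∷ ⟦ Q ⟧ e ∷ lam (abs e C) ∷ lam (abs e C') ∷ []))
    (≈refl ∷ ≈refl ∷ ≈app ≈refl (≈lam (≈app (≈app ≈refl (piece C w∉C)) (piece C' w∉C'))) ∷ [])
    (e x , d , d')
  where
  piece : ∀ C → w ∉ fnP C → abs e (closeP w (openP C w)) ≈ app (ren there (lam (abs e C))) (var here)
  piece C w∉ = ≈trans (≡⇒≈ (cong (abs e) (close-open C w∉))) (≈sym (lam-wk-β _))
-- The fresh name chosen by the rule becomes the variable of the ∇ in the clause.
encode-step (resT {B} {y} {α} y∉ y∉α t) e = res-step B α y∉ y∉α (encode-step t (bind y e))
encode-step (openT {B} {y} {x} {w} {P'} y∉ y≢x t w∉) e = absOf (closeP y P') w∉ (subst-close P')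
  (der c-open (envOf (lam (abs e B) ∷ e x ∷ lam (abs e (closeP y P')) ∷ []))
    (≈app ≈refl (≈lam (≈sym (lam-wk-β _))) ∷ ≈refl ∷ ≈refl ∷ [])
    (Der₁-≈ (≈trans (lam-wk-β _) (≈sym (enc-open B y∉)))
      (≈app (≈app ≈refl (≡⇒≈ (sym (bind-≢ e λ p → y≢x (sym p))))) (≡⇒≈ (sym (bind-≡ y e))))
      (≈trans (lam-wk-β _) (enc-close P')) (encode-step t (bind y e))))

-- From provable atoms to transitions

-- Each process constructor has its own constant, so the heads of convertible encodings exclude all
-- other constructors, and injectivity yields the arguments. The next six inversions follow the same
-- pattern.
enc-tau : ∀ {k Γ} {e : NmEnv k Γ} (P : Proc k) {t} → enc e P ≈ app (con cTau) t →
  Σ[ P₁ ∈ Proc k ] (P ≡ tauP P₁ × enc e P₁ ≈ t)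
enc-tau nil h with () ← head-≈ pB tt tt h
enc-tau (tauP P) h = _ , refl , con-inj₁ pB h
enc-tau (outP x y P) h with () ← head-≈ pB tt tt h
enc-tau (inP x P) h with () ← head-≈ pB tt tt h
enc-tau (resP P) h with () ← head-≈ pB tt tt h
enc-tau (matchP x y P) h with () ← head-≈ pB tt tt h
enc-tau (P ∣ Q) h with () ← head-≈ pB tt tt h
enc-tau (P ⊕ Q) h with () ← head-≈ pB tt tt h

enc-out : ∀ {k Γ} {e : NmEnv k Γ} (P : Proc k) {a b t} → enc e P ≈ con₃ cOut a b t →
  Σ[ x ∈ Nm k ] Σ[ y ∈ Nm k ] Σ[ P₁ ∈ Proc k ] (P ≡ outP x y P₁ × e x ≈ a × e y ≈ b × enc e P₁ ≈ t)
enc-out nil h with () ← head-≈ pB tt tt h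
enc-out (tauP P) h with () ← head-≈ pB tt tt h
enc-out (outP x y P) h = _ , _ , _ , refl , con-inj₃ pB h
enc-out (inP x P) h with () ← head-≈ pB tt tt h
enc-out (resP P) h with () ← head-≈ pB tt tt h
enc-out (matchP x y P) h with () ← head-≈ pB tt tt h
enc-out (P ∣ Q) h with () ← head-≈ pB tt tt h
enc-out (P ⊕ Q) h with () ← head-≈ pB tt tt h

enc-in : ∀ {k Γ} {e : NmEnv k Γ} (P : Proc k) {a t} → enc e P ≈ con₂ cIn a t →
  Σ[ x ∈ Nm k ] Σ[ P₁ ∈ Proc (suc k) ] (P ≡ inP x P₁ × e x ≈ a × lam (enc (extN e) P₁) ≈ t)
enc-in nil h with () ← head-≈ pB tt tt h
enc-in (tauP P) h with () ← head-≈ pB tt tt h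
enc-in (outP x y P) h with () ← head-≈ pB tt tt h
enc-in (inP x P) h = _ , _ , refl , con-inj₂ pB h
enc-in (resP P) h with () ← head-≈ pB tt tt h
enc-in (matchP x y P) h with () ← head-≈ pB tt tt h
enc-in (P ∣ Q) h with () ← head-≈ pB tt tt h
enc-in (P ⊕ Q) h with () ← head-≈ pB tt tt h

enc-res : ∀ {k Γ} {e : NmEnv k Γ} (P : Proc k) {t} → enc e P ≈ app (con cNu) t →
  Σ[ P₁ ∈ Proc (suc k) ] (P ≡ resP P₁ × lam (enc (extN e) P₁) ≈ t)
enc-res nil h with () ← head-≈ pB tt tt h
enc-res (tauP P) h with () ← head-≈ pB tt tt h
enc-res (outP x y P) h with () ← head-≈ pB tt tt h
enc-res (inP x P) h with () ← head-≈ pB tt tt h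
enc-res (resP P) h = _ , refl , con-inj₁ pB h
enc-res (matchP x y P) h with () ← head-≈ pB tt tt h
enc-res (P ∣ Q) h with () ← head-≈ pB tt tt h
enc-res (P ⊕ Q) h with () ← head-≈ pB tt tt h

enc-match : ∀ {k Γ} {e : NmEnv k Γ} (P : Proc k) {a b t} → enc e P ≈ con₃ cMatch a b t →
  Σ[ x ∈ Nm k ] Σ[ y ∈ Nm k ] Σ[ P₁ ∈ Proc k ] (P ≡ matchP x y P₁ × e x ≈ a × e y ≈ b × enc e P₁ ≈ t)
enc-match nil h with () ← head-≈ pB tt tt h
enc-match (tauP P) h with () ← head-≈ pB tt tt h
enc-match (outP x y P) h with () ← head-≈ pB tt tt h
enc-match (inP x P) h with () ← head-≈ pB tt tt h
enc-match (resP P) h with () ← head-≈ pB tt tt h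
enc-match (matchP x y P) h = _ , _ , _ , refl , con-inj₃ pB h
enc-match (P ∣ Q) h with () ← head-≈ pB tt tt h
enc-match (P ⊕ Q) h with () ← head-≈ pB tt tt h

enc-par : ∀ {k Γ} {e : NmEnv k Γ} (P : Proc k) {t u} → enc e P ≈ con₂ cPar t u →
  Σ[ P₁ ∈ Proc k ] Σ[ P₂ ∈ Proc k ] (P ≡ (P₁ ∣ P₂) × enc e P₁ ≈ t × enc e P₂ ≈ u)
enc-par nil h with () ← head-≈ pB tt tt h
enc-par (tauP P) h with () ← head-≈ pB tt tt h
enc-par (outP x y P) h with () ← head-≈ pB tt tt h
enc-par (inP x P) h with () ← head-≈ pB tt tt h
enc-par (resP P) h with () ← head-≈ pB tt tt h
enc-par (matchP x y P) h with () ← head-≈ pB tt tt h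
enc-par (P ∣ Q) h = _ , _ , refl , con-inj₂ pB h
enc-par (P ⊕ Q) h with () ← head-≈ pB tt tt h

enc-sum : ∀ {k Γ} {e : NmEnv k Γ} (P : Proc k) {t u} → enc e P ≈ con₂ cPlus t u →
  Σ[ P₁ ∈ Proc k ] Σ[ P₂ ∈ Proc k ] (P ≡ (P₁ ⊕ P₂) × enc e P₁ ≈ t × enc e P₂ ≈ u)
enc-sum nil h with () ← head-≈ pB tt tt h
enc-sum (tauP P) h with () ← head-≈ pB tt tt h
enc-sum (outP x y P) h with () ← head-≈ pB tt tt h
enc-sum (inP x P) h with () ← head-≈ pB tt tt h
enc-sum (resP P) h with () ← head-≈ pB tt tt h
enc-sum (matchP x y P) h with () ← head-≈ pB tt tt h
enc-sum (P ∣ Q) h with () ← head-≈ pB tt tt h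
enc-sum (P ⊕ Q) h = _ , _ , refl , con-inj₂ pB h

-- Freshness of variables bound by ∇

wk-inj : ∀ {Γ σ τ} {t u : Tm Γ τ} → Tm Γ σ → ren (there {σ = σ}) t ≈ ren there u → t ≈ u
wk-inj {t = t} {u} v h = ≈trans (≡⇒≈ (sym (wk-[]₀ t))) (≈trans (sub-≈ {s = ext var v} h) (≡⇒≈ (wk-[]₀ u)))

-- Two renamings that agree on weakened terms and differ on the newest variable. A weakened term
-- convertible to one that exhibits this variable would make two distinct variables convertible. The
-- argument covers arbitrary terms, also those that are not neutral.
dup₁ dup₂ : ∀ {Γ} → Ren (nT ∷ Γ) (nT ∷ nT ∷ Γ)
dup₁ = liftR there
dup₂ = there

dup-wk : ∀ {Γ τ} (t : Tm Γ τ) → ren dup₁ (ren there t) ≡ ren dup₂ (ren there t)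
dup-wk t = trans (ren-ren t) (sym (ren-ren t))

dup-≈ : ∀ {Γ τ} (t : Tm Γ τ) {u : Tm (nT ∷ Γ) τ} → ren there t ≈ u → ren dup₁ u ≈ ren dup₂ u
dup-≈ t h = ≈trans (ren-≈ (≈sym h)) (≈trans (≡⇒≈ (dup-wk t)) (ren-≈ h))

copies-differ : ∀ {Γ} → ¬ (var {nT ∷ nT ∷ Γ} {nT} here ≈ var (there here))
copies-differ h with () ← head-≈ nB tt tt h

fresh-var : ∀ {Γ} (t : Tm Γ nT) → ¬ (ren there t ≈ var here)
fresh-var t h = copies-differ (dup-≈ t h)

fresh-act₁ : ∀ {Γ} (a : Tm Γ aT) {t} → ¬ (ren there a ≈ con₂ aUp (var here) t)
fresh-act₁ a h = copies-differ (proj₁ (con-inj₂ aB (dup-≈ a h)))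

fresh-act₂ : ∀ {Γ} (a : Tm Γ aT) {t} → ¬ (ren there a ≈ con₂ aUp t (var here))
fresh-act₂ a h = copies-differ (proj₂ (con-inj₂ aB (dup-≈ a h)))

-- The arrow type is not a base type, so both sides are first applied to a common argument.
act-inj : ∀ {Γ} {c : Const (nT ⇒ nT ⇒ aT)} {t u : Tm Γ nT} → app (con c) t ≈ app (con c) u → t ≈ u
act-inj {t = t} h = proj₁ (con-inj₂ aB (≈app h (≈refl {t = t})))

fresh-actₚ : ∀ {Γ} (a : Tm Γ (nT ⇒ aT)) {c} → ¬ (ren there a ≈ app (con c) (var here))
fresh-actₚ a h = copies-differ (act-inj (dup-≈ a h))

pol-inj : ∀ {Γ} d d' {t u : Tm Γ nT} → app (con (polC d)) t ≈ app (con (polC d')) u → d ≡ d' × t ≈ u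
pol-inj inn inn h = refl , act-inj h
pol-inj out out h = refl , act-inj h
pol-inj inn out {t} h with () ← head-≈ aB tt tt (≈app h (≈refl {t = t}))
pol-inj out inn {t} h with () ← head-≈ aB tt tt (≈app h (≈refl {t = t}))

Inj : ∀ {Γ} → (ℕ → Tm Γ nT) → List ℕ → Set
Inj e L = ∀ {x y} → x ∈ L → y ∈ L → e x ≈ e y → x ≡ y

Inj-⊆ : ∀ {Γ} {e : ℕ → Tm Γ nT} {L L'} → (∀ {x} → x ∈ L' → x ∈ L) → Inj e L → Inj e L'
Inj-⊆ h i p q = i (h p) (h q)

-- The new variable differs from every weakened term, so decoding may continue under a ∇.
Inj-bind : ∀ {Γ} {e : ℕ → Tm Γ nT} y B → Inj e (fnP B) → Inj (bind y e) (fnP (openP B y))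
Inj-bind {e = e} y B i {x} {x'} p p' h with x ≟ y | x' ≟ y
... | yes refl | yes refl = refl
... | yes refl | no n = ⊥-elim (fresh-var (e x') (≈trans (≡⇒≈ (sym (bind-≢ e n)))
                          (≈trans (≈sym h) (≡⇒≈ (bind-≡ y e)))))
... | no n | yes refl = ⊥-elim (fresh-var (e x) (≈trans (≡⇒≈ (sym (bind-≢ e n)))
                          (≈trans h (≡⇒≈ (bind-≡ y e)))))
... | no n | no n' with fn-open B p | fn-open B p'
...   | inj₂ q | _      = ⊥-elim (n q)
...   | inj₁ q | inj₂ r = ⊥-elim (n' r)
...   | inj₁ q | inj₁ r = i q r (wk-inj (e x)
        (≈trans (≡⇒≈ (sym (bind-≢ e n))) (≈trans h (≡⇒≈ (bind-≢ e n')))))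

Represents : ∀ {Γ} → (ℕ → Tm Γ nT) → Act → Tm Γ aT → Set
Represents e τA         a = a ≈ con aTau
Represents e (outA x y) a = a ≈ con₂ aUp (e x) (e y)
Represents e _          a = ⊥

represents-free : ∀ {Γ} {e : ℕ → Tm Γ nT} α {a} → Represents e α a → ∀ {z} → z ∉ bnA α
represents-free τA r ()
represents-free (outA x y) r ()

-- An action term from outside the ∇ cannot mention its variable; this gives the side condition of
-- `resT`.
represents-bind : ∀ {Γ} {e : ℕ → Tm Γ nT} {y} α {a} → Represents (bind y e) α (ren there a) →
                  Represents e α a × y ∉ namesA α
represents-bind {e = e} τA r = wk-inj (e 0) r , λ ()
represents-bind {e = e} {y} (outA x w) {a} r with x ≟ y | w ≟ y
... | yes refl | _ = ⊥-elim (fresh-act₁ a (≈trans r (≈app (≈app ≈refl (≡⇒≈ (bind-≡ y e))) ≈refl)))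
... | no n | yes refl = ⊥-elim (fresh-act₂ a (≈trans r (≈app ≈refl (≡⇒≈ (bind-≡ y e)))))
... | no n | no n' =
  wk-inj (e 0) (≈trans r (≈app (≈app ≈refl (≡⇒≈ (bind-≢ e n))) (≡⇒≈ (bind-≢ e n')))) ,
  λ { (here refl) → n refl ; (there (here refl)) → n' refl }

record Dec₁ {Γ} (P : Proc 0) (e : ℕ → Tm Γ nT) (a : Tm Γ aT) (q : Tm Γ pT) : Set where
  constructor dec₁
  field
    α   : Act
    P'  : Proc 0
    rep : Represents e α a
    tr  : P —[ α ]→ P'
    res : q ≈ ⟦ P' ⟧ e

record Decₚ {Γ} (P : Proc 0) (z : ℕ) (e : ℕ → Tm Γ nT) (a : Tm Γ (nT ⇒ aT)) (m : Tm Γ (nT ⇒ pT)) : Set where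
  constructor decₚ
  field
    d   : Pol
    x   : ℕ
    B   : Proc 1
    rep : a ≈ app (con (polC d)) (e x)
    tr  : P —[ polA d x z ]→ openP B z
    new : z ∉ fnP B
    res : m ≈ lam (abs e B)

pol-bn : ∀ d {x z w} → w ∈ bnA (polA d x z) → w ≡ z
pol-bn inn (here refl) = refl
pol-bn out (here refl) = refl

pol-names : ∀ d {x z w} → w ∈ namesA (polA d x z) → w ≡ x ⊎ w ≡ z
pol-names inn (here refl)         = inj₁ refl
pol-names inn (there (here refl)) = inj₂ refl
pol-names out (here refl)         = inj₁ refl
pol-names out (there (here refl)) = inj₂ refl

dec-input : ∀ {Γ P z e} {X : Tm Γ nT} {m} d → Decₚ P z e (app (con (polC d)) X) m →
            Σ[ x ∈ ℕ ] Σ[ B ∈ Proc 1 ] (X ≈ e x × (P —[ polA d x z ]→ openP B z) × z ∉ fnP B × m ≈ lam (abs e B))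
dec-input d (decₚ d' x B rep tr new res) with pol-inj d d' rep
... | refl , h = x , B , h , tr , new , res

dec-output : ∀ {Γ P e} {X Y : Tm Γ nT} {q} → Dec₁ P e (con₂ aUp X Y) q →
             Σ[ x ∈ ℕ ] Σ[ y ∈ ℕ ] Σ[ P' ∈ Proc 0 ] (X ≈ e x × Y ≈ e y × (P —[ outA x y ]→ P') × q ≈ ⟦ P' ⟧ e)
dec-output (dec₁ τA P' rep tr res) with () ← head-≈ aB tt tt rep
dec-output (dec₁ (outA x y) P' rep tr res) with con-inj₂ aB rep
... | h , h' = x , y , P' , h , h' , tr , res

dec₁-≈ : ∀ {Γ P e} {a a' : Tm Γ aT} {q q'} → a' ≈ a → q' ≈ q → Dec₁ P e a q → Dec₁ P e a' q'
dec₁-≈ ea eq (dec₁ τA P' rep tr res) = dec₁ τA P' (≈trans ea rep) tr (≈trans eq res)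
dec₁-≈ ea eq (dec₁ (outA x y) P' rep tr res) = dec₁ (outA x y) P' (≈trans ea rep) tr (≈trans eq res)

decode-nu : ∀ {Γ} (B : Proc 1) (e : ℕ → Tm Γ nT) {y a q} → y ∉ fnP B →
            Dec₁ (openP B y) (bind y e) (ren there a) (app (ren there q) (var here)) →
            Dec₁ (resP B) e a (app (con cNu) (lam (app (ren there q) (var here))))
decode-nu B e y∉ (dec₁ α P' rep tr res) with represents-bind α rep
... | rep' , y∉α = dec₁ α _ rep' (resT y∉ y∉α tr) (≈app ≈refl (≈lam (≈trans res (≈sym (enc-close P')))))

close-residual : ∀ {z} B C → z ∉ fnP B → z ∉ fnP C →
                 resP (closeP z (openP B z ∣ openP C z)) ≡ resP (B ∣ C)
close-residual B C p q = cong resP (cong₂ _∣_ (close-open B p) (close-open C q))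

decode-close : ∀ {Γ P₁ P₂ x z B C e} {m n : Tm Γ (nT ⇒ pT)} {a q} → z ∉ fnP B → z ∉ fnP C →
               m ≈ lam (abs e B) → n ≈ lam (abs e C) → a ≈ con aTau →
               q ≈ app (con cNu) (lam (con₂ cPar (app (ren there m) (var here)) (app (ren there n) (var here)))) →
               (P₁ —[ binA x z ]→ openP B z) × (P₂ —[ boutA x z ]→ openP C z) ⊎
               (P₁ —[ boutA x z ]→ openP B z) × (P₂ —[ binA x z ]→ openP C z) →
               Dec₁ (P₁ ∣ P₂) e a q
decode-close {P₁ = P₁} {P₂} {B = B} {C} z∉B z∉C hm hn ea eq t = dec₁ τA (resP (B ∣ C)) ea
  (subst (λ R → (P₁ ∣ P₂) —[ τA ]→ R) (close-residual B C z∉B z∉C) (go t))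
  (≈trans eq (≈app ≈refl (≈lam (≈app (≈app ≈refl (abs-wk-β B hm)) (abs-wk-β C hn)))))
  where
  go : _ → _
  go (inj₁ (t₁ , t₂)) = closeR t₁ t₂
  go (inj₂ (t₁ , t₂)) = closeL t₁ t₂

decₚ-≈ : ∀ {Γ P z e} {a a' : Tm Γ (nT ⇒ aT)} {m m'} → a' ≈ a → m' ≈ m → Decₚ P z e a m → Decₚ P z e a' m'
decₚ-≈ ea em (decₚ d x B rep tr new res) = decₚ d x B (≈trans ea rep) tr new (≈trans em res)

decode-nup : ∀ {Γ} (B : Proc 1) (e : ℕ → Tm Γ nT) {y z a} {m : Tm Γ (nT ⇒ nT ⇒ pT)} → y ∉ fnP B → y ≢ z →
             Decₚ (openP B y) z (bind y e) (ren there a) (app (ren there m) (var here)) →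
             Decₚ (resP B) z e a
               (lam (app (con cNu) (lam (app (app (ren there (ren there m)) (var here)) (var (there here))))))
decode-nup B e {y} {z} {a} {m} y∉ y≢z (decₚ d x C rep tr new res) with x ≟ y
... | yes refl = ⊥-elim (fresh-actₚ a (≈trans rep (≈app ≈refl (≡⇒≈ (bind-≡ y e)))))
... | no n = decₚ d x (resP (closeP y C))
  (wk-inj (e 0) (≈trans rep (≈app ≈refl (≡⇒≈ (bind-≢ e n)))))
  (subst (λ R → resP B —[ polA d x z ]→ R) (sym (close-open-swap C (λ p → y≢z (sym p))))
    (resT y∉ (λ p → Sum.[ (λ q → n (sym q)) , y≢z ] (pol-names d p)) tr))
  (λ p → new (proj₁ (fn-close C p)))
  (enc-close-swap C {m} (η-lam res))

-- Only one case survives: the subject comes from outside the ∇ and so is not y, while the object is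
-- the ∇-variable itself and so is y.
decode-open : ∀ {Γ} (B : Proc 1) (e : ℕ → Tm Γ nT) {y z X} {m : Tm Γ (nT ⇒ pT)} → y ∉ fnP B → z ∉ fnP B →
              Dec₁ (openP B y) (bind y e) (con₂ aUp (ren there X) (var here)) (app (ren there m) (var here)) →
              Decₚ (resP B) z e (app (con aUp) X) m
decode-open B e {y} {z} {X} y∉ z∉ D with dec-output D
... | x , w , P' , hx , hw , tr , res with x ≟ y | w ≟ y
...   | yes refl | _ = ⊥-elim (fresh-var X (≈trans hx (≡⇒≈ (bind-≡ y e))))
...   | no n | no n' = ⊥-elim (fresh-var (e w) (≈sym (≈trans hw (≡⇒≈ (bind-≢ e n')))))
...   | no n | yes refl = decₚ out x (closeP y P')
  (≈app ≈refl (wk-inj (e 0) (≈trans hx (≡⇒≈ (bind-≢ e n)))))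
  (subst (λ R → resP B —[ boutA x z ]→ R) (subst-close P') (openT y∉ (λ p → n (sym p)) tr new))
  new
  (η-lam (≈trans res (≈sym (enc-close P'))))
  where
  new : z ∉ fnP (closeP y P')
  new p with fn-close P' p
  ... | q , z≢y with res-fn tr q
  ...   | inj₁ r = Sum.[ z∉ , z≢y ] (fn-open B r)

-- Injectivity turns equality of terms back into equality of names. It is needed for match and for
-- the common subject `X` of a communication, which the two sides decode separately.
mutual
  decode₁ : ∀ {G σ p a q} → Der₁ G σ p a q → ∀ P (e : ℕ → Tm (σ ++ G) nT) → Inj e (fnP P) → ⟦ P ⟧ e ≈ p → Dec₁ P e a q
  decode₁ (der c-tau u (ep ∷ ea ∷ eq ∷ []) _) P e i h with enc-tau P (≈trans h ep)
  ... | P₁ , refl , h₁ = dec₁ τA P₁ ea tauT (≈trans eq (≈sym h₁))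
  decode₁ (der c-out u (ep ∷ ea ∷ eq ∷ []) _) P e i h with enc-out P (≈trans h ep)
  ... | fr x , fr y , P₁ , refl , hx , hy , h₁ =
    dec₁ (outA x y) P₁ (≈trans ea (≈app (≈app ≈refl (≈sym hx)) (≈sym hy))) outT (≈trans eq (≈sym h₁))
  decode₁ (der c-match u (ep ∷ ea ∷ eq ∷ []) d) P e i h with enc-match P (≈trans h ep)
  ... | fr x , fr y , P₁ , refl , hx , hy , h₁
    with refl ← i (here refl) (there (here refl)) (≈trans hx (≈sym hy))
    with dec₁ α P' rep tr res ← decode₁ d P₁ e (Inj-⊆ (λ p → there (there p)) i) h₁ =
      dec₁-≈ ea eq (dec₁ α P' rep (matchT tr) res)
  decode₁ (der c-sumL u (ep ∷ ea ∷ eq ∷ []) d) P e i h with enc-sum P (≈trans h ep)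
  ... | P₁ , P₂ , refl , h₁ , h₂
    with dec₁ α P' rep tr res ← decode₁ d P₁ e (Inj-⊆ ∈-++⁺ˡ i) h₁ =
      dec₁-≈ ea eq (dec₁ α P' rep (sumL tr) res)
  decode₁ (der c-sumR u (ep ∷ ea ∷ eq ∷ []) d) P e i h with enc-sum P (≈trans h ep)
  ... | P₁ , P₂ , refl , h₁ , h₂
    with dec₁ α P' rep tr res ← decode₁ d P₂ e (Inj-⊆ (∈-++⁺ʳ (fnP P₁)) i) h₂ =
      dec₁-≈ ea eq (dec₁ α P' rep (sumR tr) res)
  decode₁ (der c-parL u (ep ∷ ea ∷ eq ∷ []) d) P e i h with enc-par P (≈trans h ep)
  ... | P₁ , P₂ , refl , h₁ , h₂
    with dec₁ α P' rep tr res ← decode₁ d P₁ e (Inj-⊆ ∈-++⁺ˡ i) h₁ =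
      dec₁-≈ ea eq (dec₁ α (P' ∣ P₂) rep (parL tr (⊥-elim ∘ represents-free α rep))
        (≈app (≈app ≈refl res) (≈sym h₂)))
  decode₁ (der c-parR u (ep ∷ ea ∷ eq ∷ []) d) P e i h with enc-par P (≈trans h ep)
  ... | P₁ , P₂ , refl , h₁ , h₂
    with dec₁ α P' rep tr res ← decode₁ d P₂ e (Inj-⊆ (∈-++⁺ʳ (fnP P₁)) i) h₂ =
      dec₁-≈ ea eq (dec₁ α (P₁ ∣ P') rep (parR tr (⊥-elim ∘ represents-free α rep))
        (≈app (≈app ≈refl (≈sym h₁)) res))
  decode₁ (der c-nu u (ep ∷ ea ∷ eq ∷ []) d) P e i h with enc-res P (≈trans h ep)
  ... | B , refl , h₁ = dec₁-≈ ea eq (decode-nu B e (fresh-∉ (fnP B))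
      (decode₁ d (openP B (fresh (fnP B))) _ (Inj-bind _ B i) (≈trans (enc-open B (fresh-∉ (fnP B))) (lam-inj h₁))))
  decode₁ (der c-close₁ u (ep ∷ ea ∷ eq ∷ []) (X , d₁ , d₂)) P e i h with enc-par P (≈trans h ep)
  ... | P₁ , P₂ , refl , h₁ , h₂
    -- Both sides are decoded at one name fresh for the whole composition, since `closeR` wants the
    -- same bound name on both.
    with x , B , hx , t , z∉B , hm ←
           dec-input inn (decodeₚ d₁ P₁ e _ (fresh-∉ (fnP P₁ ++ fnP P₂) ∘ ∈-++⁺ˡ) (Inj-⊆ ∈-++⁺ˡ i) h₁)
       | x' , C , hx' , t' , z∉C , hn ←
           dec-input out (decodeₚ d₂ P₂ e _ (fresh-∉ (fnP P₁ ++ fnP P₂) ∘ ∈-++⁺ʳ (fnP P₁))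
             (Inj-⊆ (∈-++⁺ʳ (fnP P₁)) i) h₂)
    with refl ← i (∈-++⁺ˡ (act-fn t (here refl))) (∈-++⁺ʳ (fnP P₁) (act-fn t' (here refl)))
           (≈trans (≈sym hx) hx') =
      decode-close z∉B z∉C hm hn ea eq (inj₁ (t , t'))
  decode₁ (der c-close₂ u (ep ∷ ea ∷ eq ∷ []) (X , d₁ , d₂)) P e i h with enc-par P (≈trans h ep)
  ... | P₁ , P₂ , refl , h₁ , h₂
    with x , B , hx , t , z∉B , hm ←
           dec-input out (decodeₚ d₁ P₁ e _ (fresh-∉ (fnP P₁ ++ fnP P₂) ∘ ∈-++⁺ˡ) (Inj-⊆ ∈-++⁺ˡ i) h₁)
       | x' , C , hx' , t' , z∉C , hn ←
           dec-input inn (decodeₚ d₂ P₂ e _ (fresh-∉ (fnP P₁ ++ fnP P₂) ∘ ∈-++⁺ʳ (fnP P₁))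
             (Inj-⊆ (∈-++⁺ʳ (fnP P₁)) i) h₂)
    with refl ← i (∈-++⁺ˡ (act-fn t (here refl))) (∈-++⁺ʳ (fnP P₁) (act-fn t' (here refl)))
           (≈trans (≈sym hx) hx') =
      decode-close z∉B z∉C hm hn ea eq (inj₂ (t , t'))
  decode₁ (der c-com₁ u (ep ∷ ea ∷ eq ∷ []) (X , d₁ , d₂)) P e i h with enc-par P (≈trans h ep)
  ... | P₁ , P₂ , refl , h₁ , h₂
    with x , B , hx , t , z∉B , hm ←
           dec-input inn (decodeₚ d₁ P₁ e _ (fresh-∉ (fnP P₁)) (Inj-⊆ ∈-++⁺ˡ i) h₁)
       | x' , y , P' , hx' , hy , t' , hq ← dec-output (decode₁ d₂ P₂ e (Inj-⊆ (∈-++⁺ʳ (fnP P₁)) i) h₂)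
    with refl ← i (∈-++⁺ˡ (act-fn t (here refl))) (∈-++⁺ʳ (fnP P₁) (act-fn t' (here refl)))
           (≈trans (≈sym hx) hx') =
      dec₁ τA (openP B y ∣ P') ea
        (subst (λ R → (P₁ ∣ P₂) —[ τA ]→ (R ∣ P')) (subst-open B z∉B) (comR t t'))
        (≈trans eq (≈app (≈app ≈refl (≈trans (≈app hm hy) (abs-β B y))) hq))
  decode₁ (der c-com₂ u (ep ∷ ea ∷ eq ∷ []) (X , d₁ , d₂)) P e i h with enc-par P (≈trans h ep)
  ... | P₁ , P₂ , refl , h₁ , h₂
    with x' , y , P' , hx' , hy , t' , hq ← dec-output (decode₁ d₁ P₁ e (Inj-⊆ ∈-++⁺ˡ i) h₁)
       | x , B , hx , t , z∉B , hm ←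
           dec-input inn (decodeₚ d₂ P₂ e _ (fresh-∉ (fnP P₂)) (Inj-⊆ (∈-++⁺ʳ (fnP P₁)) i) h₂)
    with refl ← i (∈-++⁺ˡ (act-fn t' (here refl))) (∈-++⁺ʳ (fnP P₁) (act-fn t (here refl)))
           (≈trans (≈sym hx') hx) =
      dec₁ τA (P' ∣ openP B y) ea
        (subst (λ R → (P₁ ∣ P₂) —[ τA ]→ (P' ∣ R)) (subst-open B z∉B) (comL t' t))
        (≈trans eq (≈app (≈app ≈refl hq) (≈trans (≈app hm hy) (abs-β B y))))

  decodeₚ : ∀ {G σ p a m} → Derₚ G σ p a m → ∀ P (e : ℕ → Tm (σ ++ G) nT) z → z ∉ fnP P → Inj e (fnP P) →
            ⟦ P ⟧ e ≈ p → Decₚ P z e a m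
  decodeₚ (der c-in u (ep ∷ ea ∷ em ∷ []) _) P e z z∉ i h with enc-in P (≈trans h ep)
  ... | fr x , B , refl , hx , h₁ = decₚ inn x B (≈trans ea (≈app ≈refl (≈sym hx)))
    (inT (z∉ ∘ there)) (z∉ ∘ there) (≈trans em (≈sym h₁))
  decodeₚ (der c-matchp u (ep ∷ ea ∷ em ∷ []) d) P e z z∉ i h with enc-match P (≈trans h ep)
  ... | fr x , fr y , P₁ , refl , hx , hy , h₁
    with refl ← i (here refl) (there (here refl)) (≈trans hx (≈sym hy))
    with decₚ d x B rep tr new res ← decodeₚ d P₁ e z (λ p → z∉ (there (there p))) (Inj-⊆ (λ p → there (there p)) i) h₁ =
      decₚ d x B (≈trans ea rep) (matchT tr) new (≈trans em res)
  decodeₚ (der c-sumLp u (ep ∷ ea ∷ em ∷ []) d) P e z z∉ i h with enc-sum P (≈trans h ep)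
  ... | P₁ , P₂ , refl , h₁ , h₂
    with decₚ d x B rep tr new res ← decodeₚ d P₁ e z (z∉ ∘ ∈-++⁺ˡ) (Inj-⊆ ∈-++⁺ˡ i) h₁ =
      decₚ d x B (≈trans ea rep) (sumL tr) new (≈trans em res)
  decodeₚ (der c-sumRp u (ep ∷ ea ∷ em ∷ []) d) P e z z∉ i h with enc-sum P (≈trans h ep)
  ... | P₁ , P₂ , refl , h₁ , h₂
    with decₚ d x B rep tr new res ← decodeₚ d P₂ e z (z∉ ∘ ∈-++⁺ʳ (fnP P₁)) (Inj-⊆ (∈-++⁺ʳ (fnP P₁)) i) h₂ =
      decₚ d x B (≈trans ea rep) (sumR tr) new (≈trans em res)
  decodeₚ (der c-parLp u (ep ∷ ea ∷ em ∷ []) d) P e z z∉ i h with enc-par P (≈trans h ep)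
  ... | P₁ , P₂ , refl , h₁ , h₂
    with decₚ d x B rep tr new res ← decodeₚ d P₁ e z (z∉ ∘ ∈-++⁺ˡ) (Inj-⊆ ∈-++⁺ˡ i) h₁ =
      decₚ d x (B ∣ mapP shiftNm P₂) (≈trans ea rep)
        (subst (λ R → (P₁ ∣ P₂) —[ polA d x z ]→ (openP B z ∣ R)) (sym (open-shift P₂))
          (parL tr (λ p q → z∉ (∈-++⁺ʳ (fnP P₁) (subst (_∈ fnP P₂) (pol-bn d p) q)))))
        (∉-++ (fnP B) new (z∉ ∘ ∈-++⁺ʳ (fnP P₁) ∘ fn-shift P₂))
        (≈trans em (≈lam (≈app (≈app ≈refl (abs-wk-β B res)) (≈trans (ren-≈ (≈sym h₂)) (≈sym (abs-shift P₂))))))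
  decodeₚ (der c-parRp u (ep ∷ ea ∷ em ∷ []) d) P e z z∉ i h with enc-par P (≈trans h ep)
  ... | P₁ , P₂ , refl , h₁ , h₂
    with decₚ d x B rep tr new res ← decodeₚ d P₂ e z (z∉ ∘ ∈-++⁺ʳ (fnP P₁)) (Inj-⊆ (∈-++⁺ʳ (fnP P₁)) i) h₂ =
      decₚ d x (mapP shiftNm P₁ ∣ B) (≈trans ea rep)
        (subst (λ R → (P₁ ∣ P₂) —[ polA d x z ]→ (R ∣ openP B z)) (sym (open-shift P₁))
          (parR tr (λ p q → z∉ (∈-++⁺ˡ (subst (_∈ fnP P₁) (pol-bn d p) q)))))
        (∉-++ (fnP (mapP shiftNm P₁)) (z∉ ∘ ∈-++⁺ˡ ∘ fn-shift P₁) new)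
        (≈trans em (≈lam (≈app (≈app ≈refl (≈trans (ren-≈ (≈sym h₁)) (≈sym (abs-shift P₁)))) (abs-wk-β B res))))
  decodeₚ (der c-nup u (ep ∷ ea ∷ em ∷ []) d) P e z z∉ i h with enc-res P (≈trans h ep)
  -- The name for the ν-variable must also differ from z, the bound name of the action; otherwise
  -- closing would capture it.
  ... | B , refl , h₁ = decₚ-≈ ea em (decode-nup B e (fresh-∉ (z ∷ fnP B) ∘ there) (λ p → fresh-∉ (z ∷ fnP B) (here p))
      (decodeₚ d (openP B (fresh (z ∷ fnP B))) _ z
        (λ p → Sum.[ z∉ , (λ q → fresh-∉ (z ∷ fnP B) (here (sym q))) ] (fn-open B p)) (Inj-bind _ B i)
        (≈trans (enc-open B (fresh-∉ (z ∷ fnP B) ∘ there)) (lam-inj h₁))))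
  decodeₚ (der c-open u (ep ∷ ea ∷ em ∷ []) d) P e z z∉ i h with enc-res P (≈trans h ep)
  ... | B , refl , h₁ = decₚ-≈ ea em (decode-open B e (fresh-∉ (fnP B)) z∉
      (decode₁ d (openP B (fresh (fnP B))) _ (Inj-bind _ B i)
        (≈trans (enc-open B (fresh-∉ (fnP B))) (lam-inj h₁))))

-- Quantifier prefixes as configurations

-- The head variable of a term tells which name it stands for; this is why distinct names have
-- distinct terms. The decoding need only be a function on variables, so a name bound twice in a
-- prefix does no harm.
HeadNamed : ∀ {Γ τ} → (∀ {σ} → Γ ∋ σ → ℕ) → Tm Γ τ → ℕ → Set
HeadNamed d (var v)   x = d v ≡ x
HeadNamed d (app t _) x = HeadNamed d t x
HeadNamed d _         x = ⊥

named-neutral : ∀ {Γ τ} {d : ∀ {σ} → Γ ∋ σ → ℕ} (t : Tm Γ τ) {x} → HeadNamed d t x → Neutral t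
named-neutral (var v)   h = tt
named-neutral (app t _) h = named-neutral t h

headName : ∀ {Γ} → (∀ {σ} → Γ ∋ σ → ℕ) → Head Γ → ℕ
headName d (hvar v) = d v
-- A term with `HeadNamed` is headed by a variable, so this default is never reached.
headName d (hcon c) = 0

headName-named : ∀ {Γ τ} {d : ∀ {σ} → Γ ∋ σ → ℕ} (t : Tm Γ τ) {x} (h : HeadNamed d t x) →
                 headName d (head t (named-neutral t h)) ≡ x
headName-named (var v)   h = h
headName-named (app t _) h = headName-named t h

named-≈ : ∀ {Γ τ} → Base τ → (d : ∀ {σ} → Γ ∋ σ → ℕ) (t u : Tm Γ τ) {x y : ℕ} →
          HeadNamed d t x → HeadNamed d u y → t ≈ u → x ≡ y
named-≈ b d t u h k e = trans (sym (headName-named t h))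
  (trans (cong (headName d) (head-≈ b (named-neutral t h) (named-neutral u k) e)) (headName-named u k))

named-ren : ∀ {Γ Δ τ} {d : ∀ {σ} → Γ ∋ σ → ℕ} {d' : ∀ {σ} → Δ ∋ σ → ℕ} {r : Ren Γ Δ} →
            (∀ {σ} (v : Γ ∋ σ) → d' (r v) ≡ d v) → (t : Tm Γ τ) {x : ℕ} → HeadNamed d t x → HeadNamed d' (ren r t) x
named-ren e (var v)   h = trans (e v) h
named-ren {d' = d'} e (app t _) h = named-ren {d' = d'} e t h

named-spine : ∀ σ {Γ τ} {d : ∀ {σ} → Γ ∋ σ → ℕ} {r : ∀ {s} → σ ∋ s → Γ ∋ s} (t : Tm Γ (raiseTy σ τ)) {x} →
              HeadNamed d t x → HeadNamed d (spine σ r t) x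
named-spine []      t h = h
named-spine (s ∷ σ) t h = named-spine σ (app t _) h

-- A quantifier prefix, innermost quantifier first, with its local signature as index.
-- The base case provides a dummy global name, the value of every name not bound.
data Cfg : Ctx → Set where
  base : Cfg []
  allC : ∀ {σ} → ℕ → Cfg σ → Cfg σ
  nabC : ∀ {σ} → ℕ → Cfg σ → Cfg (nT ∷ σ)

glob : ∀ {σ} → Cfg σ → Ctx
glob base           = nT ∷ []
glob {σ} (allC x π) = raiseTy σ nT ∷ glob π
glob (nabC y π)     = glob π

names : ∀ {σ} → Cfg σ → List ℕ
names base       = []
names (allC x π) = x ∷ names π
names (nabC y π) = y ∷ names π

raised : ∀ σ {Γ} → Tm (σ ++ raiseTy σ nT ∷ Γ) nT
raised σ = spine σ (injL σ) (var (injR σ here))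

nameTm : ∀ {σ} (π : Cfg σ) → ℕ → Tm (σ ++ glob π) nT
nameTm base           x = var here
nameTm {σ} (allC y π) x = if x ≡ᵇ y then raised σ else ren (liftRN σ there) (nameTm π x)
nameTm (nabC y π)     x = bind y (nameTm π) x

nameTm-all-≢ : ∀ {σ} (π : Cfg σ) {x y} → x ≢ y → nameTm (allC y π) x ≡ ren (liftRN σ there) (nameTm π x)
nameTm-all-≢ π n rewrite ≡ᵇ-≢ n = refl

decode-++ : ∀ σ {Γ} → (∀ {τ} → σ ∋ τ → ℕ) → (∀ {τ} → Γ ∋ τ → ℕ) → ∀ {τ} → (σ ++ Γ) ∋ τ → ℕ
decode-++ []      f g v         = g v
decode-++ (s ∷ σ) f g here      = f here
decode-++ (s ∷ σ) f g (there v) = decode-++ σ (λ w → f (there w)) g v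

decode-++-injR : ∀ σ {Γ} (f : ∀ {τ} → σ ∋ τ → ℕ) (g : ∀ {τ} → Γ ∋ τ → ℕ) {τ} (v : Γ ∋ τ) →
                 decode-++ σ f g (injR σ v) ≡ g v
decode-++-injR []      f g v = refl
decode-++-injR (s ∷ σ) f g v = decode-++-injR σ _ g v

decode-++-liftRN : ∀ σ {Γ Δ} (f : ∀ {τ} → σ ∋ τ → ℕ) (g : ∀ {τ} → Δ ∋ τ → ℕ) (r : Ren Γ Δ) {τ} (v : (σ ++ Γ) ∋ τ) →
                   decode-++ σ f g (liftRN σ r v) ≡ decode-++ σ f (λ w → g (r w)) v
decode-++-liftRN []      f g r v         = refl
decode-++-liftRN (s ∷ σ) f g r here      = refl
decode-++-liftRN (s ∷ σ) f g r (there v) = decode-++-liftRN σ _ g r v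

locName : ∀ {σ} → Cfg σ → ∀ {τ} → σ ∋ τ → ℕ
locName (allC x π) v         = locName π v
locName (nabC y π) here      = y
locName (nabC y π) (there v) = locName π v

globName : ∀ {σ} (π : Cfg σ) → ∀ {τ} → glob π ∋ τ → ℕ
globName base       v         = 0
globName (allC x π) here      = x
globName (allC x π) (there v) = globName π v
globName (nabC y π) v         = globName π v

decodeVar : ∀ {σ} (π : Cfg σ) → ∀ {τ} → (σ ++ glob π) ∋ τ → ℕ
decodeVar {σ} π = decode-++ σ (locName π) (globName π)

nameTm-named : ∀ {σ} (π : Cfg σ) {x} → x ∈ names π → HeadNamed (decodeVar π) (nameTm π x) x
nameTm-named {σ} (allC y π) {x} p with x ≟ y
... | yes refl rewrite ≡ᵇ-refl x =
  named-spine σ (var (injR σ here)) (decode-++-injR σ (locName π) (globName (allC x π)) here)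
... | no n rewrite ≡ᵇ-≢ n with p
...   | here e  = ⊥-elim (n e)
...   | there q = named-ren {d' = decodeVar (allC y π)}
  (decode-++-liftRN σ (locName π) (globName (allC y π)) there) (nameTm π x) (nameTm-named π q)
nameTm-named (nabC y π) {x} p with x ≟ y
... | yes refl rewrite ≡ᵇ-refl x = refl
... | no n rewrite ≡ᵇ-≢ n with p
...   | here e  = ⊥-elim (n e)
...   | there q = named-ren {d' = decodeVar (nabC y π)} (λ _ → refl) (nameTm π x) (nameTm-named π q)

nameTm-inj : ∀ {σ} (π : Cfg σ) → Inj (nameTm π) (names π)
nameTm-inj π p q = named-≈ nB (decodeVar π) _ _ (nameTm-named π p) (nameTm-named π q)

Irrefl : Dist → Set
Irrefl D = ∀ {x} → (x , x) ∉ D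

Covers : ∀ {σ} → Cfg σ → Dist → Set
Covers π D = ∀ {x y} → (x , y) ∈ D → x ∈ names π × y ∈ names π

-- Names outside R occur nowhere any more, so D need not separate a ∇-name from them.
Good : ∀ {σ} → List ℕ → Dist → Cfg σ → Set
Good R D base       = ⊤
Good R D (allC x π) = Good R D π
Good R D (nabC y π) = (y ∈ R → ∀ {x} → x ∈ names π → x ∈ R → (x , y) ∈ D) × Good R D π

Good-mono : ∀ {σ R R' D D'} (π : Cfg σ) → (∀ {x} → x ∈ names π → x ∈ R' → x ∈ R) →
            (∀ {p} → p ∈ D → p ∈ D') → Good R D π → Good R' D' π
Good-mono base       h k g       = tt
Good-mono (allC x π) h k g       = Good-mono π (h ∘ there) k g
Good-mono (nabC y π) h k (a , g) =
  (λ y∈ x∈ x∈R → k (a (h (here refl) y∈) x∈ (h (there x∈) x∈R))) , Good-mono π (h ∘ there) k g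

-- The inequations hold at the generic instance because D is irreflexive and `nameTm` is injective
-- on the names of the prefix.
worldOf : ∀ {σ} (π : Cfg σ) D → Irrefl D → Covers π D → World
worldOf {σ} π D irr cov = record
  { G = glob π ; loc = σ ; nm = nameTm π ; D = D ; consistent = cons }
  where
  cons : ∀ {x y} → (x , y) ∈ D → ¬ (sub (liftSN σ var) (nameTm π x) ≈ sub (liftSN σ var) (nameTm π y))
  cons {x} {y} p h with nameTm-inj π (proj₁ (cov p)) (proj₂ (cov p))
    (≈trans (≡⇒≈ (sym (sub-id (liftSN-var σ) (nameTm π x)))) (≈trans h (≡⇒≈ (sub-id (liftSN-var σ) (nameTm π y)))))
  ... | refl = irr p

-- `comm` is demanded only on `R`: a forgotten name may lose its meaning in the new prefix.
record Lift {σ} (π : Cfg σ) (θ : ℕ → ℕ) (R : List ℕ) (D' : Dist) (R' : List ℕ) : Set where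
  field
    π'   : Cfg σ
    κ    : Sub (glob π) (glob π')
    comm : ∀ {x} → x ∈ names π → x ∈ R → sub (liftSN σ κ) (nameTm π x) ≈ nameTm π' (θ x)
    fwd  : ∀ {x} → x ∈ names π → θ x ∈ names π'
    good : Good R' D' π'

-- Induction from the outermost quantifier inwards. A ∇-name keeps its variable, so θ must not send
-- it onto an earlier relevant name. The second component traces each new name back to an old one,
-- which is needed to carry `Good` over to the new prefix.
lift-cfg : ∀ {σ} (π : Cfg σ) θ {R D D' R'} →
           (∀ {x y} → (x , y) ∈ D → θ x ≢ θ y) →
           (∀ {x y} → x ∈ R → y ∉ R → θ x ≢ θ y) →
           (∀ {x y} → (x , y) ∈ D → (θ x , θ y) ∈ D') →
           (∀ {x} → θ x ∈ R' → x ∈ R) →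
           Good R D π →
           Σ[ L ∈ Lift π θ R D' R' ] (∀ {w} → w ∈ names (Lift.π' L) → Σ[ x ∈ ℕ ] (x ∈ names π × w ≡ θ x))
lift-cfg base θ resp sep img rel g = record
  { π' = base ; κ = var ; comm = λ () ; fwd = λ () ; good = tt } , λ ()
lift-cfg {σ} (allC y π) θ {R} {D} {D'} {R'} resp sep img rel g
  with lift-cfg π θ {R} {D} {D'} {R'} resp sep img rel g
... | L , back with θ y ∈? names (Lift.π' L)
-- The image of the ∀-name is a name already placed to its left: the eigenvariable is instantiated
-- by the term of that name, abstracted over σ.
...   | yes y∈ = record
  { π' = Lift.π' L ; κ = κ'
  ; comm = comm'
  ; fwd = λ { (here refl) → y∈ ; (there p) → Lift.fwd L p }
  ; good = Lift.good L } , λ p → proj₁ (back p) , there (proj₁ (proj₂ (back p))) , proj₂ (proj₂ (back p))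
  where
  π' = Lift.π' L
  κ' : Sub (raiseTy σ nT ∷ glob π) (glob π')
  κ' = ext (Lift.κ L) (lams σ (nameTm π' (θ y)))
  comm' : ∀ {x} → x ∈ names (allC y π) → x ∈ R → sub (liftSN σ κ') (nameTm (allC y π) x) ≈ nameTm π' (θ x)
  comm' {x} p x∈R with x ≟ y
  ... | yes refl rewrite ≡ᵇ-refl x = sub-raised σ κ' here (nameTm π' (θ y)) refl
  ... | no n rewrite ≡ᵇ-≢ n with p
  ...   | here e  = ⊥-elim (n e)
  ...   | there q = ≈trans (≡⇒≈ (trans (sub-ren (nameTm π x)) (sub-cong (liftSN-ren σ κ' there) (nameTm π x))))
                      (Lift.comm L q x∈R)
-- The image is new, so it becomes a ∀-name itself, and `lams σ (raised σ)` is the η-expansion of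
-- its eigenvariable.
...   | no y∉ = record
  { π' = allC (θ y) π' ; κ = κ'
  ; comm = comm'
  ; fwd = λ { (here refl) → here refl ; (there p) → there (Lift.fwd L p) }
  ; good = Lift.good L } ,
  λ { (here refl) → y , here refl , refl
    ; (there p) → proj₁ (back p) , there (proj₁ (proj₂ (back p))) , proj₂ (proj₂ (back p)) }
  where
  π' = Lift.π' L
  κ' : Sub (raiseTy σ nT ∷ glob π) (raiseTy σ nT ∷ glob π')
  κ' = ext (λ v → ren there (Lift.κ L v)) (lams σ (raised σ))
  comm' : ∀ {x} → x ∈ names (allC y π) → x ∈ R → sub (liftSN σ κ') (nameTm (allC y π) x) ≈ nameTm (allC (θ y) π') (θ x)
  comm' {x} p x∈R with x ≟ y
  ... | yes refl rewrite ≡ᵇ-refl x | ≡ᵇ-refl (θ x) = sub-raised σ κ' here (raised σ) refl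
  ... | no n rewrite ≡ᵇ-≢ n with p
  ...   | here e  = ⊥-elim (n e)
  ...   | there q = ≈trans (≡⇒≈ eq) (≈trans (ren-≈ (Lift.comm L q x∈R))
                      (≡⇒≈ (sym (nameTm-all-≢ π' (λ e → y∉ (subst (_∈ names π') e (Lift.fwd L q)))))))
    where
    eq : sub (liftSN σ κ') (ren (liftRN σ there) (nameTm π x)) ≡
         ren (liftRN σ there) (sub (liftSN σ (Lift.κ L)) (nameTm π x))
    eq = trans (sub-ren (nameTm π x)) (trans (sub-cong pt (nameTm π x)) (sym (ren-sub (nameTm π x))))
      where
      pt : ∀ {τ} (v : (σ ++ glob π) ∋ τ) → liftSN σ κ' (liftRN σ there v) ≡ ren (liftRN σ there) (liftSN σ (Lift.κ L) v)
      pt v = trans (liftSN-ren σ κ' there v) (sym (ren-liftSN σ there (Lift.κ L) v))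
lift-cfg {nT ∷ σ} (nabC y π) θ {R} {D} {D'} {R'} resp sep img rel (a , g)
  with lift-cfg π θ {R} {D} {D'} {R'} resp sep img rel g
... | L , back = record
  { π' = nabC (θ y) π' ; κ = Lift.κ L
  ; comm = comm'
  ; fwd = λ { (here refl) → here refl ; (there p) → there (Lift.fwd L p) }
  ; good = good' , Lift.good L } ,
  λ { (here refl) → y , here refl , refl
    ; (there p) → proj₁ (back p) , there (proj₁ (proj₂ (back p))) , proj₂ (proj₂ (back p)) }
  where
  π' = Lift.π' L
  good' : θ y ∈ R' → ∀ {w} → w ∈ names π' → w ∈ R' → (w , θ y) ∈ D'
  good' y∈ w∈ w∈R' with back w∈
  ... | x , x∈ , refl = img (a (rel y∈) x∈ (rel w∈R'))
  -- If y is relevant, `Good` puts the pair into D and θ respects it; if not, θ keeps relevant and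
  -- irrelevant names apart.
  apart : ∀ {x} → x ∈ names π → x ∈ R → θ x ≢ θ y
  apart x∈ x∈R with y ∈? R
  ... | yes y∈R = resp (a y∈R x∈ x∈R)
  ... | no y∉R  = sep x∈R y∉R
  comm' : ∀ {x} → x ∈ names (nabC y π) → x ∈ R →
          sub (liftSN (nT ∷ σ) (Lift.κ L)) (bind y (nameTm π) x) ≈ bind (θ y) (nameTm π') (θ x)
  comm' {x} p x∈R with x ≟ y
  ... | yes refl rewrite ≡ᵇ-refl x | ≡ᵇ-refl (θ x) = ≈refl
  ... | no n rewrite ≡ᵇ-≢ n with p
  ...   | here e  = ⊥-elim (n e)
  ...   | there q rewrite ≡ᵇ-≢ (apart q x∈R) = ≈trans
    (≡⇒≈ (trans (sub-ren (nameTm π x)) (sym (ren-sub (nameTm π x))))) (ren-≈ (Lift.comm L q x∈R))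

-- Unfolding the clause of `lbisim`

LB₂ : ∀ W σ (p q : Tm (σ ++ World.G W) pT) → Set
LB₂ W σ p q = LB W σ (p ∷ q ∷ [])

-- The three conjuncts of lbisim P Q in which P moves first; the other three are Half for Q and P.
record Half W σ (P Q : Tm (σ ++ World.G W) pT) : Set where
  field
    free : ∀ {W'} (m : Mor W W') {p q} → p ≈ sub (liftSN σ (η m)) P → q ≈ sub (liftSN σ (η m)) Q →
           ∀ {a p'} → Der₁ (World.G W') σ p a p' →
           Σ[ q' ∈ _ ] (Der₁ (World.G W') σ q a q' × LB₂ W' σ p' q')
    inp  : ∀ {W'} (m : Mor W W') {p q} → p ≈ sub (liftSN σ (η m)) P → q ≈ sub (liftSN σ (η m)) Q →
           ∀ {X p'} → Derₚ (World.G W') σ p (app (con aDn) X) p' →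
           Σ[ q' ∈ _ ] (Derₚ (World.G W') σ q (app (con aDn) X) q' × (∀ t → LB₂ W' σ (app p' t) (app q' t)))
    outp : ∀ {W'} (m : Mor W W') {p q} → p ≈ sub (liftSN σ (η m)) P → q ≈ sub (liftSN σ (η m)) Q →
           ∀ {X p'} → Derₚ (World.G W') σ p (app (con aUp) X) p' →
           Σ[ q' ∈ _ ] (Derₚ (World.G W') σ q (app (con aUp) X) q' ×
             LB₂ W' (nT ∷ σ) (app (ren there p') (var here)) (app (ren there q') (var here)))

-- Each ∀ and each ⊃ of the clause substitutes along its own morphism, so passing several of them at
-- one world leaves identity substitutions to be cleared.
module _ {W W' : World} {σ : Ctx} (m : Mor W W') where

  id¹ : ∀ {τ} (t : Tm (σ ++ World.G W') τ) → sub (liftSN σ var) t ≈ t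
  id¹ t = ≡⇒≈ (sub-id (liftSN-var σ) t)

  id² : ∀ {τ} (t : Tm (σ ++ World.G W') τ) → sub (liftSN σ var) (sub (liftSN σ var) t) ≈ t
  id² t = ≈trans (id¹ _) (id¹ t)

  moved : ∀ {τ p} {P U : Tm (σ ++ World.G W) τ} → P ≈ U → p ≈ sub (liftSN σ (η m)) P →
          sub (liftSN σ var) (sub (liftSN σ var) (sub (liftSN σ (η m)) U)) ≈ p
  moved h e = ≈trans (id² _) (≈trans (sub-≈ (≈sym h)) (≈sym e))

view : ∀ {W σ P Q} → LB₂ W σ P Q → Half W σ P Q × Half W σ Q P
view {W} {σ} {P} {Q} (lb u (hP ∷ hQ ∷ []) (f₁ , f₂ , f₃ , f₄ , f₅ , f₆)) = record
  { free = λ {W'} m ep eq {a} {p'} d →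
      -- Only the first quantifier moves along `m`; the second one and the implication are taken at
      -- `idM`.
      let q' , d' , l = f₁ W' m a W' idM p' W' idM (Der₁-≈ (moved m hP ep) (id² m a) (id¹ m p') d)
      in q' , Der₁-≈ (≈sym (moved m hQ eq)) (≈sym (id² m a)) ≈refl d' , LB-≈ (≈sym (id¹ m p') ∷ ≈refl ∷ []) l
  ; inp = λ {W'} m ep eq {a} {p'} d →
      let q' , d' , l = f₃ W' m a W' idM p' W' idM (Derₚ-≈ (moved m hP ep) (≈app ≈refl (id² m a)) (id¹ m p') d)
      in q' , Derₚ-≈ (≈sym (moved m hQ eq)) (≈app ≈refl (≈sym (id² m a))) ≈refl d' ,
         λ t → LB-≈ (≈app (≈sym (id² m p')) ≈refl ∷ ≈app (≈sym (id¹ m q')) ≈refl ∷ []) (l W' idM t)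
  ; outp = λ {W'} m ep eq {a} {p'} d →
      let q' , d' , l = f₅ W' m a W' idM p' W' idM (Derₚ-≈ (moved m hP ep) (≈app ≈refl (id² m a)) (id¹ m p') d)
      in q' , Derₚ-≈ (≈sym (moved m hQ eq)) (≈app ≈refl (≈sym (id² m a))) ≈refl d' ,
         LB-≈ (≈app (ren-≈ (≈sym (id¹ m p'))) ≈refl ∷ ≈refl ∷ []) l
  } , record
  { free = λ {W'} m ep eq {a} {p'} d →
      let q' , d' , l = f₂ W' m a W' idM p' W' idM (Der₁-≈ (moved m hQ ep) (id² m a) (id¹ m p') d)
      in q' , Der₁-≈ (≈sym (moved m hP eq)) (≈sym (id² m a)) ≈refl d' , LB-≈ (≈sym (id¹ m p') ∷ ≈refl ∷ []) l
  ; inp = λ {W'} m ep eq {a} {p'} d →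
      let q' , d' , l = f₄ W' m a W' idM p' W' idM (Derₚ-≈ (moved m hQ ep) (≈app ≈refl (id² m a)) (id¹ m p') d)
      in q' , Derₚ-≈ (≈sym (moved m hP eq)) (≈app ≈refl (≈sym (id² m a))) ≈refl d' ,
         λ t → LB-≈ (≈app (≈sym (id² m p')) ≈refl ∷ ≈app (≈sym (id¹ m q')) ≈refl ∷ []) (l W' idM t)
  ; outp = λ {W'} m ep eq {a} {p'} d →
      let q' , d' , l = f₆ W' m a W' idM p' W' idM (Derₚ-≈ (moved m hQ ep) (≈app ≈refl (id² m a)) (id¹ m p') d)
      in q' , Derₚ-≈ (≈sym (moved m hP eq)) (≈app ≈refl (≈sym (id² m a))) ≈refl d' ,
         LB-≈ (≈app (ren-≈ (≈sym (id¹ m p'))) ≈refl ∷ ≈refl ∷ []) l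
  }

-- The bisimulation

Rel : Dist → Proc 0 → Proc 0 → List ℕ
Rel D P Q = fnP P ++ fnP Q ++ fnD D

-- The two halves are stored instead of `LB` itself: in each of them the moving process comes first,
-- so symmetry is an exchange of fields.
record Conf (D : Dist) (P Q : Proc 0) : Set where
  field
    {σ}   : Ctx
    π     : Cfg σ
    irr   : Irrefl D
    sees  : ∀ {x} → x ∈ Rel D P Q → x ∈ names π
    cov   : Covers π D
    good  : Good (Rel D P Q) D π
    halfˡ : Half (worldOf π D irr cov) σ (⟦ P ⟧ (nameTm π)) (⟦ Q ⟧ (nameTm π))
    halfʳ : Half (worldOf π D irr cov) σ (⟦ Q ⟧ (nameTm π)) (⟦ P ⟧ (nameTm π))

Rel-swap : ∀ D P Q {x} → x ∈ Rel D P Q → x ∈ Rel D Q P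
Rel-swap D P Q p with ∈-++⁻ (fnP P) p
... | inj₁ q = ∈-++⁺ʳ (fnP Q) (∈-++⁺ˡ q)
... | inj₂ q with ∈-++⁻ (fnP Q) q
...   | inj₁ r = ∈-++⁺ˡ r
...   | inj₂ r = ∈-++⁺ʳ (fnP Q) (∈-++⁺ʳ (fnP P) r)

Conf-sym : ∀ {D P Q} → Conf D P Q → Conf D Q P
Conf-sym {D} {P} {Q} c = record
  { π = π ; irr = irr ; sees = sees ∘ Rel-swap D Q P ; cov = cov
  ; good = Good-mono π (λ _ → Rel-swap D Q P) (λ p → p) good
  ; halfˡ = halfʳ ; halfʳ = halfˡ }
  where open Conf c

Rel-elim : ∀ D P Q {L : List ℕ} → (∀ {x} → x ∈ fnP P → x ∈ L) → (∀ {x} → x ∈ fnP Q → x ∈ L) →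
           (∀ {x y} → (x , y) ∈ D → x ∈ L × y ∈ L) → ∀ {x} → x ∈ Rel D P Q → x ∈ L
Rel-elim D P Q f g h p with ∈-++⁻ (fnP P) p
... | inj₁ q = f q
... | inj₂ q with ∈-++⁻ (fnP Q) q
...   | inj₁ r = g r
...   | inj₂ r = fnD-⊆ D h r

conf : ∀ {D P Q σ} (π : Cfg σ) (irr : Irrefl D) (cov : Covers π D) →
       (∀ {x} → x ∈ Rel D P Q → x ∈ names π) → Good (Rel D P Q) D π →
       LB₂ (worldOf π D irr cov) σ (⟦ P ⟧ (nameTm π)) (⟦ Q ⟧ (nameTm π)) → Conf D P Q
conf π irr cov sees good l = record
  { π = π ; irr = irr ; sees = sees ; cov = cov ; good = good
  ; halfˡ = proj₁ (view l) ; halfʳ = proj₂ (view l) }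

-- The world reached from a configuration by a respectful θ.  Names that no longer matter are
-- sent to one junk name, so that z can clash with a relevant name only.
module Moved {D : Dist} {P Q : Proc 0} (c : Conf D P Q) (θ : ℕ → ℕ) (resp : Respects θ D) (z : ℕ) where
  open Conf c

  M N : List ℕ
  M  = Rel D P Q
  N = map θ M

  junk : ℕ
  junk = fresh (z ∷ N)

  junk∉ : junk ∉ N
  junk∉ p = fresh-∉ (z ∷ N) (there p)

  θ₁ : ℕ → ℕ
  θ₁ x with x ∈? M
  ... | yes _ = θ x
  ... | no _  = junk

  θ₁-∈ : ∀ {x} → x ∈ M → θ₁ x ≡ θ x
  θ₁-∈ {x} p with x ∈? M
  ... | yes _ = refl
  ... | no n  = ⊥-elim (n p)

  θ₁-∉ : ∀ {x} → x ∉ M → θ₁ x ≡ junk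
  θ₁-∉ {x} n with x ∈? M
  ... | yes p = ⊥-elim (n p)
  ... | no _  = refl

  D-∈M : ∀ {x y} → (x , y) ∈ D → x ∈ M × y ∈ M
  D-∈M p = ∈-++⁺ʳ (fnP P) (∈-++⁺ʳ (fnP Q) (proj₁ (fnD-∈ p))) ,
           ∈-++⁺ʳ (fnP P) (∈-++⁺ʳ (fnP Q) (proj₂ (fnD-∈ p)))

  Dθ : Dist
  Dθ = substD θ D

  abstract
    lifted : Σ[ L ∈ Lift π θ₁ M Dθ N ] (∀ {w} → w ∈ names (Lift.π' L) → Σ[ x ∈ ℕ ] (x ∈ names π × w ≡ θ₁ x))
    lifted = lift-cfg π θ₁
      (λ p e → resp p (trans (sym (θ₁-∈ (proj₁ (D-∈M p)))) (trans e (θ₁-∈ (proj₂ (D-∈M p))))))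
      (λ p n e → junk∉ (subst (_∈ N) (trans (sym (θ₁-∈ p)) (trans e (θ₁-∉ n))) (∈-map⁺ θ p)))
      (λ p → subst (_∈ Dθ) (cong₂ _,_ (sym (θ₁-∈ (proj₁ (D-∈M p)))) (sym (θ₁-∈ (proj₂ (D-∈M p))))) (substD-⁺ θ p))
      relevant good
      where
      relevant : ∀ {x} → θ₁ x ∈ N → x ∈ M
      relevant {x} p with x ∈? M
      ... | yes q = q
      ... | no n  = ⊥-elim (junk∉ p)

  open Lift (proj₁ lifted) public renaming (good to good')

  N⊆ : ∀ {x} → x ∈ N → x ∈ names π'
  N⊆ p with ∈-map⁻ θ p
  ... | x , q , refl = subst (_∈ names π') (θ₁-∈ q) (fwd (sees q))

  z-relevant : z ∈ names π' → z ∈ N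
  z-relevant p with proj₂ lifted p
  ... | x , q , e with x ∈? M
  ...   | yes r = subst (_∈ N) (sym e) (∈-map⁺ θ r)
  ...   | no n  = ⊥-elim (fresh-∉ (z ∷ N) (here (sym e)))

  Dθ⊆ : ∀ {x y} → (x , y) ∈ Dθ → x ∈ N × y ∈ N
  Dθ⊆ p with substD-⁻ θ D p
  ... | a , b , q , refl , refl = ∈-map⁺ θ (proj₁ (D-∈M q)) , ∈-map⁺ θ (proj₂ (D-∈M q))

  abstract
    irr' : Irrefl Dθ
    irr' p with substD-⁻ θ D p
    ... | a , b , q , e , f = resp q (trans (sym e) f)

    cov' : Covers π' Dθ
    cov' p = N⊆ (proj₁ (Dθ⊆ p)) , N⊆ (proj₂ (Dθ⊆ p))

  W W' : World
  W  = worldOf π D irr cov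
  W' = worldOf π' Dθ irr' cov'

  m : Mor W W'
  m .η = κ
  -- An inequation of D goes to its θ-image in `Dθ`, which `W'` enforces; names of D are relevant,
  -- so `comm` applies to them.
  m .pres κ' sat {x} {y} p h = sat (substD-⁺ θ p) (≈trans (≈sym (along x (D-∈M p .proj₁)))
      (≈trans h (along y (D-∈M p .proj₂))))
    where
    along : ∀ x → x ∈ M → sub (liftSN σ (κ' ⊙ κ)) (nameTm π x) ≈ sub (liftSN σ κ') (nameTm π' (θ x))
    along x q = ≈trans (≡⇒≈ (sym (trans (sub-sub (nameTm π x)) (sub-cong (liftSN-⊙ σ κ' κ) (nameTm π x)))))
      (sub-≈ (≈trans (comm (sees q) q) (≡⇒≈ (cong (nameTm π') (θ₁-∈ q)))))

  enc-moved : ∀ S → (∀ {x} → x ∈ fnP S → x ∈ M) →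
              ⟦ substP θ S ⟧ (nameTm π') ≈ sub (liftSN σ κ) (⟦ S ⟧ (nameTm π))
  enc-moved S h = ≈sym (≈trans (sub-enc S) (≈sym (enc-mapP S (agree≈ (λ ()) λ p →
    ≈sym (≈trans (comm (sees (h p)) (h p)) (≡⇒≈ (cong (nameTm π') (θ₁-∈ (h p)))))))))

  Pθ Qθ : Proc 0
  Pθ = substP θ P
  Qθ = substP θ Q

  P-moved : ⟦ Pθ ⟧ (nameTm π') ≈ sub (liftSN σ κ) (⟦ P ⟧ (nameTm π))
  P-moved = enc-moved P ∈-++⁺ˡ

  Q-moved : ⟦ Qθ ⟧ (nameTm π') ≈ sub (liftSN σ κ) (⟦ Q ⟧ (nameTm π))
  Q-moved = enc-moved Q (∈-++⁺ʳ (fnP P) ∘ ∈-++⁺ˡ)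

  Pθ⊆ : ∀ {x} → x ∈ fnP Pθ → x ∈ N
  Pθ⊆ p with fn-subst P p
  ... | y , q , refl = ∈-map⁺ θ (∈-++⁺ˡ q)

  Qθ⊆ : ∀ {x} → x ∈ fnP Qθ → x ∈ N
  Qθ⊆ p with fn-subst Q p
  ... | y , q , refl = ∈-map⁺ θ (∈-++⁺ʳ (fnP P) (∈-++⁺ˡ q))

  Qθ-inj : Inj (nameTm π') (fnP Qθ)
  Qθ-inj p q = nameTm-inj π' (N⊆ (Qθ⊆ p)) (N⊆ (Qθ⊆ q))

  N-rel : ∀ {x} → x ∈ N → x ∈ fnP Pθ ++ fnP Qθ ++ fnD Dθ
  N-rel p with ∈-map⁻ θ p
  ... | x , q , refl with ∈-++⁻ (fnP P) q
  ...   | inj₁ r = ∈-++⁺ˡ (fn-subst⁺ P r)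
  ...   | inj₂ r with ∈-++⁻ (fnP Q) r
  ...     | inj₁ s = ∈-++⁺ʳ (fnP Pθ) (∈-++⁺ˡ (fn-subst⁺ Q s))
  ...     | inj₂ s = ∈-++⁺ʳ (fnP Pθ) (∈-++⁺ʳ (fnP Qθ) (fnD-subst⁺ θ D s))

-- Decoding yields some action with the same term; injectivity makes it the given one, so the answer
-- carries the label that was asked for.
dec₁-match : ∀ {Γ P e} {a : Tm Γ aT} {q L} α → Represents e α a → (∀ {x} → x ∈ namesA α → x ∈ L) →
             (∀ {x} → x ∈ fnP P → x ∈ L) → Inj e L → Dec₁ P e a q →
             Σ[ P' ∈ Proc 0 ] ((P —[ α ]→ P') × q ≈ ⟦ P' ⟧ e)
dec₁-match τA r h k i (dec₁ τA P' rep tr res) = P' , tr , res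
dec₁-match τA r h k i (dec₁ (outA x y) P' rep tr res) with () ← head-≈ aB tt tt (≈trans (≈sym r) rep)
dec₁-match (outA x y) r h k i (dec₁ τA P' rep tr res) with () ← head-≈ aB tt tt (≈trans (≈sym r) rep)
dec₁-match (outA x y) r h k i (dec₁ (outA x' y') P' rep tr res)
  with hx , hy ← con-inj₂ aB (≈trans (≈sym r) rep)
  with refl ← i (h (here refl)) (k (act-fn tr (here refl))) hx
     | refl ← i (h (there (here refl))) (k (act-fn tr (there (here refl)))) hy = P' , tr , res

module _ {D : Dist} {P Q : Proc 0} (c : Conf D P Q) (θ : ℕ → ℕ) (resp : Respects θ D) where

  answer-free : ∀ {α P'} → IsFree α → substP θ P —[ α ]→ P' →
                ∃[ Q' ] (substP θ Q —[ α ]→ Q' × Conf (substD θ D) P' Q')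
  answer-free {α} {P'} free t = reply refl free (encode-step t {glob π'} {σ} (nameTm π'))
    where
    open Conf c using (σ; halfˡ)
    -- A free action binds no name, so any value serves for z.
    open Moved c θ resp 0
    finish : ∀ {a} → Represents (nameTm π') α a → (∀ {x} → x ∈ namesA α → x ∈ fnP Pθ) → bnA α ≡ [] →
             Der₁ (glob π') σ (⟦ Pθ ⟧ (nameTm π')) a (⟦ P' ⟧ (nameTm π')) →
             ∃[ Q' ] (Qθ —[ α ]→ Q' × Conf Dθ P' Q')
    finish r n nb d
      with q' , d' , l ← Half.free halfˡ m P-moved Q-moved d
      with Q' , t' , res ← dec₁-match α r (N⊆ ∘ Pθ⊆ ∘ n) (N⊆ ∘ Qθ⊆) (nameTm-inj π')
                             (decode₁ d' Qθ (nameTm π') Qθ-inj ≈refl) =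
        Q' , t' , conf π' irr' cov' (N⊆ ∘ rel) (Good-mono π' (λ _ → rel) (λ p → p) good')
          (LB-≈ (≈refl ∷ ≈sym res ∷ []) l)
      where
      old : ∀ {S S' x} → S —[ α ]→ S' → x ∈ fnP S' → x ∈ fnP S
      old u p with res-fn u p
      ... | inj₁ q = q
      ... | inj₂ q with () ← subst (_ ∈_) nb q
      rel : ∀ {x} → x ∈ Rel Dθ P' Q' → x ∈ N
      rel = Rel-elim Dθ P' Q' (Pθ⊆ ∘ old t) (Qθ⊆ ∘ old t') Dθ⊆
    reply : ∀ {α'} → α ≡ α' → IsFree α' → Step {glob π'} {σ} (⟦ Pθ ⟧ (nameTm π')) (nameTm π') α' P' →
            ∃[ Q' ] (Qθ —[ α ]→ Q' × Conf Dθ P' Q')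
    reply refl τ-free d   = finish ≈refl (λ ()) refl d
    reply refl out-free d = finish ≈refl (act-fn t) refl d
    reply refl in-free ()

  -- After an input the distinction does not grow: z may still become any name that `Dθ` allows. The
  -- universally quantified residual is therefore instantiated at the term of z in a prefix that
  -- contains z, either as a name known already or as a new innermost ∀.
  module Bin {x z : ℕ} {P' : Proc 0} (z∉ : z ∉ fnP (substP θ P) ++ fnP (substP θ Q))
    (t : substP θ P —[ binA x z ]→ P') where
    open Conf c using (π; σ; halfˡ)
    open Moved c θ resp z

    -- Making z relevant adds no demand on `π'`: if z is one of its names, it is a relevant one
    -- already.
    good-z : Good (z ∷ N) Dθ π'
    good-z = Good-mono π' (λ { p (here refl) → z-relevant p ; p (there q) → q }) (λ p → p) good'

    reply : (π″ : Cfg σ) (cov″ : Covers π″ Dθ) (m″ : Mor W (worldOf π″ Dθ irr' cov″)) →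
            ⟦ Pθ ⟧ (nameTm π″) ≈ sub (liftSN σ (η m″)) (⟦ P ⟧ (nameTm π)) →
            ⟦ Qθ ⟧ (nameTm π″) ≈ sub (liftSN σ (η m″)) (⟦ Q ⟧ (nameTm π)) →
            (∀ {w} → w ∈ z ∷ N → w ∈ names π″) → Good (z ∷ N) Dθ π″ →
            ∃[ Q' ] (Qθ —[ binA x z ]→ Q' × Conf Dθ P' Q')
    reply π″ cov″ m″ hP hQ seen good″
      with absOf B z∉B refl d ← encode-step t {glob π″} {σ} (nameTm π″)
      with q' , d' , l ← Half.inp halfˡ m″ hP hQ d
      with x' , C , hx , t' , z∉C , hq ← dec-input inn (decodeₚ d' Qθ (nameTm π″) z (z∉ ∘ ∈-++⁺ʳ (fnP Pθ))
             (λ p q → nameTm-inj π″ (seen (there (Qθ⊆ p))) (seen (there (Qθ⊆ q)))) ≈refl)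
      with refl ← nameTm-inj π″ (seen (there (Pθ⊆ (act-fn t (here refl)))))
                             (seen (there (Qθ⊆ (act-fn t' (here refl))))) hx =
        openP C z , t' , conf π″ irr' cov″ (seen ∘ rel) (Good-mono π″ (λ _ → rel) (λ p → p) good″)
          (LB-≈ (≈sym (abs-β B z) ∷ ≈sym (≈trans (≈app hq ≈refl) (abs-β C z)) ∷ []) (l (nameTm π″ z)))
      where
      old : ∀ {S S' w} → S —[ binA x z ]→ S' → (∀ {v} → v ∈ fnP S → v ∈ N) → w ∈ fnP S' → w ∈ z ∷ N
      old u f p with res-fn u p
      ... | inj₁ q           = there (f q)
      ... | inj₂ (here refl) = here refl
      rel : ∀ {w} → w ∈ Rel Dθ P' (openP C z) → w ∈ z ∷ N
      rel = Rel-elim Dθ P' (openP C z) (old t Pθ⊆) (old t' Qθ⊆)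
              (λ p → there (proj₁ (Dθ⊆ p)) , there (proj₂ (Dθ⊆ p)))

    add-z : z ∉ names π' → ∃[ Q' ] (Qθ —[ binA x z ]→ Q' × Conf Dθ P' Q')
    add-z z∉π' = reply π″ (λ p → there (proj₁ (cov' p)) , there (proj₂ (cov' p))) (wk ∘M m)
      (further P P-moved (N⊆ ∘ Pθ⊆)) (further Q Q-moved (N⊆ ∘ Qθ⊆))
      (λ { (here refl) → here refl ; (there p) → there (N⊆ p) }) good-z
      where
      π″ : Cfg σ
      π″ = allC z π'
      old-name : ∀ {w} → w ∈ names π' → nameTm π″ w ≡ ren (liftRN σ there) (nameTm π' w)
      old-name p = nameTm-all-≢ π' λ { refl → z∉π' p }
      wk : Mor W' (worldOf π″ Dθ irr' (λ p → there (proj₁ (cov' p)) , there (proj₂ (cov' p))))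
      wk .η v = var (there v)
      wk .pres κ' sat p h = sat p (≈trans (along (proj₁ (cov' p))) (≈trans h (≈sym (along (proj₂ (cov' p))))))
        where
        along : ∀ {w} → w ∈ names π' →
                sub (liftSN σ κ') (nameTm π″ w) ≈ sub (liftSN σ (λ v → κ' (there v))) (nameTm π' w)
        along {w} p = ≡⇒≈ (trans (cong (sub (liftSN σ κ')) (old-name p))
          (trans (sub-ren (nameTm π' w)) (sub-cong (liftSN-ren σ κ' there) (nameTm π' w))))
      further : ∀ S → ⟦ substP θ S ⟧ (nameTm π') ≈ sub (liftSN σ κ) (⟦ S ⟧ (nameTm π)) →
                (∀ {w} → w ∈ fnP (substP θ S) → w ∈ names π') →
                ⟦ substP θ S ⟧ (nameTm π″) ≈ sub (liftSN σ (η (wk ∘M m))) (⟦ S ⟧ (nameTm π))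
      further S h f = ≈trans (enc-≈ (substP θ S) (agree≈ (λ ()) λ p → ≡⇒≈ (old-name (f p))))
        (≈trans (≈sym (ren-enc (substP θ S))) (≈trans (ren-≈ h) (≡⇒≈ (trans (ren-sub (⟦ S ⟧ (nameTm π)))
          (sub-cong pt (⟦ S ⟧ (nameTm π)))))))
        where
        pt : ∀ {τ} (v : (σ ++ glob π) ∋ τ) → ren (liftRN σ there) (liftSN σ κ v) ≡ liftSN σ (η (wk ∘M m)) v
        pt v = trans (ren-liftSN σ there κ v) (liftSN-cong σ (λ u → sym (sub-ren-var (κ u))) v)

    answer : ∃[ Q' ] (Qθ —[ binA x z ]→ Q' × Conf Dθ P' Q')
    answer with z ∈? names π'
    -- Here z occurs in `Dθ`, though in neither process. Its existing term carries the inequations,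
    -- so no fresh variable may replace it.
    ... | yes z∈ = reply π' cov' m P-moved Q-moved (λ { (here refl) → z∈ ; (there p) → N⊆ p }) good-z
    ... | no n   = add-z n

  -- The ∇ of the clause makes z a new local variable, out of reach for every later instance of the
  -- older eigenvariables. The pairs added to the distinction express the same for the relevant
  -- names.
  module Bout {x z : ℕ} {P' : Proc 0} (z∉ : z ∉ fnP (substP θ P) ++ fnP (substP θ Q))
    (t : substP θ P —[ boutA x z ]→ P') where
    open Conf c using (π; σ; halfˡ)
    open Moved c θ resp z

    D″ : Dist
    D″ = extD Dθ z (fnP Pθ ++ fnP Qθ ++ fnD Dθ)

    answer : ∃[ Q' ] (Qθ —[ boutA x z ]→ Q' × (Irrefl D″ → Conf D″ P' Q'))
    answer
      with absOf B z∉B refl d ← encode-step t {glob π'} {σ} (nameTm π')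
      with q' , d' , l ← Half.outp halfˡ m P-moved Q-moved d
      with x' , C , hx , t' , z∉C , hq ← dec-input out (decodeₚ d' Qθ (nameTm π') z (z∉ ∘ ∈-++⁺ʳ (fnP Pθ)) Qθ-inj ≈refl)
      with refl ← nameTm-inj π' (N⊆ (Pθ⊆ (act-fn t (here refl)))) (N⊆ (Qθ⊆ (act-fn t' (here refl)))) hx =
        openP C z , t' , λ irr″ → conf (nabC z π') irr″ (cov″ irr″) (seen ∘ rel) (good″ irr″)
          (LB-≈ (≈trans (enc-open B z∉B) (≈sym (≈trans (id-loc _) (lam-wk-β _))) ∷
                 ≈trans (enc-open C z∉C) (≈sym (≈trans (id-loc _) (abs-wk-β C hq))) ∷ [])
            (LB-mono (grow irr″) l))
      where
      id-loc : ∀ {τ} (u : Tm (nT ∷ σ ++ glob π') τ) → sub (liftSN (nT ∷ σ) {glob π'} var) u ≈ u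
      id-loc u = ≡⇒≈ (sub-id (liftSN-var (nT ∷ σ)) u)
      fnD″ : ∀ {a b} → (a , b) ∈ D″ → a ∈ z ∷ N × b ∈ z ∷ N
      fnD″ p with extD-⁻ Dθ {z} {fnP Pθ ++ fnP Qθ ++ fnD Dθ} p
      ... | inj₁ q                 = there (proj₁ (Dθ⊆ q)) , there (proj₂ (Dθ⊆ q))
      ... | inj₂ (inj₁ (refl , q)) = here refl , there (Rel-elim Dθ Pθ Qθ Pθ⊆ Qθ⊆ Dθ⊆ q)
      ... | inj₂ (inj₂ (q , refl)) = there (Rel-elim Dθ Pθ Qθ Pθ⊆ Qθ⊆ Dθ⊆ q) , here refl
      old : ∀ {S S' w} → S —[ boutA x z ]→ S' → (∀ {v} → v ∈ fnP S → v ∈ N) → w ∈ fnP S' → w ∈ z ∷ N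
      old u f p with res-fn u p
      ... | inj₁ q           = there (f q)
      ... | inj₂ (here refl) = here refl
      rel : ∀ {w} → w ∈ Rel D″ P' (openP C z) → w ∈ z ∷ N
      rel = Rel-elim D″ P' (openP C z) (old t Pθ⊆) (old t' Qθ⊆) fnD″
      seen : ∀ {w} → w ∈ z ∷ N → w ∈ z ∷ names π'
      seen (here refl) = here refl
      seen (there p)   = there (N⊆ p)
      module _ (irr″ : Irrefl D″) where
        -- A relevant z would put (z , z) into `D″`.
        z-new : z ∉ N
        z-new p = irr″ (proj₁ (extD-⁺ Dθ {z} (N-rel p)))
        old-only : ∀ {w} → w ∈ names π' → w ∈ z ∷ N → w ∈ N
        old-only p (here refl) = z-relevant p
        old-only p (there q)   = q
        cov″ : Covers (nabC z π') D″
        cov″ p = seen (proj₁ (fnD″ p)) , seen (proj₂ (fnD″ p))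
        good″ : Good (Rel D″ P' (openP C z)) D″ (nabC z π')
        good″ = (λ _ p q → proj₂ (extD-⁺ Dθ {z} (N-rel (old-only p (rel q))))) ,
                Good-mono π' (λ p q → old-only p (rel q)) ∈-++⁺ˡ good'
        -- The eigenvariables stay while the local signature of the world grows by z. An equation
        -- between old names would persist under this weakening, so the old inequations remain
        -- enforced.
        grow : Mor W' (worldOf (nabC z π') D″ irr″ cov″)
        grow .η = var
        grow .pres κ' sat p h = sat (∈-++⁺ˡ p)
          (≈trans (along (proj₁ (Dθ⊆ p))) (≈trans (ren-≈ h) (≈sym (along (proj₂ (Dθ⊆ p))))))
          where
          along : ∀ {w} → w ∈ N →
                  sub (liftSN (nT ∷ σ) κ') (nameTm (nabC z π') w) ≈ ren there (sub (liftSN σ κ') (nameTm π' w))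
          along {w} q = ≡⇒≈ (trans (cong (sub _) (bind-≢ (nameTm π') λ { refl → z-new q }))
            (trans (sub-ren (nameTm π' w)) (sym (ren-sub (nameTm π' w)))))

-- The condition can be discharged in every clause with a transition: a substitution that respects D
-- exists only if D is irreflexive.
Bisim : Dist → Proc 0 → Proc 0 → Set
Bisim D P Q = Irrefl D → Conf D P Q

respects-irrefl : ∀ {θ D} → Respects θ D → Irrefl D
respects-irrefl resp p = resp p refl

isOpenBisim : IsOpenBisim Bisim
isOpenBisim = record
  { symm = λ s irr → Conf-sym (s irr)
  ; free = λ θ resp s f t →
      let Q' , t' , c = answer-free (s (respects-irrefl resp)) θ resp f t in Q' , t' , λ _ → c
  ; bin  = λ θ resp s z∉ t →
      let Q' , t' , c = Bin.answer (s (respects-irrefl resp)) θ resp z∉ t in Q' , t' , λ _ → c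
  ; bout = λ θ resp s z∉ t → Bout.answer (s (respects-irrefl resp)) θ resp z∉ t
  }

-- From the encoded formula to the bisimulation

>>=-just : ∀ {A B : Set} (x : Maybe A) {f : A → Maybe B} {b} → (x >>= f) ≡ just b → Σ[ a ∈ A ] (x ≡ just a × f a ≡ just b)
>>=-just (just a) e = a , refl , e

map-just : ∀ {A B : Set} (x : Maybe A) {f : A → B} {b} → Maybe.map f x ≡ just b → Σ[ a ∈ A ] (x ≡ just a × f a ≡ b)
map-just (just a) refl = a , refl , refl

-- Bridge from the partial environments in which the formula is encoded to the total ones of a
-- configuration.
record Carries {Γ Δ k} (s : Sub Γ Δ) (ρ : Env Γ) (β : Fin k → Tm Γ nT) (e : NmEnv k Δ) : Set where
  constructor carries
  field
    on-free  : ∀ {x t} → ρ x ≡ just t → sub s t ≈ e (fr x)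
    on-bound : ∀ i → sub s (β i) ≈ e (bv i)

carries-ext : ∀ {Γ Δ k} {s : Sub Γ Δ} {ρ : Env Γ} {β : Fin k → Tm Γ nT} {e} → Carries s ρ β e →
              Carries (liftS {σ = nT} s) (wkEnv ρ) (extBv β) (extN e)
carries-ext {s = s} {ρ} {β} (carries f g) = carries
  (λ {x} {t} eq → on-free (map-just (ρ x) eq))
  (λ { zero → ≈refl ; (suc i) → ≈trans (≡⇒≈ (sub-wk (β i))) (ren-≈ (g i)) })
  where
  on-free : ∀ {x t} → Σ[ a ∈ _ ] (ρ x ≡ just a × ren there a ≡ t) → sub (liftS s) t ≈ _
  on-free (a , e , refl) = ≈trans (≡⇒≈ (sub-wk a)) (ren-≈ (f e))

encNm-carried : ∀ {Γ Δ k} {s : Sub Γ Δ} {ρ : Env Γ} {β : Fin k → Tm Γ nT} {e} → Carries s ρ β e →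
                ∀ n {t} → encNm ρ β n ≡ just t → sub s t ≈ e n
encNm-carried (carries f g) (fr x) eq   = f eq
encNm-carried (carries f g) (bv i) refl = g i

encP-carried : ∀ {Γ Δ k} {s : Sub Γ Δ} {ρ : Env Γ} {β : Fin k → Tm Γ nT} {e} → Carries s ρ β e →
               ∀ P {t} → encP ρ β P ≡ just t → sub s t ≈ enc e P
encP-carried c nil refl = ≈refl
encP-carried {ρ = ρ} {β} c (tauP P) eq with >>=-just (encP ρ β P) eq
... | p , e₁ , refl = ≈app ≈refl (encP-carried c P e₁)
encP-carried {ρ = ρ} {β} c (outP x y P) eq
  with x' , ex , eq₁ ← >>=-just (encNm ρ β x) eq
  with y' , ey , eq₂ ← >>=-just (encNm ρ β y) eq₁
  with p , e₁ , refl ← >>=-just (encP ρ β P) eq₂ =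
  ≈app (≈app (≈app ≈refl (encNm-carried c x ex)) (encNm-carried c y ey)) (encP-carried c P e₁)
encP-carried {ρ = ρ} {β} c (inP x P) eq
  with x' , ex , eq₁ ← >>=-just (encNm ρ β x) eq
  with p , e₁ , refl ← >>=-just (encP (wkEnv ρ) (extBv β) P) eq₁ =
  ≈app (≈app ≈refl (encNm-carried c x ex)) (≈lam (encP-carried (carries-ext c) P e₁))
encP-carried {ρ = ρ} {β} c (resP P) eq with >>=-just (encP (wkEnv ρ) (extBv β) P) eq
... | p , e₁ , refl = ≈app ≈refl (≈lam (encP-carried (carries-ext c) P e₁))
encP-carried {ρ = ρ} {β} c (matchP x y P) eq
  with x' , ex , eq₁ ← >>=-just (encNm ρ β x) eq
  with y' , ey , eq₂ ← >>=-just (encNm ρ β y) eq₁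
  with p , e₁ , refl ← >>=-just (encP ρ β P) eq₂ =
  ≈app (≈app (≈app ≈refl (encNm-carried c x ex)) (encNm-carried c y ey)) (encP-carried c P e₁)
encP-carried {ρ = ρ} {β} c (P ∣ Q) eq
  with p , e₁ , eq₁ ← >>=-just (encP ρ β P) eq
  with q , e₂ , refl ← >>=-just (encP ρ β Q) eq₁ =
  ≈app (≈app ≈refl (encP-carried c P e₁)) (encP-carried c Q e₂)
encP-carried {ρ = ρ} {β} c (P ⊕ Q) eq
  with p , e₁ , eq₁ ← >>=-just (encP ρ β P) eq
  with q , e₂ , refl ← >>=-just (encP ρ β Q) eq₁ =
  ≈app (≈app ≈refl (encP-carried c P e₁)) (encP-carried c Q e₂)

-- [[D₀]] is forced because every future world is consistent.
encD-forced : ∀ {Γ} {ρ : Env Γ} (W : World) {s : Sub Γ (World.loc W ++ World.G W)} →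
              (∀ {x t} → ρ x ≡ just t → sub s t ≈ World.nm W x) →
              ∀ D₀ → (∀ {p} → p ∈ D₀ → p ∈ World.D W) → ∀ {F} → encD ρ D₀ ≡ just F → Force F W (World.loc W) s
encD-forced {Γ} {ρ} W {s} c = go
  where
  neq : ∀ {x y x' y'} → (x , y) ∈ World.D W → ρ x ≡ just x' → ρ y ≡ just y' → Force (neqF x' y') W (World.loc W) s
  neq {x} {y} {x'} {y'} p ex ey W' m (der c-eq u (h₁ ∷ h₂ ∷ []) _) =
    pres m var (World.consistent W') p (≈trans (≈sym (along ex)) (≈trans h₁ (≈trans (≈sym h₂) (along ey))))
    where
    σ = World.loc W
    along : ∀ {z z'} → ρ z ≡ just z' → sub (act m σ s) z' ≈ sub (liftSN σ (var ⊙ η m)) (World.nm W z)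
    along {z} {z'} ez = ≈trans (≡⇒≈ (sym (sub-sub z'))) (≈trans (sub-≈ (c ez))
      (sub-≈S (liftSN-≈S σ λ v → ≡⇒≈ (sym (sub-id (λ _ → refl) (η m v)))) (World.nm W z)))
  go : ∀ D₀ → (∀ {p} → p ∈ D₀ → p ∈ World.D W) → ∀ {F} → encD ρ D₀ ≡ just F → Force F W (World.loc W) s
  go [] i refl = tt
  go ((x , y) ∷ []) i eq
    with x' , ex , eq₁ ← >>=-just (ρ x) eq
    with y' , ey , refl ← >>=-just (ρ y) eq₁ = neq (i (here refl)) ex ey
  go ((x , y) ∷ d ∷ D₀) i eq
    with x' , ex , eq₁ ← >>=-just (ρ x) eq
    with y' , ey , eq₂ ← >>=-just (ρ y) eq₁
    with r , er , refl ← >>=-just (encD ρ (d ∷ D₀)) eq₂ =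
      neq (i (here refl)) ex ey , go (d ∷ D₀) (i ∘ there) er

dummy : ∀ {σ} (π : Cfg σ) → Tm (glob π) nT
dummy base       = var here
dummy (allC x π) = ren there (dummy π)
dummy (nabC y π) = dummy π

-- Used while the prefix is being read. It imposes no inequation, so every substitution out of it is
-- a morphism.
freeWorld : ∀ {σ} → Cfg σ → World
freeWorld π = record { G = glob π ; loc = [] ; nm = λ _ → dummy π ; D = [] ; consistent = λ () }

-- What `Good` asks for at a ∇: the distinction of a prefix separates a ∇-name from every name
-- before it, whatever the quantifier of the latter.
qdist-pair : ∀ q x pre {y} → (nabQ , y) ∈ pre → (x , y) ∈ qdist ((q , x) ∷ pre)
qdist-pair q x pre p = ∈-++⁺ˡ (go q pre p)
  where
  go : ∀ q pre {y} → (nabQ , y) ∈ pre →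
       (x , y) ∈ concatMap (λ qy → if qcond q (proj₁ qy) then (x , proj₂ qy) ∷ (proj₂ qy , x) ∷ [] else []) pre
  go allQ _ (here refl)          = here refl
  go nabQ _ (here refl)          = here refl
  go allQ ((allQ , _) ∷ pre) (there p) = go allQ pre p
  go allQ ((nabQ , _) ∷ pre) (there p) = there (there (go allQ pre p))
  go nabQ ((allQ , _) ∷ pre) (there p) = go nabQ pre p
  go nabQ ((nabQ , _) ∷ pre) (there p) = there (there (go nabQ pre p))

qdist-names : ∀ pre {x y} → (x , y) ∈ qdist pre → x ∈ map proj₂ pre × y ∈ map proj₂ pre
qdist-names ((q , x) ∷ pre) p with ∈-++⁻ (concatMap _ pre) p
... | inj₂ r = there (proj₁ (qdist-names pre r)) , there (proj₂ (qdist-names pre r))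
... | inj₁ r = go q pre r
  where
  go : ∀ q pre {a b} →
       (a , b) ∈ concatMap (λ qy → if qcond q (proj₁ qy) then (x , proj₂ qy) ∷ (proj₂ qy , x) ∷ [] else []) pre →
       a ∈ x ∷ map proj₂ pre × b ∈ x ∷ map proj₂ pre
  skip : ∀ {a y} {L : List ℕ} → a ∈ x ∷ L → a ∈ x ∷ y ∷ L
  skip (here e)  = here e
  skip (there p) = there (there p)
  skip₂ : ∀ {a b y} {L : List ℕ} → a ∈ x ∷ L × b ∈ x ∷ L → a ∈ x ∷ y ∷ L × b ∈ x ∷ y ∷ L
  skip₂ (p , q) = skip p , skip q
  go allQ ((allQ , _) ∷ pre) p                   = skip₂ (go allQ pre p)
  go nabQ ((allQ , _) ∷ pre) p                   = skip₂ (go nabQ pre p)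
  go allQ ((nabQ , _) ∷ pre) (here refl)         = here refl , there (here refl)
  go allQ ((nabQ , _) ∷ pre) (there (here refl)) = there (here refl) , here refl
  go allQ ((nabQ , _) ∷ pre) (there (there p))   = skip₂ (go allQ pre p)
  go nabQ ((nabQ , _) ∷ pre) (here refl)         = here refl , there (here refl)
  go nabQ ((nabQ , _) ∷ pre) (there (here refl)) = there (here refl) , here refl
  go nabQ ((nabQ , _) ∷ pre) (there (there p))   = skip₂ (go nabQ pre p)

move-head : ∀ {w x : ℕ} {L L'} → w ∈ L ⊎ w ∈ x ∷ L' → w ∈ x ∷ L ⊎ w ∈ L'
move-head (inj₁ p)         = inj₁ (there p)
move-head (inj₂ (here e))  = inj₁ (here e)
move-head (inj₂ (there p)) = inj₂ p

module _ {P Q : Proc 0} {D T : Dist} (irr : Irrefl T) (D⊆T : ∀ {p} → p ∈ D → p ∈ T) where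

  -- Reads the prefix from the outside and builds the configuration on the way. The hypotheses
  -- record what is still owed: `T` separates the names read so far from the ∇-names to come, and
  -- each relevant name is bound already or will be.
  reach : ∀ pre {Γ σ} (π : Cfg σ) (ρ : Env Γ) {F} (s : Sub Γ (σ ++ glob π)) →
          encGoal ρ pre D P Q ≡ just F → Force F (freeWorld π) σ s →
          (∀ {x t} → ρ x ≡ just t → sub s t ≈ nameTm π x) →
          (∀ {x y} → x ∈ names π → (nabQ , y) ∈ pre → (x , y) ∈ T) →
          (∀ {p} → p ∈ qdist pre → p ∈ T) →
          (∀ {x} → x ∈ Rel T P Q → x ∈ names π ⊎ x ∈ map proj₂ pre) →
          Good (Rel T P Q) T π → Conf T P Q
  reach [] {Γ} {σ} π ρ s eq f c _ _ sees good
    with d , ed , eq₁ ← >>=-just (encD ρ D) eq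
    with p , ep , eq₂ ← >>=-just (encP ρ noBv P) eq₁
    with q , eq' , refl ← >>=-just (encP ρ noBv Q) eq₂ =
    conf π irr cov sees' good (LB-≈ (≈sym (encP-carried c'' P ep) ∷ ≈sym (encP-carried c'' Q eq') ∷ [])
      -- The world with the inequations `T` is a future of the free world, and [[D]] is forced
      -- there, so the implication fires.
      (f W m (encD-forced W c' D D⊆T ed)))
    where
    sees' : ∀ {x} → x ∈ Rel T P Q → x ∈ names π
    sees' p with sees p
    ... | inj₁ q = q
    cov : Covers π T
    cov p = sees' (∈-++⁺ʳ (fnP P) (∈-++⁺ʳ (fnP Q) (proj₁ (fnD-∈ p)))) ,
            sees' (∈-++⁺ʳ (fnP P) (∈-++⁺ʳ (fnP Q) (proj₂ (fnD-∈ p))))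
    W : World
    W = worldOf π T irr cov
    m : Mor (freeWorld π) W
    m .η = var
    m .pres κ sat ()
    c' : ∀ {x t} → ρ x ≡ just t → sub (act m σ s) t ≈ nameTm π x
    c' {t = t} e = ≈trans (sub-≈S (act-id {freeWorld π} σ s) t) (c e)
    c'' : Carries (act m σ s) ρ noBv (nmE (nameTm π))
    c'' = carries c' (λ ())
  reach ((allQ , x) ∷ pre) {σ = σ} π ρ s eq f c b q sees good
    with F' , eF , refl ← map-just (encGoal (bindName x ρ) pre D P Q) eq =
    -- The ∀ is instantiated by a new eigenvariable, raised over the ∇-names read so far.
    reach pre (allC x π) (bindName x ρ) (ext (act m σ s) (raised σ)) eF (f (freeWorld (allC x π)) m (raised σ))
      c'
      (λ { (here refl) p → q (qdist-pair allQ x pre p) ; (there r) p → b r (there p) })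
      (q ∘ ∈-++⁺ʳ _)
      (λ p → move-head (sees p)) good
    where
    m : Mor (freeWorld π) (freeWorld (allC x π))
    m .η v = var (there v)
    m .pres κ sat ()
    old : ∀ {y t} → Σ[ a ∈ _ ] (ρ y ≡ just a × ren there a ≡ t) →
          sub (ext (act m σ s) (raised σ)) t ≈ ren (liftRN σ there) (nameTm π y)
    old (a , e , refl) = ≈trans (≡⇒≈ (trans (sub-ren a) (sym (sub-sub a))))
      (≈trans (sub-≈ (c e)) (≡⇒≈ (trans (sub-cong there-liftSN (nameTm π _)) (sub-ren-var (nameTm π _)))))
      where
      there-liftSN : ∀ {τ} (v : (σ ++ glob π) ∋ τ) →
        liftSN σ {glob π} {raiseTy σ nT ∷ glob π} (λ w → var (there w)) v ≡ var (liftRN σ there v)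
      there-liftSN v = trans (sym (liftSN-ren σ var there v)) (liftSN-var σ (liftRN σ there v))
    c' : ∀ {y t} → bindName x ρ y ≡ just t → sub (ext (act m σ s) (raised σ)) t ≈ nameTm (allC x π) y
    c' {y} e with y ≡ᵇ x | e
    ... | true  | refl = ≈refl
    ... | false | e'   = old (map-just (ρ y) e')
  reach ((nabQ , x) ∷ pre) {σ = σ} π ρ s eq f c b q sees good
    with F' , eF , refl ← map-just (encGoal (bindName x ρ) pre D P Q) eq =
    reach pre (nabC x π) (bindName x ρ) (liftS s) eF f
      c'
      (λ { (here refl) p → q (qdist-pair nabQ x pre p) ; (there r) p → b r (there p) })
      (q ∘ ∈-++⁺ʳ _)
      (λ p → move-head (sees p)) ((λ _ p _ → b p (here refl)) , good)
    where
    old : ∀ {y t} → Σ[ a ∈ _ ] (ρ y ≡ just a × ren there a ≡ t) → sub (liftS s) t ≈ ren there (nameTm π y)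
    old (a , e , refl) = ≈trans (≡⇒≈ (sub-wk a)) (ren-≈ (c e))
    c' : ∀ {y t} → bindName x ρ y ≡ just t → sub (liftS s) t ≈ bind x (nameTm π) y
    c' {y} e with y ≡ᵇ x | e
    ... | true  | refl = ≈refl
    ... | false | e'   = old (map-just (ρ y) e')

theorem5p10 : (P Q : Proc 0) (D : Dist) (pre : Prefix) →
    IsDistinction D →
    Unique (map proj₂ pre) →
    (∀ {x} → x ∈ fnP P ++ fnP Q ++ fnD D → x ∈ map proj₂ pre) →
    (F : Fm []) → encGoal emptyEnv pre D P Q ≡ just F →
    ⊢ F →
    P ∼o[ D ++ qdist pre ] Q
theorem5p10 P Q D pre _ _ closed F eF proof = Bisim , isOpenBisim , λ irr →
  -- No name has been read yet, so all relevant names are still to come, and the signature consists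
  -- of the dummy name alone.
  reach {P} {Q} {D} irr ∈-++⁺ˡ pre base emptyEnv (liftSN [] none) eF
    (sound proof (freeWorld base) none (λ ())) (λ ()) (λ ()) (∈-++⁺ʳ D) (inj₂ ∘ covered) tt
  where
  none : Sub [] (nT ∷ [])
  none ()
  D-names : ∀ {x y} → (x , y) ∈ D ++ qdist pre → x ∈ map proj₂ pre × y ∈ map proj₂ pre
  D-names p with ∈-++⁻ D p
  ... | inj₂ q = qdist-names pre q
  ... | inj₁ q = closed (∈-++⁺ʳ (fnP P) (∈-++⁺ʳ (fnP Q) (proj₁ (fnD-∈ q)))) ,
                 closed (∈-++⁺ʳ (fnP P) (∈-++⁺ʳ (fnP Q) (proj₂ (fnD-∈ q))))
  covered : ∀ {x} → x ∈ Rel (D ++ qdist pre) P Q → x ∈ map proj₂ pre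
  covered = Rel-elim (D ++ qdist pre) P Q (closed ∘ ∈-++⁺ˡ) (closed ∘ ∈-++⁺ʳ (fnP P) ∘ ∈-++⁺ˡ) D-names
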